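{- There exist a family of functions $f=f_n\colon\{0,1\}^n\to\{0,1\}$ and of ($0$-biased) product distributions $\mu=\mu_n$ over $\{0,1\}^n$ such that, as $n\to\infty$, $$\mathsf{D}^\times(f)=\Theta(\mathsf{disc}(f,\mu))=\Theta(\log n)\qquad\text{and}\qquad \mathsf{S}_0(f,\mu)=\Theta(1).$$
   Context: Inner products are over $\mathbb{F}_2$: $\langle a,x\rangle=\sum_i a_ix_i \bmod 2$. A deterministic parity decision tree $T$ on $\{0,1\}^n$ is a rooted binary tree in which every internal node is labelled by a vector $a\in\{0,1\}^n$ (the query $\langle a,x\rangle$) and has two children, one for each outcome in $\{0,1\}$, and every leaf is labelled by an output bit; $T(x)$ is the label of the leaf reached on input $x$, and $q(T,x)$ is the number of queries made by $T$ on $x$; the depth of $T$ is the maximum of $q(T,x)$ over root-to-leaf paths. A randomised parity decision tree $\mathcal{T}$ is a probability distribution over deterministic ones. For a distribution $\nu$ on $\{0,1\}^n$, $\overline{q}(\mathcal{T},\nu)=\mathbb{E}_{T\sim\mathcal{T},x\sim\nu}[q(T,x)]$ and $\mathrm{err}_f(\mathcal{T},\nu)=\Pr_{T\sim\mathcal{T},x\sim\nu}[T(x)\ne f(x)]$. $\mathsf{D}_\epsilon(f,\nu)$ is the least depth of a deterministic parity decision tree $T$ with $\Pr_{x\sim\nu}[T(x)\ne f(x)]\le\epsilon$. A distribution on $\{0,1\}^n$ is product if it is a product of $n$ independent Bernoulli distributions. $\mathsf{D}^\times(f)=\max_{\nu\text{ product}}\mathsf{D}_{1/3}(f,\nu)$.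 $\mathsf{disc}(f,\mu)=-\log_2\max_S\left|\sum_{x\in S}(-1)^{f(x)}\mu(x)\right|$, the maximum over all affine subspaces $S$ of $\{0,1\}^n=\mathbb{F}_2^n$. A product distribution $\mu$ is $0$-biased if $\Pr_{x\sim\mu}[x_i=0]\ge 1/2$ for every $i$. For such $\mu$ put $\delta_i=2\Pr_{x\sim\mu}[x_i=1]\in[0,1]$. The random partial fixing $\mathcal{R}_\mu$ is the distribution of $\rho\in\{0,\star\}^n$ with independent coordinates, $\rho_i=0$ with probability $1-\delta_i$ and $\rho_i=\star$ with probability $\delta_i$. $\mathcal{U}_\rho$ is the uniform distribution on $\{x\in\{0,1\}^n: x_i=0 \text{ whenever }\rho_i=0\}$. For a deterministic tree $T$ and $\rho\in\{0,\star\}^n$, $T_\rho$ is the tree obtained from $T$ by fixing $x_i=0$ for all $i$ with $\rho_i=0$ (so each query is restricted to the coordinates with $\rho_i=\star$) and then removing redundant queries, i.e. those whose restricted query vector is an $\mathbb{F}_2$-linear combination of the restricted query vectors made earlier on the path (their answers are determined by the earlier ones). For randomised $\mathcal{T}$, $\mathcal{T}_\rho$ is the distribution of $T_\rho$ with $T\sim\mathcal{T}$. Skew average cost: $\overline{sq}(\mathcal{T},\mu)=\mathbb{E}_{\rho\sim\mathcal{R}_\mu}[\overline{q}(\mathcal{T}_\rho,\mathcal{U}_\rho)]$. Skew measure: $\mathsf{S}_\epsilon(f,\mu)=\min_{\mathcal{T}}\{\overline{sq}(\mathcal{T},\mu):\mathrm{err}_f(\mathcal{T},\mu)\le\epsilon\}$,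 the minimum over randomised parity decision trees. -}

module Defs where

open import Data.Bool using (Bool; true; false; if_then_else_; not; _∧_; _xor_)
import Data.Bool.Properties as Bool
open import Data.Fin using (Fin)
open import Data.Integer using (ℤ; +_; -[1+_])
open import Data.List using (List; []; _∷_)
open import Data.Maybe as Maybe using (Maybe; just; nothing; maybe′; _<∣>_)
open import Data.Nat as ℕ using (ℕ; zero; suc)
import Data.Nat.Properties as ℕ
open import Data.Product using (Σ; ∃; ∃₂; _×_; _,_)
open import Data.Rational as ℚ using (ℚ; 0ℚ; 1ℚ; ½; Positive)
import Data.Rational.Properties as ℚ
open import Data.Rational.Solver using (module +-*-Solver)
open import Data.Sum using (inj₁; inj₂)
open import Data.Vec as Vec using (Vec; []; _∷_)
open import Data.Vec.Functional using (foldr)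
open import Data.Vec.Properties using (≡-dec)
open import Function using (_∘_)
open import Relation.Binary.PropositionalEquality
  using (_≡_; refl; sym; trans; cong; subst)
open import Relation.Nullary.Decidable using (⌊_⌋)

-- Real numbers: Cauchy sequences of rationals with a modulus.  All
-- operations are pointwise; equality is `_≈_`, not `_≡_`.

Cauchy : (ℕ → ℚ) → Set
Cauchy s = ∀ ε .{{_ : Positive ε}} →
  ∃ λ N → ∀ m n → N ℕ.≤ m → N ℕ.≤ n → ℚ.∣ s m ℚ.- s n ∣ ℚ.≤ ε

record ℝ : Set where
  constructor mkℝ
  field
    seq    : ℕ → ℚ
    cauchy : Cauchy seq

open ℝ public

private
  module Identities where
    open import Data.Rational using (_+_; _*_; _-_; -_)
    open +-*-Solver

    +-minus : ∀ a b c d → (a + b) - (c + d) ≡ (a - c) + (b - d)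
    +-minus = solve 4 (λ a b c d → (a :+ b) :- (c :+ d) := (a :- c) :+ (b :- d)) refl

    *-minus : ∀ a b c d → a * b - c * d ≡ a * (b - d) + d * (a - c)
    *-minus = solve 4
      (λ a b c d → a :* b :- c :* d := a :* (b :- d) :+ d :* (a :- c)) refl

    neg-minus : ∀ a b → (- a) - (- b) ≡ - (a - b)
    neg-minus = solve 2 (λ a b → (:- a) :- (:- b) := :- (a :- b)) refl

    flip : ∀ a b → - (a - b) ≡ b - a
    flip = solve 2 (λ a b → :- (a :- b) := b :- a) refl

    split : ∀ a b → a ≡ b + (a - b)
    split = solve 2 (λ a b → a := b :+ (a :- b)) refl

    cancel : ∀ b e → (b + e) - b ≡ e
    cancel = solve 2 (λ b e → (b :+ e) :- b := e) refl

    swap : ∀ b e i → b * (e * i) ≡ e * (b * i)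
    swap = solve 3 (λ b e i → b :* (e :* i) := e :* (b :* i)) refl

  open Identities

  ½ε+½ε : ∀ ε → ½ ℚ.* ε ℚ.+ ½ ℚ.* ε ≡ ε
  ½ε+½ε ε = trans (sym (ℚ.*-distribʳ-+ ε ½ ½)) (ℚ.*-identityˡ ε)

  const-cauchy : ∀ q → Cauchy (λ _ → q)
  const-cauchy q ε = 0 , λ _ _ _ _ →
    subst (ℚ._≤ ε) (cong ℚ.∣_∣ (sym (ℚ.+-inverseʳ q)))
      (ℚ.<⇒≤ (ℚ.positive⁻¹ ε))

  +-cauchy : ∀ {s t} → Cauchy s → Cauchy t → Cauchy (λ k → s k ℚ.+ t k)
  +-cauchy {s} {t} cs ct ε
    with cs (½ ℚ.* ε) {{ℚ.pos*pos⇒pos ½ ε}} | ct (½ ℚ.* ε) {{ℚ.pos*pos⇒pos ½ ε}}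
  ... | M , hM | N , hN = M ℕ.⊔ N , λ m n m≥ n≥ → begin
      ℚ.∣ (s m ℚ.+ t m) ℚ.- (s n ℚ.+ t n) ∣
        ≡⟨ cong ℚ.∣_∣ (+-minus (s m) (t m) (s n) (t n)) ⟩
      ℚ.∣ (s m ℚ.- s n) ℚ.+ (t m ℚ.- t n) ∣
        ≤⟨ ℚ.∣p+q∣≤∣p∣+∣q∣ (s m ℚ.- s n) (t m ℚ.- t n) ⟩
      ℚ.∣ s m ℚ.- s n ∣ ℚ.+ ℚ.∣ t m ℚ.- t n ∣
        ≤⟨ ℚ.+-mono-≤
             (hM m n (ℕ.m⊔n≤o⇒m≤o M N m≥) (ℕ.m⊔n≤o⇒m≤o M N n≥))
             (hN m n (ℕ.m⊔n≤o⇒n≤o M N m≥) (ℕ.m⊔n≤o⇒n≤o M N n≥)) ⟩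
      ½ ℚ.* ε ℚ.+ ½ ℚ.* ε
        ≡⟨ ½ε+½ε ε ⟩
      ε ∎
    where open ℚ.≤-Reasoning

  neg-cauchy : ∀ {s} → Cauchy s → Cauchy (λ k → ℚ.- s k)
  neg-cauchy {s} cs ε with cs ε
  ... | N , h = N , λ m n m≥ n≥ → subst (ℚ._≤ ε) (sym (eq m n)) (h m n m≥ n≥)
    where
    eq : ∀ m n → ℚ.∣ ℚ.- s m ℚ.- (ℚ.- s n) ∣ ≡ ℚ.∣ s m ℚ.- s n ∣
    eq m n = trans
      (cong ℚ.∣_∣ (neg-minus (s m) (s n)))
      (ℚ.∣-p∣≡∣p∣ (s m ℚ.- s n))

  ∣p∣≤∣q∣+∣p-q∣ : ∀ p q → ℚ.∣ p ∣ ℚ.≤ ℚ.∣ q ∣ ℚ.+ ℚ.∣ p ℚ.- q ∣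
  ∣p∣≤∣q∣+∣p-q∣ p q = begin
      ℚ.∣ p ∣                      ≡⟨ cong ℚ.∣_∣ (split p q) ⟩
      ℚ.∣ q ℚ.+ (p ℚ.- q) ∣        ≤⟨ ℚ.∣p+q∣≤∣p∣+∣q∣ q (p ℚ.- q) ⟩
      ℚ.∣ q ∣ ℚ.+ ℚ.∣ p ℚ.- q ∣    ∎
    where open ℚ.≤-Reasoning

  abs-cauchy : ∀ {s} → Cauchy s → Cauchy (λ k → ℚ.∣ s k ∣)
  abs-cauchy {s} cs ε with cs ε
  ... | N , h = N , λ m n m≥ n≥ → bound (ℚ.∣ s m ∣) (ℚ.∣ s n ∣)
          (ℚ.≤-trans (∣p∣≤∣q∣+∣p-q∣ (s m) (s n))
            (ℚ.+-monoʳ-≤ ℚ.∣ s n ∣ (h m n m≥ n≥)))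
          (ℚ.≤-trans (∣p∣≤∣q∣+∣p-q∣ (s n) (s m))
            (ℚ.+-monoʳ-≤ ℚ.∣ s m ∣ (h n m n≥ m≥)))
    where
    diff : ∀ a b → a ℚ.≤ b ℚ.+ ε → a ℚ.- b ℚ.≤ ε
    diff a b a≤ = subst (a ℚ.- b ℚ.≤_)
      (cancel b ε)
      (ℚ.+-monoˡ-≤ (ℚ.- b) a≤)
    bound : ∀ a b → a ℚ.≤ b ℚ.+ ε → b ℚ.≤ a ℚ.+ ε → ℚ.∣ a ℚ.- b ∣ ℚ.≤ ε
    bound a b a≤ b≤ with ℚ.∣p∣≡p∨∣p∣≡-p (a ℚ.- b)
    ... | inj₁ e = subst (ℚ._≤ ε) (sym e) (diff a b a≤)
    ... | inj₂ e = subst (ℚ._≤ ε)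
      (sym (trans e (flip a b)))
      (diff b a b≤)

  eventually-bounded : ∀ {s} → Cauchy s →
    ∃₂ λ B N → Positive B × (∀ n → N ℕ.≤ n → ℚ.∣ s n ∣ ℚ.≤ B)
  eventually-bounded {s} cs with cs 1ℚ
  ... | N , h = ℚ.∣ s N ∣ ℚ.+ 1ℚ , N
      , ℚ.positive (ℚ.+-mono-≤-< (ℚ.0≤∣p∣ (s N)) (ℚ.positive⁻¹ 1ℚ))
      , λ n n≥ → ℚ.≤-trans (∣p∣≤∣q∣+∣p-q∣ (s n) (s N))
          (ℚ.+-monoʳ-≤ ℚ.∣ s N ∣ (h n N n≥ ℕ.≤-refl))

  scaled : ∀ B → .{{_ : Positive B}} → ℚ → ℚ
  scaled B ε = (½ ℚ.* ε) ℚ.* (ℚ.1/ B) {{ℚ.pos⇒nonZero B}}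

  scaled-pos : ∀ B → .{{_ : Positive B}} → ∀ ε → .{{_ : Positive ε}} →
    Positive (scaled B ε)
  scaled-pos B ε = ℚ.pos*pos⇒pos (½ ℚ.* ε) {{ℚ.pos*pos⇒pos ½ ε}}
    ((ℚ.1/ B) {{ℚ.pos⇒nonZero B}}) {{ℚ.1/pos⇒pos B}}

  bounded-* : ∀ B → .{{_ : Positive B}} → ∀ ε p q →
    ℚ.∣ p ∣ ℚ.≤ B → ℚ.∣ q ∣ ℚ.≤ scaled B ε →
    ℚ.∣ p ℚ.* q ∣ ℚ.≤ ½ ℚ.* ε
  bounded-* B ε p q p≤ q≤ = begin
      ℚ.∣ p ℚ.* q ∣         ≡⟨ ℚ.∣p*q∣≡∣p∣*∣q∣ p q ⟩
      ℚ.∣ p ∣ ℚ.* ℚ.∣ q ∣   ≤⟨ ℚ.*-monoʳ-≤-nonNeg ℚ.∣ q ∣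
                                 {{ℚ.∣-∣-nonNeg q}} p≤ ⟩
      B ℚ.* ℚ.∣ q ∣         ≤⟨ ℚ.*-monoˡ-≤-nonNeg B {{ℚ.pos⇒nonNeg B}} q≤ ⟩
      B ℚ.* scaled B ε      ≡⟨ swap B (½ ℚ.* ε) B⁻¹ ⟩
      ½ ℚ.* ε ℚ.* (B ℚ.* B⁻¹) ≡⟨ cong (½ ℚ.* ε ℚ.*_)
                                 (ℚ.*-inverseʳ B {{ℚ.pos⇒nonZero B}}) ⟩
      ½ ℚ.* ε ℚ.* 1ℚ        ≡⟨ ℚ.*-identityʳ (½ ℚ.* ε) ⟩
      ½ ℚ.* ε               ∎
    where
    open ℚ.≤-Reasoning
    B⁻¹ = (ℚ.1/ B) {{ℚ.pos⇒nonZero B}}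

  *-bound : ∀ A B → .{{_ : Positive A}} → .{{_ : Positive B}} → ∀ ε a b c d →
    ℚ.∣ a ∣ ℚ.≤ A → ℚ.∣ b ℚ.- d ∣ ℚ.≤ scaled A ε →
    ℚ.∣ d ∣ ℚ.≤ B → ℚ.∣ a ℚ.- c ∣ ℚ.≤ scaled B ε →
    ℚ.∣ a ℚ.* b ℚ.- c ℚ.* d ∣ ℚ.≤ ε
  *-bound A B ε a b c d a≤ b-d≤ d≤ a-c≤ = begin
      ℚ.∣ a ℚ.* b ℚ.- c ℚ.* d ∣
        ≡⟨ cong ℚ.∣_∣ (*-minus a b c d) ⟩
      ℚ.∣ a ℚ.* (b ℚ.- d) ℚ.+ d ℚ.* (a ℚ.- c) ∣
        ≤⟨ ℚ.∣p+q∣≤∣p∣+∣q∣ (a ℚ.* (b ℚ.- d)) (d ℚ.* (a ℚ.- c)) ⟩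
      ℚ.∣ a ℚ.* (b ℚ.- d) ∣ ℚ.+ ℚ.∣ d ℚ.* (a ℚ.- c) ∣
        ≤⟨ ℚ.+-mono-≤ (bounded-* A ε a (b ℚ.- d) a≤ b-d≤)
                      (bounded-* B ε d (a ℚ.- c) d≤ a-c≤) ⟩
      ½ ℚ.* ε ℚ.+ ½ ℚ.* ε
        ≡⟨ ½ε+½ε ε ⟩
      ε ∎
    where open ℚ.≤-Reasoning

  components : ∀ K L M N {k} → (K ℕ.⊔ L) ℕ.⊔ (M ℕ.⊔ N) ℕ.≤ k →
    K ℕ.≤ k × L ℕ.≤ k × M ℕ.≤ k × N ℕ.≤ k
  components K L M N h =
    let KL = ℕ.m⊔n≤o⇒m≤o (K ℕ.⊔ L) (M ℕ.⊔ N) h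
        MN = ℕ.m⊔n≤o⇒n≤o (K ℕ.⊔ L) (M ℕ.⊔ N) h
    in ℕ.m⊔n≤o⇒m≤o K L KL , ℕ.m⊔n≤o⇒n≤o K L KL
     , ℕ.m⊔n≤o⇒m≤o M N MN , ℕ.m⊔n≤o⇒n≤o M N MN

  *-cauchy : ∀ {s t} → Cauchy s → Cauchy t → Cauchy (λ k → s k ℚ.* t k)
  *-cauchy {s} {t} cs ct ε =
    let (A , K , A>0 , hA) = eventually-bounded {s} cs
        (B , L , B>0 , hB) = eventually-bounded {t} ct
        (M , hM) = cs (scaled B {{B>0}} ε) {{scaled-pos B {{B>0}} ε}}
        (N , hN) = ct (scaled A {{A>0}} ε) {{scaled-pos A {{A>0}} ε}}
    in (K ℕ.⊔ L) ℕ.⊔ (M ℕ.⊔ N) , λ m n m≥ n≥ →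
      let (K≤m , _ , M≤m , N≤m) = components K L M N m≥
          (_ , L≤n , M≤n , N≤n) = components K L M N n≥
      in *-bound A B {{A>0}} {{B>0}} ε (s m) (t m) (s n) (t n)
           (hA m K≤m) (hN m n N≤m N≤n) (hB n L≤n) (hM m n M≤m M≤n)

infixl 6 _+_ _-_
infixl 7 _*_
infixr 8 _^_
infix  4 _≤_ _≈_

fromℚ : ℚ → ℝ
seq    (fromℚ q) _ = q
cauchy (fromℚ q)   = const-cauchy q

fromℕ : ℕ → ℝ
fromℕ n = fromℚ (+ n ℚ./ 1)

_+_ : ℝ → ℝ → ℝ
seq    (x + y) k = seq x k ℚ.+ seq y k
cauchy (x + y)   = +-cauchy {seq x} {seq y} (cauchy x) (cauchy y)

-_ : ℝ → ℝ
seq    (- x) k = ℚ.- seq x k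
cauchy (- x)   = neg-cauchy {seq x} (cauchy x)

_-_ : ℝ → ℝ → ℝ
x - y = x + (- y)

_*_ : ℝ → ℝ → ℝ
seq    (x * y) k = seq x k ℚ.* seq y k
cauchy (x * y)   = *-cauchy {seq x} {seq y} (cauchy x) (cauchy y)

∣_∣ : ℝ → ℝ
seq    ∣ x ∣ k = ℚ.∣ seq x k ∣
cauchy ∣ x ∣   = abs-cauchy {seq x} (cauchy x)

0ℝ 1ℝ 2ℝ ½ℝ : ℝ
0ℝ = fromℚ 0ℚ
1ℝ = fromℚ 1ℚ
2ℝ = fromℕ 2
½ℝ = fromℚ ½

_^_ : ℝ → ℕ → ℝ
x ^ zero  = 1ℝ
x ^ suc k = x * x ^ k

record _≤_ (x y : ℝ) : Set where
  constructor mk≤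
  field
    eventually : ∀ ε .{{_ : Positive ε}} →
      ∃ λ N → ∀ n → N ℕ.≤ n → seq x n ℚ.≤ seq y n ℚ.+ ε

open _≤_ public

_≈_ : ℝ → ℝ → Set
x ≈ y = x ≤ y × y ≤ x

∑ ∏ : ∀ {m} → (Fin m → ℝ) → ℝ
∑ = foldr _+_ 0ℝ
∏ = foldr _*_ 1ℝ

-- Sum over all words of length n over the two-letter alphabet {a , b}.
∑ⱽ : ∀ {A : Set} → A → A → ∀ {n} → (Vec A n → ℝ) → ℝ
∑ⱽ a b {zero}  g = g []
∑ⱽ a b {suc n} g = ∑ⱽ a b (g ∘ (a ∷_)) + ∑ⱽ a b (g ∘ (b ∷_))

-- Extended reals given by their rational bounds: `lower X q` is q ≤ X and
-- `upper X q` is X ≤ q.  Extrema of arbitrary families and logarithms,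
-- which need not exist constructively as elements of ℝ, are taken here:
-- q ≤ max X iff q ≤ X i for some i, max X ≤ q iff X i ≤ q for all i (the
-- maxima and minima in question being attained), and dually for minima.

record Cut : Set₁ where
  field
    lower : ℚ → Set
    upper : ℚ → Set

open Cut public

infix  4 _≼_
infixr 7 _·_

_≼_ : Cut → Cut → Set
X ≼ Y = (∀ q → lower X q → lower Y q) × (∀ q → upper Y q → upper X q)

real : ℝ → Cut
real x = record { lower = λ q → fromℚ q ≤ x ; upper = λ q → x ≤ fromℚ q }

natural : ℕ → Cut
natural n = real (fromℕ n)

_·_ : (c : ℚ) .{{_ : Positive c}} → Cut → Cut
c · X = record
  { lower = λ q → lower X ((q ℚ.÷ c) {{ℚ.pos⇒nonZero c}})
  ; upper = λ q → upper X ((q ℚ.÷ c) {{ℚ.pos⇒nonZero c}}) }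

negate : Cut → Cut
negate X = record { lower = λ q → upper X (ℚ.- q) ; upper = λ q → lower X (ℚ.- q) }

maximum minimum : {I : Set} → (I → Cut) → Cut
maximum X = record
  { lower = λ q → ∃ λ i → lower (X i) q
  ; upper = λ q → ∀ i → upper (X i) q }
minimum X = record
  { lower = λ q → ∀ i → lower (X i) q
  ; upper = λ q → ∃ λ i → upper (X i) q }

2^_ : ℤ → ℝ
2^ (+ k)    = 2ℝ ^ k
2^ -[1+ k ] = ½ℝ ^ suc k

-- Logarithm of a nonnegative real, with log₂ 0 = -∞: for q = a / d with
-- d > 0,  q ≤ log₂ x  iff  2ᵃ ≤ xᵈ.
log₂ : ℝ → Cut
log₂ x = record
  { lower = λ q → 2^ (ℚ.↥ q) ≤ x ^ ℚ.↧ₙ q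
  ; upper = λ q → x ^ ℚ.↧ₙ q ≤ 2^ (ℚ.↥ q) }

record _=Θ_ (X Y : ℕ → Cut) : Set where
  field
    c C       : ℚ
    {{c-pos}} : Positive c
    {{C-pos}} : Positive C
    threshold : ℕ
    below     : ∀ n → threshold ℕ.≤ n → c · Y n ≼ X n
    above     : ∀ n → threshold ℕ.≤ n → X n ≼ C · Y n

infix 4 _=Θ_

Word : ℕ → Set
Word = Vec Bool

zeroʷ : ∀ {n} → Word n
zeroʷ = Vec.replicate _ false

infixl 6 _⊕_

_⊕_ : ∀ {n} → Word n → Word n → Word n
_⊕_ = Vec.zipWith _xor_

⟨_,_⟩ : ∀ {n} → Word n → Word n → Bool
⟨ a , x ⟩ = Vec.foldr′ _xor_ false (Vec.zipWith _∧_ a x)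

∑ʷ : ∀ {n} → (Word n → ℝ) → ℝ
∑ʷ = ∑ⱽ false true

record AffineSubspace (n : ℕ) : Set where
  field
    direction : Word n → Bool
    zero∈     : direction zeroʷ ≡ true
    ⊕-closed  : ∀ u v → direction u ≡ true → direction v ≡ true →
                direction (u ⊕ v) ≡ true
    origin    : Word n

  member : Word n → Bool
  member x = direction (x ⊕ origin)

Mass : ℕ → Set
Mass n = Word n → ℝ

record Product (n : ℕ) : Set where
  field
    prob-one : Fin n → ℝ
    prob≥0   : ∀ i → 0ℝ ≤ prob-one i
    prob≤1   : ∀ i → prob-one i ≤ 1ℝ

  prob-zero : Fin n → ℝ
  prob-zero i = 1ℝ - prob-one i

  mass : Mass n
  mass x = ∏ λ i → if Vec.lookup x i then prob-one i else prob-zero i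

open Product public

ZeroBiased : ∀ {n} → Product n → Set
ZeroBiased μ = ∀ i → ½ℝ ≤ prob-zero μ i

data PDT (n : ℕ) : Set where
  leaf : Bool → PDT n
  node : (a : Word n) (T₀ T₁ : PDT n) → PDT n

module _ {n : ℕ} where

  run : PDT n → Word n → Bool
  run (leaf b)       x = b
  run (node a T₀ T₁) x = if ⟨ a , x ⟩ then run T₁ x else run T₀ x

  queries : PDT n → Word n → ℕ
  queries (leaf b)       x = 0
  queries (node a T₀ T₁) x =
    suc (if ⟨ a , x ⟩ then queries T₁ x else queries T₀ x)

  depth : PDT n → ℕ
  depth (leaf b)       = 0
  depth (node a T₀ T₁) = suc (depth T₀ ℕ.⊔ depth T₁)

  wrong : (Word n → Bool) → PDT n → Word n → Bool
  wrong f T x = run T x xor f x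

  error : (Word n → Bool) → PDT n → Mass n → ℝ
  error f T ν = ∑ʷ λ x → if wrong f T x then ν x else 0ℝ

  cost : PDT n → Mass n → ℝ
  cost T ν = ∑ʷ λ x → ν x * fromℕ (queries T x)

-- Finite support loses nothing: after removal of redundant queries, which
-- changes neither outputs nor skew costs, only finitely many trees remain.
record Randomised (n : ℕ) : Set where
  field
    size     : ℕ
    tree     : Fin size → PDT n
    weight   : Fin size → ℝ
    weight≥0 : ∀ j → 0ℝ ≤ weight j
    total    : ∑ weight ≈ 1ℝ

module _ {n : ℕ} where

  open Randomised

  mapTrees : (PDT n → PDT n) → Randomised n → Randomised n
  mapTrees g 𝒯 = record 𝒯 { tree = g ∘ tree 𝒯 }

  err : (Word n → Bool) → Randomised n → Mass n → ℝ
  err f 𝒯 ν = ∑ λ j → weight 𝒯 j * error f (tree 𝒯 j) ν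

  q̄ : Randomised n → Mass n → ℝ
  q̄ 𝒯 ν = ∑ λ j → weight 𝒯 j * cost (tree 𝒯 j) ν

data Status : Set where
  fixed₀ ⋆ : Status

Fixing : ℕ → Set
Fixing = Vec Status

stars : ∀ {n} → Fixing n → ℕ
stars []           = 0
stars (fixed₀ ∷ ρ) = stars ρ
stars (⋆ ∷ ρ)      = suc (stars ρ)

consistent : ∀ {n} → Fixing n → Word n → Bool
consistent []           []      = true
consistent (fixed₀ ∷ ρ) (b ∷ x) = not b ∧ consistent ρ x
consistent (⋆ ∷ ρ)      (b ∷ x) = consistent ρ x

uniform : ∀ {n} → Fixing n → Mass n
uniform ρ x = if consistent ρ x then ½ℝ ^ stars ρ else 0ℝ

restrictQuery : ∀ {n} → Fixing n → Word n → Word n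
restrictQuery []           []      = []
restrictQuery (fixed₀ ∷ ρ) (b ∷ a) = false ∷ restrictQuery ρ a
restrictQuery (⋆ ∷ ρ)      (b ∷ a) = b ∷ restrictQuery ρ a

-- `implied es a` is `just b` if a is the sum of a subfamily of the queries
-- in es, b being the sum of the corresponding answers, and `nothing` if a
-- is not in their span.  (Below, es is always linearly independent, so the
-- subfamily is unique.)
implied : ∀ {n} → List (Word n × Bool) → Word n → Maybe Bool
implied [] a =
  if ⌊ ≡-dec Bool._≟_ a zeroʷ ⌋ then just false else nothing
implied ((v , b) ∷ es) a =
  implied es a <∣> Maybe.map (b xor_) (implied es (a ⊕ v))

-- The list records the non-redundant queries made so far and their answers.
-- Redundant queries need not be recorded, as they do not change the span.
restrictFrom : ∀ {n} → Fixing n → List (Word n × Bool) → PDT n → PDT n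
restrictFrom ρ es (leaf b)       = leaf b
restrictFrom ρ es (node a T₀ T₁) =
  let a′ = restrictQuery ρ a in
  maybe′ (λ b → if b then restrictFrom ρ es T₁ else restrictFrom ρ es T₀)
         (node a′ (restrictFrom ρ ((a′ , false) ∷ es) T₀)
                  (restrictFrom ρ ((a′ , true)  ∷ es) T₁))
         (implied es a′)

restrict : ∀ {n} → Fixing n → PDT n → PDT n
restrict ρ = restrictFrom ρ []

module _ {n : ℕ} (μ : Product n) where

  δ : Fin n → ℝ
  δ i = 2ℝ * prob-one μ i

  fixingMass : Fixing n → ℝ
  fixingMass ρ = ∏ λ i → status i (Vec.lookup ρ i)
    where
    status : Fin n → Status → ℝ
    status i fixed₀ = 1ℝ - δ i
    status i ⋆      = δ i

  sq̄ : Randomised n → ℝ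
  sq̄ 𝒯 = ∑ⱽ fixed₀ ⋆ λ ρ →
    fixingMass ρ * q̄ (mapTrees (restrict ρ) 𝒯) (uniform ρ)

⅓ : ℚ
⅓ = + 1 ℚ./ 3

module _ {n : ℕ} where

  D : ℚ → (Word n → Bool) → Mass n → Cut
  D ε f ν = minimum {Σ (PDT n) λ T → error f T ν ≤ fromℚ ε}
    λ (T , _) → natural (depth T)

  D× : (Word n → Bool) → Cut
  D× f = maximum {Product n} λ ν → D ⅓ f (mass ν)

  signedMass : (Word n → Bool) → Mass n → AffineSubspace n → ℝ
  signedMass f μ S = ∑ʷ λ x →
    if AffineSubspace.member S x then (if f x then - μ x else μ x) else 0ℝ

  -- The logarithm is monotone, so it is moved inside the maximum.
  disc : (Word n → Bool) → Mass n → Cut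
  disc f μ = negate (maximum {AffineSubspace n} λ S → log₂ ∣ signedMass f μ S ∣)

  -- Only for 0-biased μ is `fixingMass μ` a distribution.
  S : ℚ → (Word n → Bool) → Product n → Cut
  S ε f μ = minimum {Σ (Randomised n) λ 𝒯 → err f 𝒯 (mass μ) ≤ fromℚ ε}
    λ (𝒯 , _) → real (sq̄ μ 𝒯)

-- Words of length 1 + N + k are split into a bit b, N bits x and k bits y.  Let
-- f = b ⊕ ⟨c_i , y⟩, where i is the position of the first one of x ("none" being
-- a further position) and c_0 , … , c_N are distinct words with N + 1 ≤ 2ᵏ < 2n.
-- Under μ the bits b and y are uniform, and x is such that i is uniform.
--
-- Skew cost: a tree may scan x up to its first one and then ask for f.  Fixed
-- coordinates are free, and a free one stops the scan with probability ½, so the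
-- scan costs at most 2 on average.  Conversely f flips with b, so a restricted
-- tree that asks nothing errs with probability ½.
--
-- Discrepancy: the fibres over x of an affine set are empty or translates of one
-- subspace V, hence contribute only if c_i ∈ V^⊥, and then |V| / 2ᵏ.  As
-- |V| |V^⊥| = 2ᵏ and i is uniform, no affine set has signed mass above
-- 1 / (N + 1).  The 2ᵈ leaves of a tree of depth d are affine, whence
-- D^× ≥ log₂ (N + 1) − O(1); the point 0 shows that the discrepancy is O(k).
--
-- Upper bound on D^×: under a product distribution keep a prefix of x with about
-- 7 expected ones.  It probably contains a one, which determines i, and at most
-- 63 of them.  The (2N)^O(1) such words are told apart by O(k) parities, because
-- some parity is odd on at least half of any list of nonzero differences.

module Submission where

open import Defs hiding (_+_; _*_; _-_; -_; _≤_; _^_; ∣_∣; _≈_)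
import Defs as Real
open import Data.Bool using (Bool; true; false; T; if_then_else_; not; _∧_; _∨_; _xor_)
import Data.Bool.Properties as Bool
open import Data.Bool.Solver using (module xor-∧-Solver)
open import Data.Empty using (⊥-elim)
open import Data.Fin using (Fin; zero; suc)
open import Data.Integer as ℤ using (ℤ; +_; -[1+_])
import Data.Integer.Properties as ℤ
open import Data.List as List using (List)
open import Data.List.Membership.Propositional using (_∈_)
open import Data.List.Membership.Propositional.Properties using (∈-map⁺; ∈-++⁺ˡ; ∈-++⁺ʳ)
open import Data.List.Properties using (length-map; length-++)
open import Data.List.Relation.Unary.All as All using (All)
open import Data.List.Relation.Unary.Any using (here; there)
open import Data.Maybe using (just; nothing)
open import Data.Nat as ℕ using (ℕ; zero; suc)
import Data.Nat.Properties as ℕ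
open import Data.Product using (∃; Σ-syntax; _×_; _,_; proj₁; proj₂)
open import Data.Rational
  using (ℚ; 0ℚ; 1ℚ; ½; Positive; _+_; _*_; _-_; -_; _≤_; _<_; ∣_∣; _/_; toℚᵘ; nonNegative; positive)
import Data.Rational as ℚ
open import Data.Rational.Properties as ℚ using (module ≤-Reasoning)
open import Data.Rational.Solver using (module +-*-Solver)
import Data.Rational.Unnormalised as ℚᵘ
import Data.Rational.Unnormalised.Properties as ℚᵘ
open import Data.Sum using (_⊎_; inj₁; inj₂)
open import Data.Vec as Vec using (Vec; []; _∷_; _++_)
open import Data.Vec.Functional using (foldr)
import Data.Vec.Properties as Vec
open import Function using (_∘_; case_of_)
open import Relation.Binary.PropositionalEquality
open import Relation.Nullary using (yes; no; ¬_)

-- The gap between S and D^× comes from the zeros of x: a coordinate of small bias is mostly fixed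
-- to 0, so reading it adds little skew cost, while depth counts every query. Two features of the
-- setting shape the proof. The distribution μ has constant rational biases, so each term of the
-- Cauchy sequences that describe it is an exact rational expectation over independent bits, apart
-- from the weights of randomised trees. The maximum in D^×, however, runs over real biases, which
-- cannot be compared with one another. The prefix is therefore chosen for rational biases nearby,
-- and the tree is shown to err almost as rarely under the true ones. The error budget is 1/8 for
-- too many ones, 1/8 for a prefix without a one and 1/16 for the approximation, together 5/16 <
-- 1/3; the numbers 7 and 63 are what make the first two equal to 1/8. The discrepancy, D^× and log
-- n are not compared with one another but each with k.

-- Rational arithmetic

-- Opaque, since products with a literal factor unfold during unification.
abstract
  ½′ : ℚ
  ½′ = ½

  ½′≡½ : ½′ ≡ ½
  ½′≡½ = refl

abstract
  fromℤ : ℤ → ℚ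
  fromℤ z = z / 1

  fromℤ-/1 : ∀ z → fromℤ z ≡ z / 1
  fromℤ-/1 z = refl

  fromℤ-0 : fromℤ (+ 0) ≡ 0ℚ
  fromℤ-0 = refl

  fromℤ-1 : fromℤ (+ 1) ≡ 1ℚ
  fromℤ-1 = refl

  toℚᵘ-fromℤ : ∀ z → toℚᵘ (fromℤ z) ℚᵘ.≃ ℚᵘ.mkℚᵘ z 0
  toℚᵘ-fromℤ z = ℚ.toℚᵘ-fromℚᵘ (ℚᵘ.mkℚᵘ z 0)

  fromℤ-+ : ∀ z w → fromℤ (z ℤ.+ w) ≡ fromℤ z + fromℤ w
  fromℤ-+ z w = ℚ.toℚᵘ-injective (begin
    toℚᵘ (fromℤ (z ℤ.+ w))                    ≈⟨ toℚᵘ-fromℤ (z ℤ.+ w) ⟩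
    ℚᵘ.mkℚᵘ (z ℤ.+ w) 0                       ≈⟨ ℚᵘ.*≡* (cong (ℤ._* + 1)
        (sym (cong₂ ℤ._+_ (ℤ.*-identityʳ z) (ℤ.*-identityʳ w)))) ⟩
    ℚᵘ.mkℚᵘ z 0 ℚᵘ.+ ℚᵘ.mkℚᵘ w 0              ≈⟨ ℚᵘ.+-cong (toℚᵘ-fromℤ z) (toℚᵘ-fromℤ w) ⟨
    toℚᵘ (fromℤ z) ℚᵘ.+ toℚᵘ (fromℤ w)        ≈⟨ ℚ.toℚᵘ-homo-+ (fromℤ z) (fromℤ w) ⟨
    toℚᵘ (fromℤ z + fromℤ w)                  ∎)
    where open ℚᵘ.≃-Reasoning

  fromℤ-* : ∀ z w → fromℤ (z ℤ.* w) ≡ fromℤ z * fromℤ w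
  fromℤ-* z w = ℚ.toℚᵘ-injective (begin
    toℚᵘ (fromℤ (z ℤ.* w))                    ≈⟨ toℚᵘ-fromℤ (z ℤ.* w) ⟩
    ℚᵘ.mkℚᵘ z 0 ℚᵘ.* ℚᵘ.mkℚᵘ w 0              ≈⟨ ℚᵘ.*-cong (toℚᵘ-fromℤ z) (toℚᵘ-fromℤ w) ⟨
    toℚᵘ (fromℤ z) ℚᵘ.* toℚᵘ (fromℤ w)        ≈⟨ ℚ.toℚᵘ-homo-* (fromℤ z) (fromℤ w) ⟨
    toℚᵘ (fromℤ z * fromℤ w)                  ∎)
    where open ℚᵘ.≃-Reasoning

  fromℤ-mono : ∀ {z w} → z ℤ.≤ w → fromℤ z ≤ fromℤ w
  fromℤ-mono {z} {w} z≤w = ℚ.toℚᵘ-cancel-≤ (begin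
    toℚᵘ (fromℤ z)  ≃⟨ toℚᵘ-fromℤ z ⟩
    ℚᵘ.mkℚᵘ z 0     ≤⟨ ℚᵘ.*≤* (ℤ.*-monoʳ-≤-nonNeg (+ 1) z≤w) ⟩
    ℚᵘ.mkℚᵘ w 0     ≃⟨ toℚᵘ-fromℤ w ⟨
    toℚᵘ (fromℤ w)  ∎)
    where open ℚᵘ.≤-Reasoning

  fromℤ-cancel : ∀ {z w} → fromℤ z ≤ fromℤ w → z ℤ.≤ w
  fromℤ-cancel {z} {w} h = ℤ.*-cancelʳ-≤-pos z w (+ 1) (ℚᵘ.drop-*≤* (begin
    ℚᵘ.mkℚᵘ z 0     ≃⟨ toℚᵘ-fromℤ z ⟨
    toℚᵘ (fromℤ z)  ≤⟨ ℚ.toℚᵘ-mono-≤ h ⟩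
    toℚᵘ (fromℤ w)  ≃⟨ toℚᵘ-fromℤ w ⟩
    ℚᵘ.mkℚᵘ w 0     ∎))
    where open ℚᵘ.≤-Reasoning

  *-denominator : ∀ q → q * fromℤ (ℚ.↧ q) ≡ fromℤ (ℚ.↥ q)
  *-denominator q@(ℚ.mkℚ n d _) = ℚ.toℚᵘ-injective (begin
    toℚᵘ (q * fromℤ (ℚ.↧ q))                              ≈⟨ ℚ.toℚᵘ-homo-* q (fromℤ (ℚ.↧ q)) ⟩
    toℚᵘ q ℚᵘ.* toℚᵘ (fromℤ (ℚ.↧ q))                      ≈⟨ ℚᵘ.*-congˡ {toℚᵘ q} (toℚᵘ-fromℤ (ℚ.↧ q)) ⟩
    toℚᵘ q ℚᵘ.* ℚᵘ.mkℚᵘ (ℚ.↧ q) 0                      ≈⟨ ℚᵘ.*≡*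
        (trans (ℤ.*-identityʳ (n ℤ.* + suc d)) (cong (λ e → n ℤ.* + suc e) (sym (ℕ.*-identityʳ d)))) ⟩
    ℚᵘ.mkℚᵘ (ℚ.↥ q) 0                                  ≈⟨ toℚᵘ-fromℤ (ℚ.↥ q) ⟨
    toℚᵘ (fromℤ (ℚ.↥ q))                               ∎)
    where open ℚᵘ.≃-Reasoning

ι : ℕ → ℚ
ι n = fromℤ (+ n)

ι-+ : ∀ m n → ι (m ℕ.+ n) ≡ ι m + ι n
ι-+ m n = fromℤ-+ (+ m) (+ n)

ι-suc : ∀ n → ι (suc n) ≡ 1ℚ + ι n
ι-suc n = trans (ι-+ 1 n) (cong (_+ ι n) fromℤ-1)

ι-* : ∀ m n → ι (m ℕ.* n) ≡ ι m * ι n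
ι-* m n = trans (cong fromℤ (ℤ.pos-* m n)) (fromℤ-* (+ m) (+ n))

ι-mono : ∀ {m n} → m ℕ.≤ n → ι m ≤ ι n
ι-mono = fromℤ-mono ∘ ℤ.+≤+

ι-cancel : ∀ {m n} → ι m ≤ ι n → m ℕ.≤ n
ι-cancel = ℤ.drop‿+≤+ ∘ fromℤ-cancel

0≤ι : ∀ n → 0ℚ ≤ ι n
0≤ι n = subst (_≤ ι n) fromℤ-0 (ι-mono ℕ.z≤n)

ι-suc-pos : ∀ n → Positive (ι (suc n))
ι-suc-pos n = positive (ℚ.<-≤-trans (ℚ.positive⁻¹ 1ℚ) (subst (_≤ ι (suc n)) fromℤ-1 (ι-mono (ℕ.s≤s ℕ.z≤n))))

*-monoˡ : ∀ {r p q} → 0ℚ ≤ r → p ≤ q → r * p ≤ r * q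
*-monoˡ {r} 0≤r = ℚ.*-monoˡ-≤-nonNeg r {{nonNegative 0≤r}}

*-monoʳ : ∀ {r p q} → 0ℚ ≤ r → p ≤ q → p * r ≤ q * r
*-monoʳ {r} 0≤r = ℚ.*-monoʳ-≤-nonNeg r {{nonNegative 0≤r}}

*-mono : ∀ {p q r s} → 0ℚ ≤ p → 0ℚ ≤ s → p ≤ q → r ≤ s → p * r ≤ q * s
*-mono 0≤p 0≤s p≤q r≤s = ℚ.≤-trans (*-monoˡ 0≤p r≤s) (*-monoʳ 0≤s p≤q)

0≤* : ∀ {p q} → 0ℚ ≤ p → 0ℚ ≤ q → 0ℚ ≤ p * q
0≤* {p} {q} 0≤p 0≤q = subst (_≤ p * q) (ℚ.*-zeroʳ p) (*-monoˡ 0≤p 0≤q)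

0≤+ : ∀ {p q} → 0ℚ ≤ p → 0ℚ ≤ q → 0ℚ ≤ p + q
0≤+ = ℚ.+-mono-≤

0≤½′ : 0ℚ ≤ ½′
0≤½′ = subst (0ℚ ≤_) (sym ½′≡½) (ℚ.nonNegative⁻¹ ½)

0≤1 : 0ℚ ≤ 1ℚ
0≤1 = ℚ.nonNegative⁻¹ 1ℚ

p≤∣p∣ : ∀ p → p ≤ ∣ p ∣
p≤∣p∣ p with ℚ.∣p∣≡p∨∣p∣≡-p p | ℚ.≤-total 0ℚ p
... | _ | inj₁ 0≤p = ℚ.≤-reflexive (sym (ℚ.0≤p⇒∣p∣≡p 0≤p))
... | _ | inj₂ p≤0 = ℚ.≤-trans p≤0 (ℚ.0≤∣p∣ p)

neg-involutive : ∀ p → - (- p) ≡ p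
neg-involutive = solve 1 (λ p → :- (:- p) := p) refl
  where open +-*-Solver

∣p∣≤ : ∀ {p q} → p ≤ q → - p ≤ q → ∣ p ∣ ≤ q
∣p∣≤ {p} {q} p≤q -p≤q with ℚ.∣p∣≡p∨∣p∣≡-p p
... | inj₁ e = subst (_≤ q) (sym e) p≤q
... | inj₂ e = subst (_≤ q) (sym e) -p≤q

≤⇒0≤- : ∀ {p q} → p ≤ q → 0ℚ ≤ q - p
≤⇒0≤- {p} {q} p≤q = subst (_≤ q - p) (ℚ.+-inverseʳ p) (ℚ.+-monoˡ-≤ (- p) p≤q)

0≤-⇒≤ : ∀ {p q} → 0ℚ ≤ q - p → p ≤ q
0≤-⇒≤ {p} {q} h = subst₂ _≤_ (ℚ.+-identityˡ p) (lem q p) (ℚ.+-monoˡ-≤ p h)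
  where
  open +-*-Solver
  lem : ∀ q p → q - p + p ≡ q
  lem = solve 2 (λ q p → q :- p :+ p := q) refl

-- The average over one bit that is one with probability p. `E`, `R` and `U` below are iterated
-- mixes, so their algebra comes down to the identities for `mix`.
mix : ℚ → ℚ → ℚ → ℚ
mix p a b = (1ℚ - p) * a + p * b

module _ where
  open +-*-Solver

  mix-+ : ∀ p a b c d → mix p (a + c) (b + d) ≡ mix p a b + mix p c d
  mix-+ = solve 5 (λ p a b c d →
    (con 1ℚ :- p) :* (a :+ c) :+ p :* (b :+ d) :=
    ((con 1ℚ :- p) :* a :+ p :* b) :+ ((con 1ℚ :- p) :* c :+ p :* d)) refl

  mix-* : ∀ p r a b → mix p (r * a) (r * b) ≡ r * mix p a b
  mix-* = solve 4 (λ p r a b →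
    (con 1ℚ :- p) :* (r :* a) :+ p :* (r :* b) :=
    r :* ((con 1ℚ :- p) :* a :+ p :* b)) refl

  mix-same : ∀ p a → mix p a a ≡ a
  mix-same = solve 2 (λ p a → (con 1ℚ :- p) :* a :+ p :* a := a) refl

  mix-½ : ∀ a b → mix ½′ a b ≡ ½′ * (a + b)
  mix-½ rewrite ½′≡½ = solve 2 (λ a b → (con 1ℚ :- con ½) :* a :+ con ½ :* b := con ½ :* (a :+ b)) refl

  mix-neg : ∀ p a b → mix p (- a) (- b) ≡ - mix p a b
  mix-neg = solve 3 (λ p a b →
    (con 1ℚ :- p) :* (:- a) :+ p :* (:- b) := :- ((con 1ℚ :- p) :* a :+ p :* b)) refl

IsProb : ℚ → Set
IsProb p = 0ℚ ≤ p × p ≤ 1ℚ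

½′-prob : IsProb ½′
½′-prob = 0≤½′ , subst (_≤ 1ℚ) (sym ½′≡½) (ℚ.toℚᵘ-cancel-≤ (ℚᵘ.*≤* (ℤ.+≤+ (ℕ.s≤s ℕ.z≤n))))

mix-mono : ∀ {p a b c d} → IsProb p → a ≤ c → b ≤ d → mix p a b ≤ mix p c d
mix-mono (0≤p , p≤1) a≤c b≤d = ℚ.+-mono-≤ (*-monoˡ (≤⇒0≤- p≤1) a≤c) (*-monoˡ 0≤p b≤d)

-- The expectation over independent bits with Pr[xᵢ = 1] = p i.
E : ∀ {n} → (Fin n → ℚ) → (Word n → ℚ) → ℚ
E {zero}  p g = g []
E {suc n} p g = mix (p zero) (E (p ∘ suc) (g ∘ (false ∷_))) (E (p ∘ suc) (g ∘ (true ∷_)))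

IsProbs : ∀ {n} → (Fin n → ℚ) → Set
IsProbs p = ∀ i → IsProb (p i)

E-cong : ∀ {n} (p : Fin n → ℚ) {g h : Word n → ℚ} → (∀ x → g x ≡ h x) → E p g ≡ E p h
E-cong {zero}  p e = e []
E-cong {suc n} p e = cong₂ (mix (p zero)) (E-cong (p ∘ suc) (e ∘ (false ∷_))) (E-cong (p ∘ suc) (e ∘ (true ∷_)))

E-mono : ∀ {n} {p : Fin n → ℚ} → IsProbs p → {g h : Word n → ℚ} → (∀ x → g x ≤ h x) → E p g ≤ E p h
E-mono {zero}  P e = e []
E-mono {suc n} P e = mix-mono (P zero) (E-mono (P ∘ suc) (e ∘ (false ∷_))) (E-mono (P ∘ suc) (e ∘ (true ∷_)))

E-+ : ∀ {n} (p : Fin n → ℚ) (g h : Word n → ℚ) → E p (λ x → g x + h x) ≡ E p g + E p h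
E-+ {zero}  p g h = refl
E-+ {suc n} p g h = trans
  (cong₂ (mix (p zero)) (E-+ (p ∘ suc) (g ∘ (false ∷_)) (h ∘ (false ∷_)))
      (E-+ (p ∘ suc) (g ∘ (true ∷_)) (h ∘ (true ∷_))))
  (mix-+ (p zero) _ _ _ _)

E-* : ∀ {n} (p : Fin n → ℚ) r (g : Word n → ℚ) → E p (λ x → r * g x) ≡ r * E p g
E-* {zero}  p r g = refl
E-* {suc n} p r g = trans
  (cong₂ (mix (p zero)) (E-* (p ∘ suc) r (g ∘ (false ∷_))) (E-* (p ∘ suc) r (g ∘ (true ∷_))))
  (mix-* (p zero) r _ _)

E-neg : ∀ {n} (p : Fin n → ℚ) (g : Word n → ℚ) → E p (λ x → - g x) ≡ - E p g
E-neg {zero}  p g = refl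
E-neg {suc n} p g = trans
  (cong₂ (mix (p zero)) (E-neg (p ∘ suc) (g ∘ (false ∷_))) (E-neg (p ∘ suc) (g ∘ (true ∷_))))
  (mix-neg (p zero) _ _)

E-const : ∀ {n} (p : Fin n → ℚ) r → E p (λ _ → r) ≡ r
E-const {zero}  p r = refl
E-const {suc n} p r = trans (cong₂ (mix (p zero)) (E-const (p ∘ suc) r) (E-const (p ∘ suc) r))
    (mix-same (p zero) r)

E-bound : ∀ {n} {p : Fin n → ℚ} → IsProbs p → (g : Word n → ℚ) (r : ℚ) → (∀ x → ∣ g x ∣ ≤ r) → ∣ E p g ∣ ≤ r
E-bound {p = p} P g r h = ∣p∣≤
  (subst (E p g ≤_) (E-const p r) (E-mono P (λ x → ℚ.≤-trans (p≤∣p∣ (g x)) (h x))))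
  (subst₂ _≤_ (E-neg p g) (E-const p r) (E-mono P (λ x →
    ℚ.≤-trans (p≤∣p∣ (- g x)) (subst (_≤ r) (sym (ℚ.∣-p∣≡∣p∣ (g x))) (h x)))))

-- Comparison of reals through their terms

≤ᴿ-pointwise : ∀ {x y} → (∀ k → seq x k ≤ seq y k) → x Real.≤ y
≤ᴿ-pointwise h = mk≤ λ ε → 0 , λ k _ → subst (_≤ _) (ℚ.+-identityʳ _)
    (ℚ.+-mono-≤ (h k) (ℚ.<⇒≤ (ℚ.positive⁻¹ ε)))

-- The order of ℚ is decidable, so it is enough to refute b < a: for a rational m strictly between
-- them, ε = m - b would give a ≤ m.
≤-limit : ∀ {a b} → (∀ ε .{{_ : Positive ε}} → a ≤ b + ε) → a ≤ b
≤-limit {a} {b} h = ℚ.≮⇒≥ λ b<a → case ℚ.<-dense b<a of λ (m , b<m , m<a) →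
  let 0<m-b = subst (_< m - b) (ℚ.+-inverseʳ b) (ℚ.+-monoˡ-< (- b) b<m)
      a≤m = subst (a ≤_) (cancel b m) (h (m - b) {{positive 0<m-b}})
  in ℚ.<-irrefl refl (ℚ.<-≤-trans m<a a≤m)
  where
  open +-*-Solver
  cancel : ∀ b m → b + (m - b) ≡ m
  cancel = solve 2 (λ b m → b :+ (m :- b) := m) refl

-- The way back from ℝ to ℚ: rational bounds that are valid at every index survive the ε in the real
-- order.
≤ᴿ⇒≤ : ∀ {x y a b} → x Real.≤ y → (∀ k → a ≤ seq x k) → (∀ k → seq y k ≤ b) → a ≤ b
≤ᴿ⇒≤ x≤y a≤x y≤b = ≤-limit λ ε → case eventually x≤y ε of λ (N , h) →
  ℚ.≤-trans (a≤x N) (ℚ.≤-trans (h N ℕ.≤-refl) (ℚ.+-monoˡ-≤ ε (y≤b N)))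

≤ᴿ-trans : ∀ {x y z} → x Real.≤ y → y Real.≤ z → x Real.≤ z
≤ᴿ-trans {x} {y} {z} x≤y y≤z = mk≤ λ ε →
  let instance _ = ℚ.pos*pos⇒pos ½ ε
      (M , hM) = eventually x≤y (½ * ε)
      (N , hN) = eventually y≤z (½ * ε)
  in M ℕ.⊔ N , λ n n≥ → begin
    seq x n                         ≤⟨ hM n (ℕ.m⊔n≤o⇒m≤o M N n≥) ⟩
    seq y n + ½ * ε                 ≤⟨ ℚ.+-monoˡ-≤ (½ * ε) (hN n (ℕ.m⊔n≤o⇒n≤o M N n≥)) ⟩
    seq z n + ½ * ε + ½ * ε         ≡⟨ lem (seq z n) ε ⟩
    seq z n + ε                     ∎
  where
  open ≤-Reasoning
  open +-*-Solver
  lem : ∀ z ε → z + ½ * ε + ½ * ε ≡ z + ε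
  lem = solve 2 (λ z ε → z :+ con ½ :* ε :+ con ½ :* ε := z :+ ε) refl

-- Bounds on extended reals

infix 4 _⊒_ _⊑_

-- The two predicates of a `Cut` are not tied to each other by any law, so a bound has to speak
-- about both: about which rationals belong to one and about which can belong to the other.
_⊒_ _⊑_ : Cut → ℚ → Set
X ⊒ a = (∀ q → q ≤ a → lower X q) × (∀ q → upper X q → a ≤ q)
X ⊑ b = (∀ q → b ≤ q → upper X q) × (∀ q → lower X q → q ≤ b)

⊒-weaken : ∀ {X a b} → b ≤ a → X ⊒ a → X ⊒ b
⊒-weaken b≤a (l , u) = (λ q q≤b → l q (ℚ.≤-trans q≤b b≤a)) , λ q h → ℚ.≤-trans b≤a (u q h)

⊑-weaken : ∀ {X a b} → a ≤ b → X ⊑ a → X ⊑ b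
⊑-weaken a≤b (u , l) = (λ q b≤q → u q (ℚ.≤-trans a≤b b≤q)) , λ q h → ℚ.≤-trans (l q h) a≤b

real-⊒ : ∀ {x a} → fromℚ a Real.≤ x → real x ⊒ a
real-⊒ {x} {a} a≤x =
  (λ q q≤a → ≤ᴿ-trans (≤ᴿ-pointwise (λ _ → q≤a)) a≤x) ,
  (λ q x≤q → ≤ᴿ⇒≤ (≤ᴿ-trans a≤x x≤q) (λ _ → ℚ.≤-refl) (λ _ → ℚ.≤-refl))

real-⊑ : ∀ {x a} → x Real.≤ fromℚ a → real x ⊑ a
real-⊑ {x} {a} x≤a =
  (λ q a≤q → ≤ᴿ-trans x≤a (≤ᴿ-pointwise (λ _ → a≤q))) ,
  (λ q q≤x → ≤ᴿ⇒≤ (≤ᴿ-trans q≤x x≤a) (λ _ → ℚ.≤-refl) (λ _ → ℚ.≤-refl))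

maximum-⊒ : ∀ {I} {X : I → Cut} {a} i → X i ⊒ a → maximum X ⊒ a
maximum-⊒ i (l , u) = (λ q h → i , l q h) , λ q h → u q (h i)

maximum-⊑ : ∀ {I} {X : I → Cut} {a} → (∀ i → X i ⊑ a) → maximum X ⊑ a
maximum-⊑ h = (λ q a≤q i → proj₁ (h i) q a≤q) , λ q (i , l) → proj₂ (h i) q l

minimum-⊒ : ∀ {I} {X : I → Cut} {a} → (∀ i → X i ⊒ a) → minimum X ⊒ a
minimum-⊒ h = (λ q q≤a i → proj₁ (h i) q q≤a) , λ q (i , u) → proj₂ (h i) q u

minimum-⊑ : ∀ {I} {X : I → Cut} {a} i → X i ⊑ a → minimum X ⊑ a
minimum-⊑ i (u , l) = (λ q h → i , u q h) , λ q h → l q (h i)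

negate-⊑ : ∀ {X a} → X ⊒ a → negate X ⊑ - a
negate-⊑ {a = a} (l , u) =
  (λ q -a≤q → l (- q) (subst (- q ≤_) (neg-involutive a) (ℚ.neg-antimono-≤ -a≤q))) ,
  (λ q h → subst (_≤ - a) (neg-involutive q) (ℚ.neg-antimono-≤ (u (- q) h)))

negate-⊒ : ∀ {X a} → X ⊑ a → negate X ⊒ - a
negate-⊒ {a = a} (u , l) =
  (λ q q≤-a → u (- q) (subst (_≤ - q) (neg-involutive a) (ℚ.neg-antimono-≤ q≤-a))) ,
  (λ q h → subst (- a ≤_) (neg-involutive q) (ℚ.neg-antimono-≤ (l (- q) h)))

÷-cancel : ∀ c .{{_ : Positive c}} q → c * ((q ℚ.÷ c) {{ℚ.pos⇒nonZero c}}) ≡ q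
÷-cancel c q = begin
  c * (q * c⁻¹)  ≡⟨ solve 3 (λ c q d → c :* (q :* d) := q :* (c :* d)) refl c q c⁻¹ ⟩
  q * (c * c⁻¹)  ≡⟨ cong (q *_) (ℚ.*-inverseʳ c {{ℚ.pos⇒nonZero c}}) ⟩
  q * 1ℚ         ≡⟨ ℚ.*-identityʳ q ⟩
  q              ∎
  where
  open ≡-Reasoning
  open +-*-Solver
  c⁻¹ = (ℚ.1/ c) {{ℚ.pos⇒nonZero c}}

·-≼ : ∀ {X Y a b} c .{{_ : Positive c}} → c * b ≡ a → Y ⊑ b → X ⊒ a → c · Y ≼ X
·-≼ {X} {Y} {a} {b} c cb≡a (uY , lY) (lX , uX) =
  (λ q h → lX q (subst₂ _≤_ (÷-cancel c q) cb≡a (*-monoˡ 0≤c (lY _ h)))) ,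
  (λ q h → uY _ (ℚ.*-cancelˡ-≤-pos c (subst₂ _≤_ (sym cb≡a) (sym (÷-cancel c q)) (uX q h))))
  where 0≤c = ℚ.<⇒≤ (ℚ.positive⁻¹ c)

≼-· : ∀ {X Y a b} c .{{_ : Positive c}} → c * a ≡ b → X ⊑ b → Y ⊒ a → X ≼ c · Y
≼-· {X} {Y} {a} {b} c ca≡b (uX , lX) (lY , uY) =
  (λ q h → lY _ (ℚ.*-cancelˡ-≤-pos c (subst₂ _≤_ (sym (÷-cancel c q)) (sym ca≡b) (lX q h)))) ,
  (λ q h → uX q (subst₂ _≤_ ca≡b (÷-cancel c q) (*-monoˡ 0≤c (uY _ h))))
  where 0≤c = ℚ.<⇒≤ (ℚ.positive⁻¹ c)

-- Two quantities that lie in the same interval [aκ, bκ] differ by a factor of at most b / a. The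
-- ratios c = a / b and C = b / a are passed with their defining equations, which avoids division.
Θ-intro : ∀ {X Y : ℕ → Cut} a b c C .{{_ : Positive c}} .{{_ : Positive C}} → c * b ≡ a → C * a ≡ b →
  (N : ℕ) (κ : ∀ n → N ℕ.≤ n → ℚ) →
  (∀ n h → X n ⊒ a * κ n h × X n ⊑ b * κ n h) →
  (∀ n h → Y n ⊒ a * κ n h × Y n ⊑ b * κ n h) → X =Θ Y
Θ-intro a b c C cb≡a Ca≡b N κ hX hY = record
  { c = c ; C = C ; c-pos = pos c ; C-pos = pos C ; threshold = N
  ; below = λ n h → ·-≼ c (scale c b a (κ n h) cb≡a) (proj₂ (hY n h)) (proj₁ (hX n h))
  ; above = λ n h → ≼-· C (scale C a b (κ n h) Ca≡b) (proj₂ (hX n h)) (proj₁ (hY n h)) }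
  where
  pos : ∀ c → .{{Positive c}} → Positive c
  pos c = positive (ℚ.positive⁻¹ c)
  scale : ∀ c b a k → c * b ≡ a → c * (b * k) ≡ a * k
  scale c b a k e = trans (sym (ℚ.*-assoc c b k)) (cong (_* k) e)

-- Powers of two and logarithms

infixr 8 _^ᵠ_
_^ᵠ_ : ℚ → ℕ → ℚ
p ^ᵠ zero  = 1ℚ
p ^ᵠ suc n = p * p ^ᵠ n

seq-^ : ∀ x n k → seq (x Real.^ n) k ≡ seq x k ^ᵠ n
seq-^ x zero    k = refl
seq-^ x (suc n) k = cong (seq x k *_) (seq-^ x n k)

^ᵠ-+ : ∀ p m n → p ^ᵠ (m ℕ.+ n) ≡ p ^ᵠ m * p ^ᵠ n
^ᵠ-+ p zero    n = sym (ℚ.*-identityˡ _)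
^ᵠ-+ p (suc m) n = trans (cong (p *_) (^ᵠ-+ p m n)) (sym (ℚ.*-assoc p _ _))

^ᵠ-* : ∀ p m n → p ^ᵠ (m ℕ.* n) ≡ (p ^ᵠ m) ^ᵠ n
^ᵠ-* p m zero    = cong (p ^ᵠ_) (ℕ.*-zeroʳ m)
^ᵠ-* p m (suc n) = trans (cong (p ^ᵠ_) (ℕ.*-suc m n)) (trans (^ᵠ-+ p m (m ℕ.* n))
    (cong (p ^ᵠ m *_) (^ᵠ-* p m n)))

0≤^ᵠ : ∀ {p} → 0ℚ ≤ p → ∀ n → 0ℚ ≤ p ^ᵠ n
0≤^ᵠ 0≤p zero    = 0≤1
0≤^ᵠ 0≤p (suc n) = 0≤* 0≤p (0≤^ᵠ 0≤p n)

^ᵠ-mono : ∀ {p q} → 0ℚ ≤ p → p ≤ q → ∀ n → p ^ᵠ n ≤ q ^ᵠ n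
^ᵠ-mono 0≤p p≤q zero    = ℚ.≤-refl
^ᵠ-mono 0≤p p≤q (suc n) = *-mono 0≤p (0≤^ᵠ (ℚ.≤-trans 0≤p p≤q) n) p≤q (^ᵠ-mono 0≤p p≤q n)

2ℚ : ℚ
2ℚ = + 2 / 1

pow2 : ℤ → ℚ
pow2 (+ n)    = 2ℚ ^ᵠ n
pow2 -[1+ n ] = ½ ^ᵠ suc n

seq-2^ : ∀ z k → seq (2^ z) k ≡ pow2 z
seq-2^ (+ n)    k = seq-^ 2ℝ n k
seq-2^ -[1+ n ] k = seq-^ ½ℝ (suc n) k

pow2-suc : ∀ z → pow2 (+ 1 ℤ.+ z) ≡ 2ℚ * pow2 z
pow2-suc (+ n)            = refl
pow2-suc -[1+ zero ]      = refl
pow2-suc -[1+ suc n ]     = solve 1 (λ p → p := con 2ℚ :* (con ½ :* p)) refl (½ ^ᵠ suc n)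
  where open +-*-Solver

pow2-neg : ∀ n → pow2 (ℤ.- + n) ≡ ½ ^ᵠ n
pow2-neg zero    = refl
pow2-neg (suc n) = refl

pow2-pos : ∀ z → Positive (pow2 z)
pow2-pos (+ zero)         = _
pow2-pos (+ suc n)        = ℚ.pos*pos⇒pos 2ℚ (2ℚ ^ᵠ n) {{pow2-pos (+ n)}}
pow2-pos -[1+ zero ]      = _
pow2-pos -[1+ suc n ]     = ℚ.pos*pos⇒pos ½ (½ ^ᵠ suc n) {{pow2-pos -[1+ n ]}}

pow2-< : ∀ z → pow2 z < pow2 (+ 1 ℤ.+ z)
pow2-< z = subst₂ _<_ (ℚ.*-identityˡ (pow2 z)) (sym (pow2-suc z))
  (ℚ.*-monoˡ-<-pos (pow2 z) {{pow2-pos z}} 1<2)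
  where
  1<2 : 1ℚ < 2ℚ
  1<2 = ℚ.*<* (ℤ.+<+ (ℕ.s≤s (ℕ.s≤s ℕ.z≤n)))

pow2-mono-+ : ∀ z n → pow2 z ≤ pow2 (+ n ℤ.+ z)
pow2-mono-+ z zero    = ℚ.≤-reflexive (cong pow2 (sym (ℤ.+-identityˡ z)))
pow2-mono-+ z (suc n) = ℚ.≤-trans (pow2-mono-+ z n)
  (subst (λ w → pow2 (+ n ℤ.+ z) ≤ pow2 w) (sym (ℤ.+-assoc (+ 1) (+ n) z)) (ℚ.<⇒≤ (pow2-< (+ n ℤ.+ z))))

pow2-mono : ∀ {z w} → z ℤ.≤ w → pow2 z ≤ pow2 w
pow2-mono {z} {w} z≤w with w ℤ.- z in e | ℤ.i≤j⇒0≤j-i z≤w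
... | + n | _ = subst (λ v → pow2 z ≤ pow2 v) eq (pow2-mono-+ z n)
  where
  eq : + n ℤ.+ z ≡ w
  eq = trans (cong (ℤ._+ z) (sym e)) (trans (ℤ.+-assoc w (ℤ.- z) z)
    (trans (cong (λ v → w ℤ.+ v) (ℤ.+-inverseˡ z)) (ℤ.+-identityʳ w)))

pow2-cancel : ∀ {z w} → pow2 z ≤ pow2 w → z ℤ.≤ w
pow2-cancel {z} {w} h = ℤ.≮⇒≥ λ w<z → ℚ.<-irrefl refl
  (ℚ.<-≤-trans (pow2-< w) (ℚ.≤-trans (pow2-mono (ℤ.i<j⇒suc[i]≤j w<z)) h))

pow2-* : ∀ z n → pow2 (z ℤ.* + n) ≡ pow2 z ^ᵠ n
pow2-* (+ m)    n = trans (cong pow2 (sym (ℤ.pos-* m n))) (^ᵠ-* 2ℚ m n)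
pow2-* -[1+ m ] n = begin
  pow2 (-[1+ m ] ℤ.* + n)            ≡⟨ cong pow2 (sym (ℤ.neg-distribˡ-* (+ suc m) (+ n))) ⟩
  pow2 (ℤ.- (+ suc m ℤ.* + n))       ≡⟨ cong (pow2 ∘ ℤ.-_) (sym (ℤ.pos-* (suc m) n)) ⟩
  pow2 (ℤ.- + (suc m ℕ.* n))         ≡⟨ pow2-neg (suc m ℕ.* n) ⟩
  ½ ^ᵠ (suc m ℕ.* n)                 ≡⟨ ^ᵠ-* ½ (suc m) n ⟩
  (½ ^ᵠ suc m) ^ᵠ n                  ∎
  where open ≡-Reasoning

neg-fromℤ : ∀ z → - fromℤ (ℤ.- z) ≡ fromℤ z
neg-fromℤ z = begin
  - fromℤ (ℤ.- z)                                ≡⟨ lem (fromℤ z) (fromℤ (ℤ.- z)) ⟩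
  fromℤ z - (fromℤ z + fromℤ (ℤ.- z))            ≡⟨ cong (λ s → fromℤ z - s)
      (trans (sym (fromℤ-+ z (ℤ.- z))) (trans (cong fromℤ (ℤ.+-inverseʳ z)) fromℤ-0)) ⟩
  fromℤ z - 0ℚ                                   ≡⟨ ℚ.+-identityʳ (fromℤ z) ⟩
  fromℤ z                                        ∎
  where
  open ≡-Reasoning
  open +-*-Solver
  lem : ∀ a b → - b ≡ a - (a + b)
  lem = solve 2 (λ a b → :- b := a :- (a :+ b)) refl

≤-clear : ∀ {z q} → fromℤ z ≤ q → z ℤ.* ℚ.↧ q ℤ.≤ ℚ.↥ q
≤-clear {z} {q} h = fromℤ-cancel (subst₂ _≤_ (sym (fromℤ-* z (ℚ.↧ q))) (*-denominator q)
  (*-monoʳ (0≤ι (ℚ.↧ₙ q)) h))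

≥-clear : ∀ {z q} → q ≤ fromℤ z → ℚ.↥ q ℤ.≤ z ℤ.* ℚ.↧ q
≥-clear {z} {q} h = fromℤ-cancel (subst₂ _≤_ (*-denominator q) (sym (fromℤ-* z (ℚ.↧ q)))
  (*-monoʳ (0≤ι (ℚ.↧ₙ q)) h))

clear-≤ : ∀ {z q} → z ℤ.* ℚ.↧ q ℤ.≤ ℚ.↥ q → fromℤ z ≤ q
clear-≤ {z} {q@record{}} h = ℚ.*-cancelʳ-≤-pos (ι (ℚ.↧ₙ q)) {{ι-suc-pos _}}
  (subst₂ _≤_ (fromℤ-* z (ℚ.↧ q)) (sym (*-denominator q)) (fromℤ-mono h))

clear-≥ : ∀ {z q} → ℚ.↥ q ℤ.≤ z ℤ.* ℚ.↧ q → q ≤ fromℤ z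
clear-≥ {z} {q@record{}} h = ℚ.*-cancelʳ-≤-pos (ι (ℚ.↧ₙ q)) {{ι-suc-pos _}}
  (subst₂ _≤_ (sym (*-denominator q)) (fromℤ-* z (ℚ.↧ q)) (fromℤ-mono h))

-- Only integer bounds z are needed. For q = a / d, the comparison of q with z clears to that of a
-- with z · d, and x ≤ 2ᶻ gives xᵈ ≤ 2^(z·d), so no root is taken.
log₂-⊑ : ∀ x z → (∀ k → 0ℚ ≤ seq x k) → (∀ k → seq x k ≤ pow2 z) → log₂ x ⊑ fromℤ z
log₂-⊑ x z 0≤x x≤ =
  (λ q h → ≤ᴿ-pointwise λ k → subst (seq (x Real.^ ℚ.↧ₙ q) k ≤_) (sym (seq-2^ (ℚ.↥ q) k))
    (ℚ.≤-trans (bound (ℚ.↧ₙ q) k) (pow2-mono (≤-clear h)))) ,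
  (λ q h → clear-≥ (pow2-cancel (≤ᴿ⇒≤ h (λ k → ℚ.≤-reflexive (sym (seq-2^ (ℚ.↥ q) k))) (bound (ℚ.↧ₙ q)))))
  where
  bound : ∀ d k → seq (x Real.^ d) k ≤ pow2 (z ℤ.* + d)
  bound d k = subst₂ _≤_ (sym (seq-^ x d k)) (sym (pow2-* z d)) (^ᵠ-mono (0≤x k) (x≤ k) d)

log₂-⊒ : ∀ x z → (∀ k → pow2 z ≤ seq x k) → log₂ x ⊒ fromℤ z
log₂-⊒ x z ≤x =
  (λ q h → ≤ᴿ-pointwise λ k → subst (_≤ seq (x Real.^ ℚ.↧ₙ q) k) (sym (seq-2^ (ℚ.↥ q) k))
    (ℚ.≤-trans (pow2-mono (≥-clear h)) (bound (ℚ.↧ₙ q) k))) ,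
  (λ q h → clear-≤ (pow2-cancel (≤ᴿ⇒≤ h (bound (ℚ.↧ₙ q)) (λ k → ℚ.≤-reflexive (seq-2^ (ℚ.↥ q) k)))))
  where
  bound : ∀ d k → pow2 (z ℤ.* + d) ≤ seq (x Real.^ d) k
  bound d k = subst₂ _≤_ (sym (pow2-* z d)) (sym (seq-^ x d k))
    (^ᵠ-mono (ℚ.<⇒≤ (ℚ.positive⁻¹ (pow2 z) {{pow2-pos z}})) (≤x k) d)

ind : Bool → ℚ
ind true  = 1ℚ
ind false = 0ℚ

sgn : Bool → ℚ
sgn true  = - 1ℚ
sgn false = 1ℚ

-- Expectations

Σᵛ : ∀ {A : Set} → A → A → ∀ {n} → (Vec A n → ℚ) → ℚ
Σᵛ a b {zero}  g = g []
Σᵛ a b {suc n} g = Σᵛ a b (g ∘ (a ∷_)) + Σᵛ a b (g ∘ (b ∷_))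

seq-∑ⱽ : ∀ {A : Set} (a b : A) {n} (g : Vec A n → ℝ) k → seq (∑ⱽ a b g) k ≡ Σᵛ a b (λ v → seq (g v) k)
seq-∑ⱽ a b {zero}  g k = refl
seq-∑ⱽ a b {suc n} g k = cong₂ _+_ (seq-∑ⱽ a b (g ∘ (a ∷_)) k) (seq-∑ⱽ a b (g ∘ (b ∷_)) k)

Σᵛ-cong : ∀ {A : Set} (a b : A) {n} {g h : Vec A n → ℚ} → (∀ v → g v ≡ h v) → Σᵛ a b g ≡ Σᵛ a b h
Σᵛ-cong a b {zero}  e = e []
Σᵛ-cong a b {suc n} e = cong₂ _+_ (Σᵛ-cong a b (e ∘ (a ∷_))) (Σᵛ-cong a b (e ∘ (b ∷_)))

Σᵛ-* : ∀ {A : Set} (a b : A) {n} r (g : Vec A n → ℚ) → Σᵛ a b (λ v → r * g v) ≡ r * Σᵛ a b g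
Σᵛ-* a b {zero}  r g = refl
Σᵛ-* a b {suc n} r g = trans (cong₂ _+_ (Σᵛ-* a b r (g ∘ (a ∷_))) (Σᵛ-* a b r (g ∘ (b ∷_))))
  (sym (ℚ.*-distribˡ-+ r _ _))

Σᵛ-0 : ∀ {A : Set} (a b : A) {n} {g : Vec A n → ℚ} → (∀ v → g v ≡ 0ℚ) → Σᵛ a b g ≡ 0ℚ
Σᵛ-0 a b {zero}  e = e []
Σᵛ-0 a b {suc n} e = cong₂ _+_ (Σᵛ-0 a b (e ∘ (a ∷_))) (Σᵛ-0 a b (e ∘ (b ∷_)))

wt : ∀ {n} → (Fin n → ℚ) → Word n → ℚ
wt p []          = 1ℚ
wt p (false ∷ x) = (1ℚ - p zero) * wt (p ∘ suc) x
wt p (true ∷ x)  = p zero * wt (p ∘ suc) x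

E-Σ : ∀ {n} (p : Fin n → ℚ) g → E p g ≡ Σᵛ false true (λ x → wt p x * g x)
E-Σ {zero}  p g = sym (ℚ.*-identityˡ (g []))
E-Σ {suc n} p g = cong₂ _+_ (half (1ℚ - p zero) (g ∘ (false ∷_))) (half (p zero) (g ∘ (true ∷_)))
  where
  half : ∀ r h → r * E (p ∘ suc) h ≡ Σᵛ false true (λ x → r * wt (p ∘ suc) x * h x)
  half r h = begin
    r * E (p ∘ suc) h                                        ≡⟨ cong (r *_) (E-Σ (p ∘ suc) h) ⟩
    r * Σᵛ false true (λ x → wt (p ∘ suc) x * h x)           ≡⟨ Σᵛ-* false true r (λ x → wt (p ∘ suc) x * h x) ⟨
    Σᵛ false true (λ x → r * (wt (p ∘ suc) x * h x))         ≡⟨ Σᵛ-cong false true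
        (λ x → sym (ℚ.*-assoc r _ (h x))) ⟩
    Σᵛ false true (λ x → r * wt (p ∘ suc) x * h x)           ∎
    where open ≡-Reasoning

seq-prod : ∀ {n} (P : Fin n → ℝ) x k →
  seq (∏ (λ i → if Vec.lookup x i then P i else 1ℝ Real.- P i)) k ≡ wt (λ i → seq (P i) k) x
seq-prod P []          k = refl
seq-prod P (false ∷ x) k = cong ((1ℚ - seq (P zero) k) *_) (seq-prod (P ∘ suc) x k)
seq-prod P (true ∷ x)  k = cong (seq (P zero) k *_) (seq-prod (P ∘ suc) x k)

seq-* : ∀ x y k → seq (x Real.* y) k ≡ seq x k * seq y k
seq-* x y k = refl

at : ∀ {n} → Product n → ℕ → Fin n → ℚ
at ν k i = seq (prob-one ν i) k

seq-mass : ∀ {n} (ν : Product n) x k → seq (mass ν x) k ≡ wt (at ν k) x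
seq-mass ν = seq-prod (prob-one ν)

seq-if : ∀ b {x} k → seq (if b then x else 0ℝ) k ≡ seq x k * ind b
seq-if true  {x} k = sym (ℚ.*-identityʳ (seq x k))
seq-if false {x} k = sym (ℚ.*-zeroʳ (seq x k))

seq-error : ∀ {n} f (T : PDT n) ν k → seq (error f T (mass ν)) k ≡ E (at ν k) (ind ∘ wrong f T)
seq-error f T ν k = begin
  seq (error f T (mass ν)) k                                          ≡⟨ seq-∑ⱽ false true
      (λ x → if wrong f T x then mass ν x else 0ℝ) k ⟩
  Σᵛ false true (λ x → seq (if wrong f T x then mass ν x else 0ℝ) k)  ≡⟨ Σᵛ-cong false true (λ x →
    trans (seq-if (wrong f T x) k) (cong (_* ind (wrong f T x)) (seq-mass ν x k))) ⟩
  Σᵛ false true (λ x → wt (at ν k) x * ind (wrong f T x))             ≡⟨ E-Σ (at ν k) _ ⟨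
  E (at ν k) (ind ∘ wrong f T)                                        ∎
  where open ≡-Reasoning

signed : ∀ {n} → (Word n → Bool) → (Word n → Bool) → Word n → ℚ
signed f P x = ind (P x) * sgn (f x)

seq-signedMass : ∀ {n} f (ν : Product n) S k →
  seq (signedMass f (mass ν) S) k ≡ E (at ν k) (signed f (AffineSubspace.member S))
seq-signedMass f ν S k = trans (seq-∑ⱽ false true
   (λ x → if AffineSubspace.member S x then (if f x then Real.- mass ν x else mass ν x) else 0ℝ) k)
  (trans (Σᵛ-cong false true (λ x → trans
     (term (AffineSubspace.member S x) (f x) (mass ν x))
     (cong (_* signed f (AffineSubspace.member S) x) (seq-mass ν x k))))
  (sym (E-Σ (at ν k) _)))
  where
  term : ∀ b c m → seq (if b then (if c then Real.- m else m) else 0ℝ) k ≡ seq m k * (ind b * sgn c)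
  term false c m = sym (trans (cong (seq m k *_) (ℚ.*-zeroˡ (sgn c))) (ℚ.*-zeroʳ (seq m k)))
  term true false m = sym (ℚ.*-identityʳ (seq m k))
  term true true m = solve 1 (λ m → :- m := m :* (con 1ℚ :* con (- 1ℚ))) refl (seq m k)
    where open +-*-Solver

-- The expectation over ρ ∼ 𝓡_μ, and below that over x ∼ 𝓤_ρ.
R : ∀ {n} → (Fin n → ℚ) → (Fixing n → ℚ) → ℚ
R {zero}  p G = G []
R {suc n} p G = mix (2ℚ * p zero) (R (p ∘ suc) (G ∘ (fixed₀ ∷_))) (R (p ∘ suc) (G ∘ (⋆ ∷_)))

R-cong : ∀ {n} (p : Fin n → ℚ) {G H : Fixing n → ℚ} → (∀ ρ → G ρ ≡ H ρ) → R p G ≡ R p H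
R-cong {zero}  p e = e []
R-cong {suc n} p e = cong₂ (mix (2ℚ * p zero)) (R-cong (p ∘ suc) (e ∘ (fixed₀ ∷_)))
    (R-cong (p ∘ suc) (e ∘ (⋆ ∷_)))

R-mono : ∀ {n} {p : Fin n → ℚ} → (∀ i → IsProb (2ℚ * p i)) → {G H : Fixing n → ℚ} →
    (∀ ρ → G ρ ≤ H ρ) → R p G ≤ R p H
R-mono {zero}  P e = e []
R-mono {suc n} P e = mix-mono (P zero) (R-mono (P ∘ suc) (e ∘ (fixed₀ ∷_))) (R-mono (P ∘ suc) (e ∘ (⋆ ∷_)))

R-+ : ∀ {n} (p : Fin n → ℚ) (G H : Fixing n → ℚ) → R p (λ ρ → G ρ + H ρ) ≡ R p G + R p H
R-+ {zero}  p G H = refl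
R-+ {suc n} p G H = trans
  (cong₂ (mix (2ℚ * p zero)) (R-+ (p ∘ suc) (G ∘ (fixed₀ ∷_)) (H ∘ (fixed₀ ∷_)))
      (R-+ (p ∘ suc) (G ∘ (⋆ ∷_)) (H ∘ (⋆ ∷_))))
  (mix-+ (2ℚ * p zero) _ _ _ _)

R-* : ∀ {n} (p : Fin n → ℚ) r (G : Fixing n → ℚ) → R p (λ ρ → r * G ρ) ≡ r * R p G
R-* {zero}  p r G = refl
R-* {suc n} p r G = trans
  (cong₂ (mix (2ℚ * p zero)) (R-* (p ∘ suc) r (G ∘ (fixed₀ ∷_))) (R-* (p ∘ suc) r (G ∘ (⋆ ∷_))))
  (mix-* (2ℚ * p zero) r _ _)

R-const : ∀ {n} (p : Fin n → ℚ) r → R p (λ _ → r) ≡ r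
R-const {zero}  p r = refl
R-const {suc n} p r = trans (cong₂ (mix (2ℚ * p zero)) (R-const (p ∘ suc) r) (R-const (p ∘ suc) r))
    (mix-same (2ℚ * p zero) r)

R-mix : ∀ {n} (p : Fin n → ℚ) q (G H : Fixing n → ℚ) → R p (λ ρ → mix q (G ρ) (H ρ)) ≡ mix q (R p G) (R p H)
R-mix p q G H = trans (R-+ p _ _) (cong₂ _+_ (R-* p (1ℚ - q) G) (R-* p q H))

fw : ∀ {n} → (Fin n → ℚ) → Fixing n → ℚ
fw p []           = 1ℚ
fw p (fixed₀ ∷ ρ) = (1ℚ - 2ℚ * p zero) * fw (p ∘ suc) ρ
fw p (⋆ ∷ ρ)      = 2ℚ * p zero * fw (p ∘ suc) ρ

R-Σ : ∀ {n} (p : Fin n → ℚ) G → R p G ≡ Σᵛ fixed₀ ⋆ (λ ρ → fw p ρ * G ρ)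
R-Σ {zero}  p G = sym (ℚ.*-identityˡ (G []))
R-Σ {suc n} p G = cong₂ _+_ (half (1ℚ - 2ℚ * p zero) (G ∘ (fixed₀ ∷_))) (half (2ℚ * p zero) (G ∘ (⋆ ∷_)))
  where
  half : ∀ r H → r * R (p ∘ suc) H ≡ Σᵛ fixed₀ ⋆ (λ ρ → r * fw (p ∘ suc) ρ * H ρ)
  half r H = begin
    r * R (p ∘ suc) H                                        ≡⟨ cong (r *_) (R-Σ (p ∘ suc) H) ⟩
    r * Σᵛ fixed₀ ⋆ (λ ρ → fw (p ∘ suc) ρ * H ρ)             ≡⟨ Σᵛ-* fixed₀ ⋆ r (λ ρ → fw (p ∘ suc) ρ * H ρ) ⟨
    Σᵛ fixed₀ ⋆ (λ ρ → r * (fw (p ∘ suc) ρ * H ρ))           ≡⟨ Σᵛ-cong fixed₀ ⋆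
        (λ ρ → sym (ℚ.*-assoc r _ (H ρ))) ⟩
    Σᵛ fixed₀ ⋆ (λ ρ → r * fw (p ∘ suc) ρ * H ρ)             ∎
    where open ≡-Reasoning

-- A single factor is written as the weight of a fixing of length one, so that both statuses share
-- one expression.
seq-prodᶠ : ∀ {n} (p : Fin n → ℚ) (v : Fin n → ℝ) ρ k →
  (∀ i → seq (v i) k ≡ fw {1} (λ _ → p i) (Vec.lookup ρ i ∷ [])) → seq (∏ v) k ≡ fw p ρ
seq-prodᶠ p v []           k e = refl
seq-prodᶠ p v (fixed₀ ∷ ρ) k e = cong₂ _*_ (trans (e zero) (ℚ.*-identityʳ (1ℚ - 2ℚ * p zero)))
    (seq-prodᶠ (p ∘ suc) (v ∘ suc) ρ k (e ∘ suc))
seq-prodᶠ p v (⋆ ∷ ρ)      k e = cong₂ _*_ (trans (e zero) (ℚ.*-identityʳ (2ℚ * p zero)))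
    (seq-prodᶠ (p ∘ suc) (v ∘ suc) ρ k (e ∘ suc))

-- Recovers the family of factors of `fixingMass`, which is local to its definition.
factors : ∀ {n} {v : Fin n → ℝ} {x} → x ≡ ∏ v → Fin n → ℝ
factors {v = v} _ = v

seq-fixingFactor : ∀ {n} (μ : Product n) ρ k i →
  seq (factors (refl {x = fixingMass μ ρ}) i) k ≡ fw {1} (λ _ → at μ k i) (Vec.lookup ρ i ∷ [])
seq-fixingFactor μ ρ k i with Vec.lookup ρ i
... | fixed₀ = sym (ℚ.*-identityʳ _)
... | ⋆      = sym (ℚ.*-identityʳ _)

seq-fixingMass : ∀ {n} (μ : Product n) ρ k → seq (fixingMass μ ρ) k ≡ fw (at μ k) ρ
seq-fixingMass μ ρ k = seq-prodᶠ (at μ k) _ ρ k (seq-fixingFactor μ ρ k)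

U : ∀ {n} → Fixing n → (Word n → ℚ) → ℚ
U []           g = g []
U (fixed₀ ∷ ρ) g = U ρ (g ∘ (false ∷_))
U (⋆ ∷ ρ)      g = mix ½′ (U ρ (g ∘ (false ∷_))) (U ρ (g ∘ (true ∷_)))

U-mono : ∀ {n} (ρ : Fixing n) {g h} → (∀ x → consistent ρ x ≡ true → g x ≤ h x) → U ρ g ≤ U ρ h
U-mono []           e = e [] refl
U-mono (fixed₀ ∷ ρ) e = U-mono ρ (e ∘ (false ∷_))
U-mono (⋆ ∷ ρ)      e = mix-mono ½′-prob (U-mono ρ (e ∘ (false ∷_))) (U-mono ρ (e ∘ (true ∷_)))

U-+ : ∀ {n} (ρ : Fixing n) g h → U ρ (λ x → g x + h x) ≡ U ρ g + U ρ h
U-+ []           g h = refl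
U-+ (fixed₀ ∷ ρ) g h = U-+ ρ _ _
U-+ (⋆ ∷ ρ)      g h = trans (cong₂ (mix ½′) (U-+ ρ (g ∘ (false ∷_)) (h ∘ (false ∷_)))
    (U-+ ρ (g ∘ (true ∷_)) (h ∘ (true ∷_)))) (mix-+ ½′ _ _ _ _)

U-const : ∀ {n} (ρ : Fixing n) r → U ρ (λ _ → r) ≡ r
U-const []           r = refl
U-const (fixed₀ ∷ ρ) r = U-const ρ r
U-const (⋆ ∷ ρ)      r = trans (cong₂ (mix ½′) (U-const ρ r) (U-const ρ r)) (mix-same ½′ r)

uw : ∀ {n} → Fixing n → Word n → ℚ
uw ρ x = if consistent ρ x then ½′ ^ᵠ stars ρ else 0ℚ

seq-uniform : ∀ {n} (ρ : Fixing n) x k → seq (uniform ρ x) k ≡ uw ρ x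
seq-uniform ρ x k with consistent ρ x
... | true  = trans (seq-^ ½ℝ (stars ρ) k) (cong (_^ᵠ stars ρ) (sym ½′≡½))
... | false = refl

U-Σ : ∀ {n} (ρ : Fixing n) g → U ρ g ≡ Σᵛ false true (λ x → uw ρ x * g x)
U-Σ []           g = sym (ℚ.*-identityˡ (g []))
U-Σ (fixed₀ ∷ ρ) g = trans (U-Σ ρ _) (trans (sym (ℚ.+-identityʳ _))
  (cong (λ z → Σᵛ false true (λ x → uw ρ x * g (false ∷ x)) + z)
      (sym (Σᵛ-0 false true λ x → ℚ.*-zeroˡ (g (true ∷ x))))))
U-Σ (⋆ ∷ ρ) g = trans (mix-½ _ _) (trans (ℚ.*-distribˡ-+ ½′ _ _)
  (cong₂ _+_ (half (g ∘ (false ∷_))) (half (g ∘ (true ∷_)))))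
  where
  scale : ∀ b r → ½′ * (if b then r else 0ℚ) ≡ (if b then ½′ * r else 0ℚ)
  scale true  r = refl
  scale false r = ℚ.*-zeroʳ ½′
  half : ∀ h → ½′ * U ρ h ≡ Σᵛ false true (λ x → uw (⋆ ∷ ρ) (false ∷ x) * h x)
  half h = begin
    ½′ * U ρ h                                                ≡⟨ cong (½′ *_) (U-Σ ρ h) ⟩
    ½′ * Σᵛ false true (λ x → uw ρ x * h x)                   ≡⟨ Σᵛ-* false true ½′ (λ x → uw ρ x * h x) ⟨
    Σᵛ false true (λ x → ½′ * (uw ρ x * h x))                 ≡⟨ Σᵛ-cong false true (λ x →
      trans (sym (ℚ.*-assoc ½′ _ (h x))) (cong (_* h x) (scale (consistent ρ x) (½′ ^ᵠ stars ρ)))) ⟩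
    Σᵛ false true (λ x → uw (⋆ ∷ ρ) (false ∷ x) * h x)       ∎
    where open ≡-Reasoning

-- A coordinate that is free with probability 2p and then fair is one with probability p. Hence the
-- uniform distributions, averaged over the random fixing, give back the product distribution.
R-U : ∀ {n} (p : Fin n → ℚ) g → R p (λ ρ → U ρ g) ≡ E p g
R-U {zero}  p g = refl
R-U {suc n} p g = trans
  (cong₂ (mix (2ℚ * p zero)) (R-U (p ∘ suc) _) (trans (R-mix (p ∘ suc) ½′ _ _)
      (cong₂ (mix ½′) (R-U (p ∘ suc) _) (R-U (p ∘ suc) _))))
  (lem (p zero) _ _)
  where
  open +-*-Solver
  lem : ∀ p a b → mix (2ℚ * p) a (mix ½′ a b) ≡ mix p a b
  lem rewrite ½′≡½ = solve 3 (λ p a b →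
    (con 1ℚ :- con 2ℚ :* p) :* a :+ con 2ℚ :* p :* ((con 1ℚ :- con ½) :* a :+ con ½ :* b) :=
    (con 1ℚ :- p) :* a :+ p :* b) refl

-- Costs and errors of finite mixtures of trees

Σᶠ : ∀ {m} → (Fin m → ℚ) → ℚ
Σᶠ = foldr _+_ 0ℚ

seq-∑ : ∀ {m} (v : Fin m → ℝ) k → seq (∑ v) k ≡ Σᶠ (λ i → seq (v i) k)
seq-∑ {zero}  v k = refl
seq-∑ {suc m} v k = cong (λ z → seq (v zero) k + z) (seq-∑ (v ∘ suc) k)

Σᶠ-cong : ∀ {m} {v w : Fin m → ℚ} → (∀ i → v i ≡ w i) → Σᶠ v ≡ Σᶠ w
Σᶠ-cong {zero}  e = refl
Σᶠ-cong {suc m} e = cong₂ _+_ (e zero) (Σᶠ-cong (e ∘ suc))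

R-Σᶠ : ∀ {n m} (p : Fin n → ℚ) (w : Fin m → ℚ) (G : Fin m → Fixing n → ℚ) →
  R p (λ ρ → Σᶠ (λ i → w i * G i ρ)) ≡ Σᶠ (λ i → w i * R p (G i))
R-Σᶠ {m = zero}  p w G = R-const p 0ℚ
R-Σᶠ {m = suc m} p w G = trans (R-+ p _ _) (cong₂ _+_ (R-* p (w zero) (G zero)) (R-Σᶠ p (w ∘ suc) (G ∘ suc)))

seq-cost : ∀ {n} (T : PDT n) ρ k → seq (cost T (uniform ρ)) k ≡ U ρ (ι ∘ queries T)
seq-cost T ρ k = trans (seq-∑ⱽ false true (λ x → uniform ρ x Real.* fromℕ (queries T x)) k)
  (trans (Σᵛ-cong false true (λ x → trans (seq-* (uniform ρ x) (fromℕ (queries T x)) k)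
    (cong₂ _*_ (seq-uniform ρ x k) (sym (fromℤ-/1 (+ queries T x)))))) (sym (U-Σ ρ _)))

skewCost : ∀ {n} → (Fin n → ℚ) → PDT n → ℚ
skewCost p T = R p (λ ρ → U ρ (ι ∘ queries (restrict ρ T)))

seq-q̄ : ∀ {n} 𝒯 (ν : Mass n) k → let open Randomised in
  seq (q̄ 𝒯 ν) k ≡ Σᶠ (λ j → seq (weight 𝒯 j) k * seq (cost (tree 𝒯 j) ν) k)
seq-q̄ 𝒯 ν k = trans (seq-∑ (λ j → weight 𝒯 j Real.* cost (tree 𝒯 j) ν) k)
  (Σᶠ-cong (λ j → seq-* (weight 𝒯 j) (cost (tree 𝒯 j) ν) k))
  where open Randomised

seq-q̄-uniform : ∀ {n} 𝒯 (ρ : Fixing n) k → let open Randomised in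
  seq (q̄ 𝒯 (uniform ρ)) k ≡ Σᶠ (λ j → seq (weight 𝒯 j) k * U ρ (ι ∘ queries (tree 𝒯 j)))
seq-q̄-uniform 𝒯 ρ k = trans (seq-q̄ 𝒯 (uniform ρ) k)
  (Σᶠ-cong (λ j → cong (seq (weight 𝒯 j) k *_) (seq-cost (tree 𝒯 j) ρ k)))
  where open Randomised

seq-sq̄ : ∀ {n} (μ : Product n) 𝒯 k → let open Randomised in
  seq (sq̄ μ 𝒯) k ≡ Σᶠ (λ j → seq (weight 𝒯 j) k * skewCost (at μ k) (tree 𝒯 j))
seq-sq̄ μ 𝒯 k = trans
  (seq-∑ⱽ fixed₀ ⋆ (λ ρ → fixingMass μ ρ Real.* q̄ (mapTrees (restrict ρ) 𝒯) (uniform ρ)) k)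
  (trans (Σᵛ-cong fixed₀ ⋆ (λ ρ → trans (seq-* (fixingMass μ ρ) (q̄ (mapTrees (restrict ρ) 𝒯) (uniform ρ)) k)
      (cong₂ _*_ (seq-fixingMass μ ρ k) (seq-q̄-uniform (mapTrees (restrict ρ) 𝒯) ρ k))))
  (trans (sym (R-Σ (at μ k) _))
    (R-Σᶠ (at μ k) (λ j → seq (weight 𝒯 j) k) (λ j ρ → U ρ (ι ∘ queries (restrict ρ (tree 𝒯 j)))))))
  where open Randomised

seq-err : ∀ {n} f 𝒯 (μ : Product n) k → let open Randomised in
  seq (err f 𝒯 (mass μ)) k ≡ Σᶠ (λ j → seq (weight 𝒯 j) k * E (at μ k) (ind ∘ wrong f (tree 𝒯 j)))
seq-err f 𝒯 μ k = trans
  (seq-∑ {size 𝒯} (λ j → weight 𝒯 j Real.* error f (tree 𝒯 j) (mass μ)) k)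
  (Σᶠ-cong {size 𝒯} (λ j → trans (seq-* (weight 𝒯 j) (error f (tree 𝒯 j) (mass μ)) k)
      (cong (seq (weight 𝒯 j) k *_) (seq-error f (tree 𝒯 j) μ k))))
  where open Randomised

-- Parities and affine sets

⊕-assoc : ∀ {n} (x y z : Word n) → (x ⊕ y) ⊕ z ≡ x ⊕ (y ⊕ z)
⊕-assoc = Vec.zipWith-assoc Bool.xor-assoc

⊕-comm : ∀ {n} (x y : Word n) → x ⊕ y ≡ y ⊕ x
⊕-comm = Vec.zipWith-comm Bool.xor-comm

⊕-identityˡ : ∀ {n} (x : Word n) → zeroʷ ⊕ x ≡ x
⊕-identityˡ = Vec.zipWith-identityˡ Bool.xor-identityˡ

⊕-identityʳ : ∀ {n} (x : Word n) → x ⊕ zeroʷ ≡ x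
⊕-identityʳ = Vec.zipWith-identityʳ Bool.xor-identityʳ

⊕-self : ∀ {n} (x : Word n) → x ⊕ x ≡ zeroʷ
⊕-self []      = refl
⊕-self (b ∷ x) = cong₂ _∷_ (Bool.xor-same b) (⊕-self x)

⊕-cancelʳ : ∀ {n} (x y : Word n) → (x ⊕ y) ⊕ y ≡ x
⊕-cancelʳ x y = trans (⊕-assoc x y y) (trans (cong (x ⊕_) (⊕-self y)) (⊕-identityʳ x))

⟨,⟩-⊕ʳ : ∀ {n} (a x y : Word n) → ⟨ a , x ⊕ y ⟩ ≡ ⟨ a , x ⟩ xor ⟨ a , y ⟩
⟨,⟩-⊕ʳ []       []      []      = refl
⟨,⟩-⊕ʳ (a ∷ as) (b ∷ x) (c ∷ y) rewrite ⟨,⟩-⊕ʳ as x y =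
  solve 5 (λ a b c d e → a :* (b :+ c) :+ (d :+ e) := a :* b :+ d :+ (a :* c :+ e)) refl a b c ⟨ as , x ⟩
      ⟨ as , y ⟩
  where open xor-∧-Solver

⟨,⟩-comm : ∀ {n} (a x : Word n) → ⟨ a , x ⟩ ≡ ⟨ x , a ⟩
⟨,⟩-comm a x = cong (Vec.foldr′ _xor_ false) (Vec.zipWith-comm Bool.∧-comm a x)

⟨,⟩-⊕ˡ : ∀ {n} (a b x : Word n) → ⟨ a ⊕ b , x ⟩ ≡ ⟨ a , x ⟩ xor ⟨ b , x ⟩
⟨,⟩-⊕ˡ a b x = trans (⟨,⟩-comm (a ⊕ b) x) (trans (⟨,⟩-⊕ʳ x a b) (cong₂ _xor_ (⟨,⟩-comm x a) (⟨,⟩-comm x b)))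

⟨0,⟩ : ∀ {n} (x : Word n) → ⟨ zeroʷ , x ⟩ ≡ false
⟨0,⟩ []      = refl
⟨0,⟩ (b ∷ x) = ⟨0,⟩ x

find : ∀ {n} (P : Word n → Bool) → (∃ λ x → P x ≡ true) ⊎ (∀ x → P x ≡ false)
find {zero} P with P [] in e
... | true  = inj₁ ([] , e)
... | false = inj₂ λ { [] → e }
find {suc n} P with find (P ∘ (false ∷_)) | find (P ∘ (true ∷_))
... | inj₁ (x , e) | _            = inj₁ (false ∷ x , e)
... | inj₂ _       | inj₁ (x , e) = inj₁ (true ∷ x , e)
... | inj₂ h₀      | inj₂ h₁      = inj₂ λ { (false ∷ x) → h₀ x ; (true ∷ x) → h₁ x }

-- Unlike `AffineSubspace`, this includes the empty set.
Affine : ∀ {n} → (Word n → Bool) → Set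
Affine P = ∀ x y z → P x ≡ true → P y ≡ true → P z ≡ true → P (x ⊕ y ⊕ z) ≡ true

-- Three translations by the origin amount to one.
member-affine : ∀ {n} (S : AffineSubspace n) → Affine (AffineSubspace.member S)
member-affine S x y z hx hy hz = subst (λ w → direction w ≡ true) e (⊕-closed _ _ (⊕-closed _ _ hx hy) hz)
  where
  open AffineSubspace S
  o = origin
  e : ((x ⊕ o) ⊕ (y ⊕ o)) ⊕ (z ⊕ o) ≡ (x ⊕ y ⊕ z) ⊕ o
  e = trans (sym (⊕-assoc _ z o)) (cong (λ w → w ⊕ z ⊕ o) (trans (cong (x ⊕ o ⊕_) (⊕-comm y o))
    (trans (sym (⊕-assoc (x ⊕ o) o y)) (cong (_⊕ y) (⊕-cancelʳ x o)))))

affine-∷ : ∀ {n} {P : Word (suc n) → Bool} → Affine P → ∀ b → Affine (P ∘ (b ∷_))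
affine-∷ {P = P} A b x y z hx hy hz =
  subst (λ c → P (c ∷ (x ⊕ y ⊕ z)) ≡ true) (cong (_xor b) (Bool.xor-same b)) (A _ _ _ hx hy hz)

true⇔ : ∀ {a b} → (a ≡ true → b ≡ true) → (b ≡ true → a ≡ true) → a ≡ b
true⇔ {true}  {b}     f g = sym (f refl)
true⇔ {false} {false} f g = refl
true⇔ {false} {true}  f g = g refl

∧-true : ∀ {a b} → a ∧ b ≡ true → a ≡ true × b ≡ true
∧-true {true} {true} _ = refl , refl

agrees : ∀ {n} → Word n → Bool → Word n → Bool
agrees a b x = not (b xor ⟨ a , x ⟩)

affine-∧ : ∀ {n} {P : Word n → Bool} → Affine P → ∀ a b → Affine (λ x → P x ∧ agrees a b x)
affine-∧ {P = P} A a b x y z hx hy hz with ∧-true {P x} hx | ∧-true {P y} hy | ∧-true {P z} hz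
... | px , ax | py , ay | pz , az = cong₂ _∧_ (A x y z px py pz) (begin
    not (b xor ⟨ a , x ⊕ y ⊕ z ⟩)
      ≡⟨ cong (λ c → not (b xor c)) (trans (⟨,⟩-⊕ʳ a (x ⊕ y) z) (cong (_xor ⟨ a , z ⟩) (⟨,⟩-⊕ʳ a x y))) ⟩
    not (b xor ((⟨ a , x ⟩ xor ⟨ a , y ⟩) xor ⟨ a , z ⟩))
      ≡⟨ lem b ⟨ a , x ⟩ ⟨ a , y ⟩ ⟨ a , z ⟩ ax ay az ⟩
    true ∎)
  where
  open ≡-Reasoning
  lem : ∀ b c d e → not (b xor c) ≡ true → not (b xor d) ≡ true → not (b xor e) ≡ true →
    not (b xor ((c xor d) xor e)) ≡ true
  lem false false false false _ _ _ = refl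
  lem true  true  true  true  _ _ _ = refl

sgn-not : ∀ b → sgn (not b) ≡ - sgn b
sgn-not true  = refl
sgn-not false = refl

E-signed-leaf : ∀ {n} (p : Fin n → ℚ) f P b →
  ∣ E p (λ x → ind (P x) * sgn (b xor f x)) ∣ ≡ ∣ E p (signed f P) ∣
E-signed-leaf p f P false = refl
E-signed-leaf p f P true  = trans
  (cong ∣_∣ (trans (E-cong p λ x → trans (cong (ind (P x) *_) (sgn-not (f x)))
      (sym (ℚ.neg-distribʳ-* (ind (P x)) (sgn (f x)))))
    (E-neg p (signed f P))))
  (ℚ.∣-p∣≡∣p∣ (E p (signed f P)))

-- The signed agreement is additive over the two answers to a query, and a query cuts an affine set
-- into affine sets. P is kept general for this induction. At a leaf the output only changes the
-- global sign, and there are at most 2^depth leaves.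
tree-discrepancy : ∀ {n} {p : Fin n → ℚ} {f β} → 0ℚ ≤ β →
  (∀ P → Affine P → ∣ E p (signed f P) ∣ ≤ β) →
  ∀ T P → Affine P → ∣ E p (λ x → ind (P x) * sgn (wrong f T x)) ∣ ≤ ι (2 ℕ.^ depth T) * β
tree-discrepancy {p = p} {f} {β} 0≤β h (leaf b) P A = subst₂ _≤_
  (sym (E-signed-leaf p f P b)) (sym (trans (cong (_* β) fromℤ-1) (ℚ.*-identityˡ β))) (h P A)
tree-discrepancy {p = p} {f} {β} 0≤β h (node a T₀ T₁) P A = begin
  ∣ E p (λ x → ind (P x) * sgn (wrong f (node a T₀ T₁) x)) ∣
    ≡⟨ cong ∣_∣ (trans (E-cong p split) (E-+ p _ _)) ⟩
  ∣ E p (g false T₀) + E p (g true T₁) ∣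
    ≤⟨ ℚ.∣p+q∣≤∣p∣+∣q∣ (E p (g false T₀)) (E p (g true T₁)) ⟩
  ∣ E p (g false T₀) ∣ + ∣ E p (g true T₁) ∣
    ≤⟨ ℚ.+-mono-≤ (tree-discrepancy 0≤β h T₀ _ (affine-∧ A a false))
        (tree-discrepancy 0≤β h T₁ _ (affine-∧ A a true)) ⟩
  ι (2 ℕ.^ depth T₀) * β + ι (2 ℕ.^ depth T₁) * β
    ≡⟨ trans (sym (ℚ.*-distribʳ-+ β (ι (2 ℕ.^ depth T₀)) (ι (2 ℕ.^ depth T₁))))
        (cong (_* β) (sym (ι-+ (2 ℕ.^ depth T₀) (2 ℕ.^ depth T₁)))) ⟩
  ι (2 ℕ.^ depth T₀ ℕ.+ 2 ℕ.^ depth T₁) * β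
    ≤⟨ *-monoʳ 0≤β (ι-mono (ℕ.+-mono-≤ (ℕ.^-monoʳ-≤ 2 (ℕ.m≤m⊔n (depth T₀) (depth T₁)))
         (ℕ.≤-trans (ℕ.^-monoʳ-≤ 2 (ℕ.m≤n⊔m (depth T₀) (depth T₁))) (ℕ.m≤m+n _ 0)))) ⟩
  ι (2 ℕ.^ depth (node a T₀ T₁)) * β ∎
  where
  open ≤-Reasoning
  g : Bool → PDT _ → Word _ → ℚ
  g b T x = ind (P x ∧ agrees a b x) * sgn (wrong f T x)
  case₂ : ∀ b q s t → ind b * sgn (if q then t else s) ≡
    ind (b ∧ not (false xor q)) * sgn s + ind (b ∧ not (true xor q)) * sgn t
  case₂ false q s t = trans (ℚ.*-zeroˡ (sgn (if q then t else s)))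
      (sym (cong₂ _+_ (ℚ.*-zeroˡ (sgn s)) (ℚ.*-zeroˡ (sgn t))))
  case₂ true false s t = sym (trans (cong (λ z → 1ℚ * sgn s + z) (ℚ.*-zeroˡ (sgn t))) (ℚ.+-identityʳ _))
  case₂ true true  s t = sym (trans (cong (λ z → z + 1ℚ * sgn t) (ℚ.*-zeroˡ (sgn s))) (ℚ.+-identityˡ _))
  split : ∀ x → ind (P x) * sgn (wrong f (node a T₀ T₁) x) ≡ g false T₀ x + g true T₁ x
  split x with ⟨ a , x ⟩
  ... | false = case₂ (P x) false (wrong f T₀ x) (wrong f T₁ x)
  ... | true  = case₂ (P x) true  (wrong f T₀ x) (wrong f T₁ x)

sgn-ind : ∀ b → sgn b ≡ 1ℚ + - (1ℚ + 1ℚ) * ind b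
sgn-ind true  = refl
sgn-ind false = refl

-- An error of at most ⅓ means a correlation of at least 1 - 2 · ⅓, which computes to ⅓ and so
-- starts the chain.
depth-bound : ∀ {n} {p : Fin n → ℚ} {f β} → 0ℚ ≤ β →
  (∀ P → Affine P → ∣ E p (signed f P) ∣ ≤ β) →
  ∀ T → E p (ind ∘ wrong f T) ≤ ⅓ → ⅓ ≤ ι (2 ℕ.^ depth T) * β
depth-bound {p = p} {f} {β} 0≤β h T e≤⅓ = begin
  1ℚ + - (1ℚ + 1ℚ) * ⅓                           ≤⟨ ℚ.+-monoʳ-≤ 1ℚ (ℚ.*-monoˡ-≤-nonPos (- (1ℚ + 1ℚ)) e≤⅓) ⟩
  1ℚ + - (1ℚ + 1ℚ) * E p (ind ∘ wrong f T)       ≡⟨ cong₂ _+_ (E-const p 1ℚ)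
      (E-* p (- (1ℚ + 1ℚ)) (ind ∘ wrong f T)) ⟨
  E p (λ _ → 1ℚ) + E p (λ x → - (1ℚ + 1ℚ) * ind (wrong f T x))
      ≡⟨ E-+ p (λ _ → 1ℚ) (λ x → - (1ℚ + 1ℚ) * ind (wrong f T x)) ⟨
  E p (λ x → 1ℚ + - (1ℚ + 1ℚ) * ind (wrong f T x)) ≡⟨ E-cong p
      (λ x → trans (sym (sgn-ind (wrong f T x))) (sym (ℚ.*-identityˡ (sgn (wrong f T x))))) ⟩
  E p (λ x → 1ℚ * sgn (wrong f T x))             ≤⟨ p≤∣p∣ _ ⟩
  ∣ E p (λ x → 1ℚ * sgn (wrong f T x)) ∣         ≤⟨ tree-discrepancy 0≤β h T (λ _ → true)
      (λ _ _ _ _ _ _ → refl) ⟩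
  ι (2 ℕ.^ depth T) * β                          ∎
  where open ≤-Reasoning

-- The function and the distribution

-- Words of length N + k are read as x ++ y; `G` has one further bit in front.
after : ∀ N {k} → Word (N ℕ.+ k) → Word k
after zero    w       = w
after (suc N) (_ ∷ w) = after N w

F : ∀ N {k} → Vec (Word k) (suc N) → Word (N ℕ.+ k) → Bool
F zero    (c ∷ [])  w           = ⟨ c , w ⟩
F (suc N) (c ∷ cs)  (true ∷ w)  = ⟨ c , after N w ⟩
F (suc N) (c ∷ cs)  (false ∷ w) = F N cs w

G : ∀ N {k} → Vec (Word k) (suc N) → Word (suc (N ℕ.+ k)) → Bool
G N cs (b ∷ w) = b xor F N cs w

abstract
  -- The reciprocal of n + 1, not of n, so that it is total: `inv 7` is 1/8, `inv 15` is 1/16 and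
  -- `inv 63` is 1/64.
  inv : ℕ → ℚ
  inv n = (ℚ.1/ ι (suc n)) {{ℚ.pos⇒nonZero (ι (suc n)) {{ι-suc-pos n}}}}

  inv-* : ∀ n → inv n * ι (suc n) ≡ 1ℚ
  inv-* n = ℚ.*-inverseˡ (ι (suc n)) {{ℚ.pos⇒nonZero (ι (suc n)) {{ι-suc-pos n}}}}

  inv-pos : ∀ n → Positive (inv n)
  inv-pos n = ℚ.1/pos⇒pos (ι (suc n)) {{ι-suc-pos n}}

0≤inv : ∀ n → 0ℚ ≤ inv n
0≤inv n = ℚ.<⇒≤ (ℚ.positive⁻¹ (inv n) {{inv-pos n}})

inv-0 : inv 0 ≡ 1ℚ
inv-0 = trans (sym (ℚ.*-identityʳ (inv 0))) (trans (cong (inv 0 *_) (sym fromℤ-1)) (inv-* 0))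

inv≤ : ∀ n {r} → 1ℚ ≤ r * ι (suc n) → inv n ≤ r
inv≤ n {r} h = ℚ.*-cancelʳ-≤-pos (ι (suc n)) {{ι-suc-pos n}} (subst (_≤ r * ι (suc n)) (sym (inv-* n)) h)

inv-unique : ∀ n {r} → r * ι (suc n) ≡ 1ℚ → r ≡ inv n
inv-unique n {r} e = begin
  r                        ≡⟨ ℚ.*-identityʳ r ⟨
  r * 1ℚ                   ≡⟨ cong (r *_) (inv-* n) ⟨
  r * (inv n * ι (suc n))  ≡⟨ solve 3 (λ r i s → r :* (i :* s) := r :* s :* i) refl r (inv n) (ι (suc n)) ⟩
  r * ι (suc n) * inv n    ≡⟨ cong (_* inv n) e ⟩
  1ℚ * inv n               ≡⟨ ℚ.*-identityˡ (inv n) ⟩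
  inv n                    ∎
  where
  open ≡-Reasoning
  open +-*-Solver

-- This makes the first one uniform: of n + 2 possible positions the nearest is taken with
-- probability 1/(n + 2), and the other n + 1 share the survival probability equally.
inv-hazard : ∀ n → (1ℚ - inv (suc n)) * inv n ≡ inv (suc n)
inv-hazard n = inv-unique (suc n) (begin
  (1ℚ - inv (suc n)) * inv n * ι (suc (suc n))
    ≡⟨ lem (inv (suc n)) (inv n) (ι (suc (suc n))) ⟩
  inv n * (ι (suc (suc n)) - inv (suc n) * ι (suc (suc n)))
    ≡⟨ cong₂ (λ s t → inv n * (s - t)) (ι-suc (suc n)) (inv-* (suc n)) ⟩
  inv n * (1ℚ + ι (suc n) - 1ℚ)
    ≡⟨ lem₂ (inv n) (ι (suc n)) ⟩
  inv n * ι (suc n)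
    ≡⟨ inv-* n ⟩
  1ℚ ∎)
  where
  open ≡-Reasoning
  open +-*-Solver
  lem : ∀ i j s → (1ℚ - i) * j * s ≡ j * (s - i * s)
  lem = solve 3 (λ i j s → (con 1ℚ :- i) :* j :* s := j :* (s :- i :* s)) refl
  lem₂ : ∀ i s → i * (1ℚ + s - 1ℚ) ≡ i * s
  lem₂ = solve 2 (λ i s → i :* (con 1ℚ :+ s :- con 1ℚ) := i :* s) refl

-- Keeps the hazards at most one half, as 0-biasedness demands; then twice a hazard is still a
-- probability.
inv-suc≤½ : ∀ n → inv (suc n) ≤ ½′
inv-suc≤½ n = inv≤ (suc n) (subst (1ℚ ≤_) (cong (½′ *_) (sym e))
    (subst₂ _≤_ (ℚ.+-identityʳ 1ℚ) (lem (ι n)) (ℚ.+-monoʳ-≤ 1ℚ (0≤* 0≤½′ (0≤ι n)))))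
  where
  e : ι (suc (suc n)) ≡ 1ℚ + (1ℚ + ι n)
  e = trans (ι-suc (suc n)) (cong (λ z → 1ℚ + z) (ι-suc n))
  open +-*-Solver
  lem : ∀ s → 1ℚ + ½′ * s ≡ ½′ * (1ℚ + (1ℚ + s))
  lem rewrite ½′≡½ = solve 1 (λ s → con 1ℚ :+ con ½ :* s := con ½ :* (con 1ℚ :+ (con 1ℚ :+ s))) refl

halves : ∀ {n} → Fin n → ℚ
halves _ = ½′

-- With these hazard rates the position of the first one among the first N
-- coordinates, "none" included, is uniform on N + 1 values.
hazards : ∀ N {k} → Fin (N ℕ.+ k) → ℚ
hazards zero    i       = ½′
hazards (suc N) zero    = inv (suc N)
hazards (suc N) (suc i) = hazards N i

biases : ∀ N {k} → Fin (suc (N ℕ.+ k)) → ℚ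
biases N zero    = ½′
biases N (suc i) = hazards N i

inv-prob : ∀ n → IsProb (inv (suc n))
inv-prob n = 0≤inv (suc n) , ℚ.≤-trans (inv-suc≤½ n) (proj₂ ½′-prob)

hazards-prob : ∀ N {k} → IsProbs (hazards N {k})
hazards-prob zero    i       = ½′-prob
hazards-prob (suc N) zero    = inv-prob N
hazards-prob (suc N) (suc i) = hazards-prob N i

-- Discrepancy

mix-∣∣ : ∀ {p a b c d} → IsProb p → ∣ a ∣ ≤ c → ∣ b ∣ ≤ d → ∣ mix p a b ∣ ≤ mix p c d
mix-∣∣ {p} {a} {b} P a≤c b≤d = ∣p∣≤
  (mix-mono P (ℚ.≤-trans (p≤∣p∣ a) a≤c) (ℚ.≤-trans (p≤∣p∣ b) b≤d))
  (subst (_≤ _) (mix-neg p a b) (mix-mono P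
    (ℚ.≤-trans (p≤∣p∣ (- a)) (subst (_≤ _) (sym (ℚ.∣-p∣≡∣p∣ a)) a≤c))
    (ℚ.≤-trans (p≤∣p∣ (- b)) (subst (_≤ _) (sym (ℚ.∣-p∣≡∣p∣ b)) b≤d))))

fibre-bound : ∀ N {k} (g : Word (N ℕ.+ k) → ℚ) r → (∀ (x : Word N) →
    ∣ E halves (λ (y : Word k) → g (x ++ y)) ∣ ≤ r) → ∣ E (hazards N) g ∣ ≤ r
fibre-bound zero    g r h = h []
fibre-bound (suc N) g r h = subst (∣ E (hazards (suc N)) g ∣ ≤_) (mix-same (inv (suc N)) r)
  (mix-∣∣ (inv-prob N) (fibre-bound N (g ∘ (false ∷_)) r (λ x → h (false ∷ x)))
      (fibre-bound N (g ∘ (true ∷_)) r (λ x → h (true ∷ x))))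

after-++ : ∀ {N k} (x : Word N) (y : Word k) → after N (x ++ y) ≡ y
after-++ []      y = refl
after-++ (b ∷ x) y = after-++ x y

sumᵛ : ∀ {A : Set} {m} → (A → ℚ) → Vec A m → ℚ
sumᵛ Φ []       = 0ℚ
sumᵛ Φ (c ∷ cs) = Φ c + sumᵛ Φ cs

-- Φ c bounds every y-fibre on which the function is the character of c, whatever x is. Conditioning
-- on the first one uses each of the N + 1 code words with the same probability, by `inv-hazard`.
F-bound : ∀ N {k} (cs : Vec (Word k) (suc N)) (P : Word (N ℕ.+ k) → Bool) Φ →
  (∀ x c → ∣ E halves (λ y → ind (P (x ++ y)) * sgn ⟨ c , y ⟩) ∣ ≤ Φ c) →
  ∣ E (hazards N) (signed (F N cs) P) ∣ ≤ inv N * sumᵛ Φ cs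
F-bound zero (c ∷ []) P Φ h = subst (∣ E halves (signed (F 0 (c ∷ [])) P) ∣ ≤_) (sym e) (h [] c)
  where
  e : inv 0 * (Φ c + 0ℚ) ≡ Φ c
  e = trans (cong₂ _*_ inv-0 (ℚ.+-identityʳ (Φ c))) (ℚ.*-identityˡ (Φ c))
F-bound (suc N) (c ∷ cs) P Φ h = subst (∣ E (hazards (suc N)) (signed (F (suc N) (c ∷ cs)) P) ∣ ≤_) e
  (mix-∣∣ (inv-prob N)
    (F-bound N cs (P ∘ (false ∷_)) Φ (h ∘ (false ∷_)))
    (fibre-bound N (λ w → ind (P (true ∷ w)) * sgn ⟨ c , after N w ⟩) (Φ c) λ (x : Word N) →
        subst (λ z → ∣ z ∣ ≤ Φ c)
      (E-cong halves {λ y → ind (P (true ∷ x ++ y)) * sgn ⟨ c , y ⟩} λ y →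
          cong (λ y′ → ind (P (true ∷ x ++ y)) * sgn ⟨ c , y′ ⟩) (sym (after-++ x y)))
      (h (true ∷ x) c)))
  where
  open +-*-Solver
  lem : ∀ i j s t → (1ℚ - i) * (j * s) + i * t ≡ (1ℚ - i) * j * s + i * t
  lem = solve 4 (λ i j s t → (con 1ℚ :- i) :* (j :* s) :+ i :* t := (con 1ℚ :- i) :* j :* s :+ i :* t) refl
  lem₂ : ∀ i s t → i * s + i * t ≡ i * (t + s)
  lem₂ = solve 3 (λ i s t → i :* s :+ i :* t := i :* (t :+ s)) refl
  S′ = sumᵛ Φ cs
  e : mix (inv (suc N)) (inv N * S′) (Φ c) ≡ inv (suc N) * (Φ c + S′)
  e = trans (lem (inv (suc N)) (inv N) S′ (Φ c)) (trans (cong (λ z → z * S′ + inv (suc N) * Φ c) (inv-hazard N))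
    (lem₂ (inv (suc N)) S′ (Φ c)))

-- Fourier coefficients of the fibres

E-shift : ∀ {k} (u : Word k) (g : Word k → ℚ) → E halves (λ v → g (v ⊕ u)) ≡ E halves g
E-shift []          g = refl
E-shift (false ∷ u) g = cong₂ (mix ½′) (E-shift u (g ∘ (false ∷_))) (E-shift u (g ∘ (true ∷_)))
E-shift (true ∷ u)  g = trans (cong₂ (mix ½′) (E-shift u (g ∘ (true ∷_))) (E-shift u (g ∘ (false ∷_))))
  (trans (mix-½ (E halves (g ∘ (true ∷_))) _) (trans (cong (½′ *_) (ℚ.+-comm (E halves (g ∘ (true ∷_))) _))
    (sym (mix-½ (E halves (g ∘ (false ∷_))) _))))

-- Summed over all c, the characters cancel at every v other than zero. In the induction the words v
-- with leading bit one cancel between the two leading bits of c. The normalisation 2⁻ᵏ sits inside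
-- `E`.
fourier-inversion-0 : ∀ {k} (g : Word k → ℚ) →
  Σᵛ false true (λ c → E halves (λ v → g v * sgn ⟨ c , v ⟩)) ≡ g zeroʷ
fourier-inversion-0 {zero}  g = ℚ.*-identityʳ (g [])
fourier-inversion-0 {suc k} g = trans (sym (Σᵛ-+ {k} (λ c → E halves (λ v → g v * sgn ⟨ false ∷ c , v ⟩))
    (λ c → E halves (λ v → g v * sgn ⟨ true ∷ c , v ⟩))))
    (trans (Σᵛ-cong false true pair) (fourier-inversion-0 (g ∘ (false ∷_))))
  where
  Σᵛ-+ : ∀ {n} (a b : Word n → ℚ) → Σᵛ false true (λ v → a v + b v) ≡ Σᵛ false true a + Σᵛ false true b
  Σᵛ-+ {zero}  a b = refl
  Σᵛ-+ {suc n} a b = trans (cong₂ _+_ (Σᵛ-+ (a ∘ (false ∷_)) (b ∘ (false ∷_)))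
      (Σᵛ-+ (a ∘ (true ∷_)) (b ∘ (true ∷_))))
    (lem (Σᵛ false true (a ∘ (false ∷_))) (Σᵛ false true (b ∘ (false ∷_))) (Σᵛ false true (a ∘ (true ∷_)))
        (Σᵛ false true (b ∘ (true ∷_))))
    where
    open +-*-Solver
    lem : ∀ a b c d → (a + b) + (c + d) ≡ (a + c) + (b + d)
    lem = solve 4 (λ a b c d → a :+ b :+ (c :+ d) := a :+ c :+ (b :+ d)) refl
  lem : ∀ a b → mix ½′ a b + mix ½′ a (- b) ≡ a
  lem a b rewrite ½′≡½ = solve 2 (λ a b → (con 1ℚ :- con ½) :* a :+ con ½ :* b :+
      ((con 1ℚ :- con ½) :* a :+ con ½ :* (:- b)) := a) refl a b
    where open +-*-Solver
  pair : ∀ c → E halves (λ v → g v * sgn ⟨ false ∷ c , v ⟩) + E halves (λ v → g v * sgn ⟨ true ∷ c , v ⟩) ≡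
    E halves (λ v → g (false ∷ v) * sgn ⟨ c , v ⟩)
  pair c = trans (cong (λ z → mix ½′ a b + mix ½′ a z) (trans
      (E-cong halves λ v → trans (cong (g (true ∷ v) *_) (sgn-not ⟨ c , v ⟩))
          (sym (ℚ.neg-distribʳ-* (g (true ∷ v)) _)))
      (E-neg halves (λ v → g (true ∷ v) * sgn ⟨ c , v ⟩))))
    (lem a b)
    where
    a = E halves (λ v → g (false ∷ v) * sgn ⟨ c , v ⟩)
    b = E halves (λ v → g (true ∷ v) * sgn ⟨ c , v ⟩)

module Fibres {N k} {P : Word (N ℕ.+ k) → Bool} (A : Affine P) (x₀ : Word N) (y₀ : Word k) (base : P (x₀ ++ y₀) ≡ true) where

  -- The points (x, v ⊕ y), (x, y) and (x′, y′) sum to (x′, v ⊕ y′), so a difference that occurs at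
  -- a point of one fibre occurs at every point of every other fibre.
  translate : ∀ (x : Word N) (y : Word k) (x′ : Word N) (y′ : Word k) v → P (x ++ y) ≡ true →
      P (x′ ++ y′) ≡ true →
    P (x ++ (v ⊕ y)) ≡ true → P (x′ ++ (v ⊕ y′)) ≡ true
  translate x y x′ y′ v h h′ hv = subst (λ w → P w ≡ true) e (A _ _ _ hv h h′)
    where
    e : (x ++ (v ⊕ y)) ⊕ (x ++ y) ⊕ (x′ ++ y′) ≡ x′ ++ (v ⊕ y′)
    e = trans (cong (_⊕ (x′ ++ y′)) (Vec.zipWith-++ _xor_ x (v ⊕ y) x y))
      (trans (Vec.zipWith-++ _xor_ (x ⊕ x) (v ⊕ y ⊕ y) x′ y′)
      (cong₂ _++_ (trans (cong (_⊕ x′) (⊕-self x)) (⊕-identityˡ x′)) (cong (_⊕ y′) (⊕-cancelʳ v y))))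

  -- The common direction of all nonempty fibres, read off at the base point.
  V : Word k → Bool
  V v = P (x₀ ++ (v ⊕ y₀))

  V-zero : V zeroʷ ≡ true
  V-zero = subst (λ y → P (x₀ ++ y) ≡ true) (sym (⊕-identityˡ y₀)) base

  V-fibre : ∀ (x : Word N) (y : Word k) → P (x ++ y) ≡ true → ∀ v → P (x ++ (v ⊕ y)) ≡ V v
  V-fibre x y h v = true⇔ (translate x y x₀ y₀ v h base) (translate x₀ y₀ x y v base h)

  V-shift : ∀ u → V u ≡ true → ∀ v → V (v ⊕ u) ≡ V v
  V-shift u h v = trans (cong (λ y → P (x₀ ++ y)) (⊕-assoc v u y₀)) (V-fibre x₀ (u ⊕ y₀) h v)

  character : Word k → Word k → ℚ
  character c v = ind (V v) * sgn ⟨ c , v ⟩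

  -- The Fourier coefficient of V at c: it is |V| / 2ᵏ on V^⊥ and 0 elsewhere. In place of this
  -- dichotomy and of the count |V| |V^⊥| = 2ᵏ, the proof works with nonnegativity and with total
  -- sum 1.
  Φ : Word k → ℚ
  Φ c = E halves (character c)

  sgn-xor : ∀ a b → sgn (a xor b) ≡ sgn b * sgn a
  sgn-xor false false = refl
  sgn-xor false true  = refl
  sgn-xor true  false = refl
  sgn-xor true  true  = refl

  shifted : ∀ (x : Word N) (y : Word k) → P (x ++ y) ≡ true → ∀ c →
    E halves (λ (y : Word k) → ind (P (x ++ y)) * sgn ⟨ c , y ⟩) ≡ sgn ⟨ c , y ⟩ * Φ c
  shifted x y h c = begin
    E halves (λ y → ind (P (x ++ y)) * sgn ⟨ c , y ⟩)             ≡⟨ E-shift y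
        (λ y → ind (P (x ++ y)) * sgn ⟨ c , y ⟩) ⟨
    E halves (λ v → ind (P (x ++ (v ⊕ y))) * sgn ⟨ c , v ⊕ y ⟩)   ≡⟨ E-cong halves (λ v →
      trans (cong₂ (λ b d → ind b * sgn d) (V-fibre x y h v) (⟨,⟩-⊕ʳ c v y))
      (trans (cong (ind (V v) *_) (sgn-xor ⟨ c , v ⟩ ⟨ c , y ⟩))
      (lem (ind (V v)) (sgn ⟨ c , y ⟩) (sgn ⟨ c , v ⟩)))) ⟩
    E halves (λ v → sgn ⟨ c , y ⟩ * character c v)                ≡⟨ E-* halves (sgn ⟨ c , y ⟩) (character c) ⟩
    sgn ⟨ c , y ⟩ * Φ c                                           ∎
    where
    open ≡-Reasoning
    open +-*-Solver
    lem : ∀ a b c → a * (b * c) ≡ b * (a * c)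
    lem = solve 3 (λ a b c → a :* (b :* c) := b :* (a :* c)) refl

  0≤ind : ∀ b → 0ℚ ≤ ind b
  0≤ind true  = 0≤1
  0≤ind false = ℚ.≤-refl

  -- If c is orthogonal to V, all terms are nonnegative. Otherwise some u in V has odd product with
  -- c, and the shift by u preserves V but flips the character, so that Φ c = - Φ c.
  0≤Φ : ∀ c → 0ℚ ≤ Φ c
  0≤Φ c with find (λ v → V v ∧ ⟨ c , v ⟩)
  ... | inj₂ none = subst (_≤ Φ c) (E-const (halves {k}) 0ℚ)
      (E-mono (λ _ → ½′-prob) λ v → nonneg (V v) ⟨ c , v ⟩ (none v))
    where
    nonneg : ∀ a b → a ∧ b ≡ false → 0ℚ ≤ ind a * sgn b
    nonneg true  false _ = 0≤1
    nonneg false true  _ = ℚ.≤-refl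
    nonneg false false _ = ℚ.≤-refl
  ... | inj₁ (u , e) with ∧-true {V u} e
  ... | u∈V , ⟨c,u⟩ with ℚ.≤-total 0ℚ (Φ c)
  ... | inj₁ 0≤Φc = 0≤Φc
  ... | inj₂ Φc≤0 = subst (0ℚ ≤_) (sym Φ≡-Φ) (ℚ.neg-antimono-≤ Φc≤0)
    where
    Φ≡-Φ : Φ c ≡ - Φ c
    Φ≡-Φ = begin
      E halves (character c)     ≡⟨ E-shift u (character c) ⟨
      E halves (λ v → character c (v ⊕ u))  ≡⟨ E-cong halves (λ v → trans
        (cong₂ (λ b d → ind b * sgn d) (V-shift u u∈V v) (trans (⟨,⟩-⊕ʳ c v u) (cong (⟨ c , v ⟩ xor_) ⟨c,u⟩)))
        (trans (cong (ind (V v) *_) (sgn-xor ⟨ c , v ⟩ true)) (lem (ind (V v)) (sgn ⟨ c , v ⟩)))) ⟩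
      E halves (λ v → - character c v)      ≡⟨ E-neg halves (character c) ⟩
      - Φ c                      ∎
      where
      open ≡-Reasoning
      open +-*-Solver
      lem : ∀ a b → a * (- 1ℚ * b) ≡ - (a * b)
      lem = solve 2 (λ a b → a :* (con (- 1ℚ) :* b) := :- (a :* b)) refl

  -- A nonempty fibre is a translate of V, and a translation changes a Fourier coefficient only in
  -- sign. An empty fibre contributes 0.
  fibre≤Φ : ∀ (x : Word N) c → ∣ E halves (λ (y : Word k) → ind (P (x ++ y)) * sgn ⟨ c , y ⟩) ∣ ≤ Φ c
  fibre≤Φ x c with find (λ (y : Word k) → P (x ++ y))
  ... | inj₁ (y , h) = ℚ.≤-reflexive (trans (cong ∣_∣ (shifted x y h c)) (unit ⟨ c , y ⟩))
    where
    unit : ∀ b → ∣ sgn b * Φ c ∣ ≡ Φ c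
    unit b = trans (ℚ.∣p*q∣≡∣p∣*∣q∣ (sgn b) (Φ c)) (trans (cong₂ _*_ (one b) (ℚ.0≤p⇒∣p∣≡p (0≤Φ c)))
        (ℚ.*-identityˡ (Φ c)))
      where
      one : ∀ b → ∣ sgn b ∣ ≡ 1ℚ
      one true  = refl
      one false = refl
  ... | inj₂ none = subst (_≤ Φ c) (sym (cong ∣_∣ (trans
      (E-cong halves (λ y → trans (cong (λ b → ind b * sgn ⟨ c , y ⟩) (none y)) (ℚ.*-zeroˡ (sgn ⟨ c , y ⟩))))
      (E-const (halves {k}) 0ℚ)))) (0≤Φ c)

  ∑Φ : Σᵛ false true Φ ≡ 1ℚ
  ∑Φ = trans (fourier-inversion-0 (ind ∘ V)) (cong ind V-zero)

-- Distinctness of the code words in the form in which it is used: summing a nonnegative function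
-- over the list counts no word twice.
Spread : ∀ {k m} → Vec (Word k) m → Set
Spread {k} cs = ∀ (Φ : Word k → ℚ) → (∀ c → 0ℚ ≤ Φ c) → sumᵛ Φ cs ≤ Σᵛ false true Φ

F-discrepancy : ∀ N {k} (cs : Vec (Word k) (suc N)) → Spread cs → ∀ P → Affine P →
  ∣ E (hazards N) (signed (F N cs) P) ∣ ≤ inv N
F-discrepancy N cs spread P A with find P
... | inj₂ none = subst (_≤ inv N) (sym (cong ∣_∣ (trans
    (E-cong (hazards N) (λ w → trans (cong (λ b → ind b * sgn (F N cs w)) (none w))
        (ℚ.*-zeroˡ (sgn (F N cs w)))))
    (E-const (hazards N) 0ℚ)))) (0≤inv N)
... | inj₁ (w , h) with Vec.splitAt N w
... | x₀ , y₀ , refl = begin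
  ∣ E (hazards N) (signed (F N cs) P) ∣ ≤⟨ F-bound N cs P Φ fibre≤Φ ⟩
  inv N * sumᵛ Φ cs                     ≤⟨ *-monoˡ (0≤inv N) (spread Φ 0≤Φ) ⟩
  inv N * Σᵛ false true Φ               ≡⟨ trans (cong (inv N *_) ∑Φ) (ℚ.*-identityʳ (inv N)) ⟩
  inv N                                 ∎
  where
  open ≤-Reasoning
  open Fibres A x₀ y₀ h

G-discrepancy : ∀ N {k} (cs : Vec (Word k) (suc N)) → Spread cs → ∀ P → Affine P →
  ∣ E (biases N) (signed (G N cs) P) ∣ ≤ inv N
G-discrepancy N cs spread P A = subst (∣ E (biases N) (signed (G N cs) P) ∣ ≤_) (mix-same ½′ (inv N))
  (mix-∣∣ ½′-prob (F-discrepancy N cs spread _ (affine-∷ A false))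
    (subst (_≤ inv N) (sym (E-signed-leaf (hazards N) (F N cs) (P ∘ (true ∷_)) true))
      (F-discrepancy N cs spread _ (affine-∷ A true))))

-- Code words, and the mass of the point zero

allWords : ∀ k → Vec (Word k) (2 ℕ.^ k)
allWords zero    = [] ∷ []
-- The trailing empty vector matches 2^(1+k), which unfolds to 2ᵏ + (2ᵏ + 0).
allWords (suc k) = Vec.map (false ∷_) (allWords k) ++ (Vec.map (true ∷_) (allWords k) ++ [])

sumᵛ-++ : ∀ {A : Set} {m n} (Φ : A → ℚ) (xs : Vec A m) (ys : Vec A n) →
    sumᵛ Φ (xs ++ ys) ≡ sumᵛ Φ xs + sumᵛ Φ ys
sumᵛ-++ Φ []       ys = sym (ℚ.+-identityˡ _)
sumᵛ-++ Φ (x ∷ xs) ys = trans (cong (λ z → Φ x + z) (sumᵛ-++ Φ xs ys))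
    (sym (ℚ.+-assoc (Φ x) (sumᵛ Φ xs) (sumᵛ Φ ys)))

sumᵛ-map : ∀ {A B : Set} {m} (Φ : B → ℚ) (g : A → B) (xs : Vec A m) → sumᵛ Φ (Vec.map g xs) ≡ sumᵛ (Φ ∘ g) xs
sumᵛ-map Φ g []       = refl
sumᵛ-map Φ g (x ∷ xs) = cong (λ z → Φ (g x) + z) (sumᵛ-map Φ g xs)

sumᵛ-allWords : ∀ k (Φ : Word k → ℚ) → sumᵛ Φ (allWords k) ≡ Σᵛ false true Φ
sumᵛ-allWords zero    Φ = ℚ.+-identityʳ (Φ [])
sumᵛ-allWords (suc k) Φ = trans (sumᵛ-++ Φ (Vec.map (false ∷_) (allWords k)) _) (cong₂ _+_
  (trans (sumᵛ-map Φ (false ∷_) (allWords k)) (sumᵛ-allWords k (Φ ∘ (false ∷_))))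
  (trans (sumᵛ-++ Φ (Vec.map (true ∷_) (allWords k)) []) (trans (ℚ.+-identityʳ _)
    (trans (sumᵛ-map Φ (true ∷_) (allWords k)) (sumᵛ-allWords k (Φ ∘ (true ∷_)))))))

0≤sumᵛ : ∀ {A : Set} {m} (Φ : A → ℚ) → (∀ a → 0ℚ ≤ Φ a) → (xs : Vec A m) → 0ℚ ≤ sumᵛ Φ xs
0≤sumᵛ Φ h []       = ℚ.≤-refl
0≤sumᵛ Φ h (x ∷ xs) = 0≤+ (h x) (0≤sumᵛ Φ h xs)

sumᵛ-truncate : ∀ {A : Set} {m n} (Φ : A → ℚ) → (∀ a → 0ℚ ≤ Φ a) → (m≤n : m ℕ.≤ n) (xs : Vec A n) →
  sumᵛ Φ (Vec.truncate m≤n xs) ≤ sumᵛ Φ xs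
sumᵛ-truncate Φ h ℕ.z≤n     xs       = 0≤sumᵛ Φ h xs
sumᵛ-truncate Φ h (ℕ.s≤s l) (x ∷ xs) = ℚ.+-monoʳ-≤ (Φ x) (sumᵛ-truncate Φ h l xs)

codes : ∀ {N k} → suc N ℕ.≤ 2 ℕ.^ k → Vec (Word k) (suc N)
codes {k = k} h = Vec.truncate h (allWords k)

codes-spread : ∀ {N k} (h : suc N ℕ.≤ 2 ℕ.^ k) → Spread (codes h)
codes-spread {k = k} h Φ 0≤Φ = ℚ.≤-trans (sumᵛ-truncate Φ 0≤Φ h (allWords k))
    (ℚ.≤-reflexive (sumᵛ-allWords k Φ))

isZero : ∀ {n} → Word n → Bool
isZero []      = true
isZero (b ∷ x) = not b ∧ isZero x

isZero-zeroʷ : ∀ n → isZero (zeroʷ {n}) ≡ true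
isZero-zeroʷ zero    = refl
isZero-zeroʷ (suc n) = isZero-zeroʷ n

isZero-⊕ : ∀ {n} (u v : Word n) → isZero u ≡ true → isZero v ≡ true → isZero (u ⊕ v) ≡ true
isZero-⊕ []          []          _ _ = refl
isZero-⊕ (false ∷ u) (false ∷ v) a b = isZero-⊕ u v a b

origin₀ : ∀ {n} → AffineSubspace n
origin₀ {n} = record { direction = isZero ; zero∈ = isZero-zeroʷ n ; ⊕-closed = isZero-⊕ ; origin = zeroʷ }

zeroMass : ∀ {n} → (Fin n → ℚ) → ℚ
zeroMass {zero}  p = 1ℚ
zeroMass {suc n} p = (1ℚ - p zero) * zeroMass (p ∘ suc)

E-isZero : ∀ {n} (p : Fin n → ℚ) (g : Word n → ℚ) → E p (λ x → ind (isZero x) * g x) ≡ zeroMass p * g zeroʷ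
E-isZero {zero}  p g = refl
E-isZero {suc n} p g = begin
  mix (p zero) (E (p ∘ suc) (λ x → ind (isZero x) * g (false ∷ x))) (E (p ∘ suc) (λ x → 0ℚ * g (true ∷ x)))
    ≡⟨ cong₂ (mix (p zero)) (E-isZero (p ∘ suc) (g ∘ (false ∷_)))
        (trans (E-* (p ∘ suc) 0ℚ (g ∘ (true ∷_))) (ℚ.*-zeroˡ (E (p ∘ suc) (g ∘ (true ∷_))))) ⟩
  mix (p zero) (zeroMass (p ∘ suc) * g zeroʷ) 0ℚ
    ≡⟨ lem (p zero) (zeroMass (p ∘ suc)) (g zeroʷ) ⟩
  (1ℚ - p zero) * zeroMass (p ∘ suc) * g zeroʷ ∎
  where
  open ≡-Reasoning
  open +-*-Solver
  lem : ∀ p z g → mix p (z * g) 0ℚ ≡ (1ℚ - p) * z * g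
  lem = solve 3 (λ p z g → (con 1ℚ :- p) :* (z :* g) :+ p :* con 0ℚ := (con 1ℚ :- p) :* z :* g) refl

zeroMass-halves : ∀ k → zeroMass (halves {k}) ≡ ½′ ^ᵠ k
zeroMass-halves zero    = refl
zeroMass-halves (suc k) = cong₂ _*_ 1-½′ (zeroMass-halves k)
  where
  1-½′ : 1ℚ - ½′ ≡ ½′
  1-½′ rewrite ½′≡½ = refl

-- The survival probabilities telescope by `inv-hazard`: "no one at all" is one of the N + 1 equally
-- likely outcomes for x.
zeroMass-hazards : ∀ N k → zeroMass (hazards N {k}) ≡ inv N * ½′ ^ᵠ k
zeroMass-hazards zero    k = trans (zeroMass-halves k) (sym (trans (cong (_* ½′ ^ᵠ k) inv-0) (ℚ.*-identityˡ _)))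
zeroMass-hazards (suc N) k = trans (cong ((1ℚ - inv (suc N)) *_) (zeroMass-hazards N k))
  (trans (sym (ℚ.*-assoc (1ℚ - inv (suc N)) (inv N) _)) (cong (_* ½′ ^ᵠ k) (inv-hazard N)))

zeroMass-biases : ∀ N k → zeroMass (biases N {k}) ≡ ½′ * (inv N * ½′ ^ᵠ k)
zeroMass-biases N k = cong₂ _*_ 1-½′ (zeroMass-hazards N k)
  where
  1-½′ : 1ℚ - ½′ ≡ ½′
  1-½′ rewrite ½′≡½ = refl

F-zero : ∀ N {k} (cs : Vec (Word k) (suc N)) → F N cs zeroʷ ≡ false
F-zero zero    (c ∷ [])     = trans (⟨,⟩-comm c zeroʷ) (⟨0,⟩ c)
F-zero (suc N) (c ∷ cs)     = F-zero N cs

origin-mass : ∀ N {k} (cs : Vec (Word k) (suc N)) →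
  E (biases N) (signed (G N cs) (AffineSubspace.member origin₀)) ≡ ½′ * (inv N * ½′ ^ᵠ k)
origin-mass N {k} cs = begin
  E (biases N) (signed (G N cs) (AffineSubspace.member origin₀))
    ≡⟨ E-cong (biases N) (λ w → cong (λ v → ind (isZero v) * sgn (G N cs w)) (⊕-identityʳ w)) ⟩
  E (biases N) (λ w → ind (isZero w) * sgn (G N cs w))
    ≡⟨ E-isZero (biases N) (sgn ∘ G N cs) ⟩
  zeroMass (biases N) * sgn (G N cs zeroʷ)
    ≡⟨ cong₂ (λ z b → z * sgn b) (zeroMass-biases N k) (F-zero N cs) ⟩
  ½′ * (inv N * ½′ ^ᵠ k) * 1ℚ
    ≡⟨ ℚ.*-identityʳ _ ⟩
  ½′ * (inv N * ½′ ^ᵠ k) ∎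
  where open ≡-Reasoning

-- Shallow trees for product distributions

select : ∀ {A : Set} → (A → Bool) → List A → List A
select g List.[]       = List.[]
select g (x List.∷ xs) = if g x then x List.∷ select g xs else select g xs

length-select : ∀ {A : Set} (g : A → Bool) xs →
  List.length (select g xs) ℕ.+ List.length (select (not ∘ g) xs) ≡ List.length xs
length-select g List.[]       = refl
length-select g (x List.∷ xs) with g x
... | true  = cong suc (length-select g xs)
... | false = trans (ℕ.+-suc _ _) (cong suc (length-select g xs))

∈-select : ∀ {A : Set} (g : A → Bool) {xs x} → x ∈ xs → g x ≡ true → x ∈ select g xs
∈-select g {y List.∷ ys} (here refl) e rewrite e = here refl
∈-select g {y List.∷ ys} (there i)   e with g y
... | true  = there (∈-select g i e)
... | false = ∈-select g i e

-- The parity is built bit by bit instead of by averaging. Its tail a is fixed by the words with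
-- leading bit 0; the new leading bit b acts only on the words with leading bit 1 and is set so that
-- at most half of those stay even. Zero words may be dropped, which settles length 0.
halve : ∀ {n} (Z : List (Word n)) → Σ[ a ∈ Word n ] Σ[ Z′ ∈ List (Word n) ]
  (2 ℕ.* List.length Z′ ℕ.≤ List.length Z × (∀ z → z ∈ Z → z ≢ zeroʷ → ⟨ a , z ⟩ ≡ false → z ∈ Z′))
halve {zero}  Z = [] , List.[] , ℕ.z≤n , λ { [] _ z≢0 _ → ⊥-elim (z≢0 refl) }
halve {suc n} Z with halve (List.map Vec.tail (select (not ∘ Vec.head) Z))
... | a , Z₀ , len₀ , survive₀ = b ∷ a , Z′ , len , survive
  where
  tails₀ tails₁ : List (Word n)
  tails₀ = List.map Vec.tail (select (not ∘ Vec.head) Z)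
  tails₁ = List.map Vec.tail (select Vec.head Z)
  odds evens : List (Word n)
  odds  = select (λ z → ⟨ a , z ⟩) tails₁
  evens = select (λ z → not ⟨ a , z ⟩) tails₁

  minority : Σ[ b ∈ Bool ] Σ[ L ∈ List (Word n) ]
    (2 ℕ.* List.length L ℕ.≤ List.length tails₁ × (∀ z → z ∈ tails₁ → b xor ⟨ a , z ⟩ ≡ false → z ∈ L))
  minority with ℕ.≤-total (List.length odds) (List.length evens)
  -- The survivors are the words with `b xor ⟨ a , z ⟩` false, so b = true keeps the odd ones and b
  -- = false the even ones.
  ... | inj₁ o≤e = true , odds , subst (2 ℕ.* List.length odds ℕ.≤_) (length-select (λ z → ⟨ a , z ⟩) tails₁)
        (ℕ.+-monoʳ-≤ (List.length odds) (subst (ℕ._≤ List.length evens) (sym (ℕ.+-identityʳ _)) o≤e)) ,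
        λ z i e → ∈-select (λ z → ⟨ a , z ⟩) i (Bool.not-injective e)
  ... | inj₂ e≤o = false , evens , subst (2 ℕ.* List.length evens ℕ.≤_)
          (trans (ℕ.+-comm (List.length evens) (List.length odds)) (length-select (λ z → ⟨ a , z ⟩) tails₁))
        (ℕ.+-monoʳ-≤ (List.length evens) (subst (ℕ._≤ List.length odds) (sym (ℕ.+-identityʳ _)) e≤o)) ,
        λ z i e → ∈-select (λ z → not ⟨ a , z ⟩) i (cong not e)

  b = proj₁ minority
  Z₁ = proj₁ (proj₂ minority)
  Z′ = List.map (false ∷_) Z₀ List.++ List.map (true ∷_) Z₁

  len : 2 ℕ.* List.length Z′ ℕ.≤ List.length Z
  len = begin
    2 ℕ.* List.length Z′
      ≡⟨ cong (2 ℕ.*_) (trans (length-++ (List.map (false ∷_) Z₀))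
          (cong₂ ℕ._+_ (length-map _ Z₀) (length-map _ Z₁))) ⟩
    2 ℕ.* (List.length Z₀ ℕ.+ List.length Z₁)
      ≡⟨ ℕ.*-distribˡ-+ 2 (List.length Z₀) (List.length Z₁) ⟩
    2 ℕ.* List.length Z₀ ℕ.+ 2 ℕ.* List.length Z₁
      ≤⟨ ℕ.+-mono-≤ len₀ (proj₁ (proj₂ (proj₂ minority))) ⟩
    List.length tails₀ ℕ.+ List.length tails₁
      ≡⟨ cong₂ ℕ._+_ (length-map _ (select (not ∘ Vec.head) Z)) (length-map _ (select Vec.head Z)) ⟩
    List.length (select (not ∘ Vec.head) Z) ℕ.+ List.length (select Vec.head Z)
      ≡⟨ ℕ.+-comm (List.length (select (not ∘ Vec.head) Z)) _ ⟩
    List.length (select Vec.head Z) ℕ.+ List.length (select (not ∘ Vec.head) Z)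
      ≡⟨ length-select Vec.head Z ⟩
    List.length Z ∎
    where open ℕ.≤-Reasoning

  survive : ∀ z → z ∈ Z → z ≢ zeroʷ → ⟨ b ∷ a , z ⟩ ≡ false → z ∈ Z′
  survive (false ∷ z) i z≢0 e = ∈-++⁺ˡ (∈-map⁺ (false ∷_)
    (survive₀ z (∈-map⁺ Vec.tail (∈-select (not ∘ Vec.head) i refl)) (z≢0 ∘ cong (false ∷_))
      (subst (λ c → c xor ⟨ a , z ⟩ ≡ false) (Bool.∧-zeroʳ b) e)))
  survive (true ∷ z) i z≢0 e = ∈-++⁺ʳ (List.map (false ∷_) Z₀) (∈-map⁺ (true ∷_)
    (proj₂ (proj₂ (proj₂ minority)) z (∈-map⁺ Vec.tail (∈-select Vec.head i refl))
      (subst (λ c → c xor ⟨ a , z ⟩ ≡ false) (Bool.∧-identityʳ b) e)))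

agrees-true : ∀ b {c} → not (b xor c) ≡ true → c ≡ b
agrees-true true  {true}  _ = refl
agrees-true false {false} _ = refl

-- Z contains all differences of pairs still to be separated; each query halves it.
separate : ∀ d {n} (f R : Word n → Bool) (Z : List (Word n)) → List.length Z ℕ.< 2 ℕ.^ d →
  (∀ x y → R x ≡ true → R y ≡ true → f x ≢ f y → x ⊕ y ∈ Z) →
  Σ[ T ∈ PDT n ] (depth T ℕ.≤ d × (∀ x → R x ≡ true → run T x ≡ f x))
separate zero f R Z len h with find R
... | inj₂ none     = leaf false , ℕ.z≤n , λ x Rx → case trans (sym Rx) (none x) of λ ()
... | inj₁ (x₀ , Rx₀) = leaf (f x₀) , ℕ.z≤n , agree
  where
  empty : ∀ {Z : List (Word _)} {z} → List.length Z ℕ.< 1 → ¬ z ∈ Z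
  empty {List.[]} _ ()
  empty {x List.∷ Z} (ℕ.s≤s ()) _
  agree : ∀ x → R x ≡ true → f x₀ ≡ f x
  agree x Rx with f x₀ Bool.≟ f x
  ... | yes e = e
  ... | no fx≢fy = ⊥-elim (empty len (h x₀ x Rx₀ Rx fx≢fy))
separate (suc d) f R Z len h with halve Z
... | a , Z′ , len′ , survive = node a (proj₁ (branch false)) (proj₁ (branch true)) ,
    ℕ.s≤s (ℕ.⊔-lub (proj₁ (proj₂ (branch false))) (proj₁ (proj₂ (branch true)))) , correct
  where
  Rᵇ : Bool → Word _ → Bool
  Rᵇ b x = R x ∧ agrees a b x
  h′ : ∀ b x y → Rᵇ b x ≡ true → Rᵇ b y ≡ true → f x ≢ f y → x ⊕ y ∈ Z′
  h′ b x y Rx Ry fx≢fy with ∧-true {R x} Rx | ∧-true {R y} Ry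
  ... | rx , ax | ry , ay = survive (x ⊕ y) (h x y rx ry fx≢fy) nonzero
      (trans (⟨,⟩-⊕ʳ a x y) (trans (cong₂ _xor_ (agrees-true b ax) (agrees-true b ay)) (Bool.xor-same b)))
    where
    nonzero : x ⊕ y ≢ zeroʷ
    nonzero e = fx≢fy (cong f (trans (sym (⊕-cancelʳ x y)) (trans (cong (_⊕ y) e) (⊕-identityˡ y))))
  branch : ∀ b → Σ[ T ∈ PDT _ ] (depth T ℕ.≤ d × (∀ x → Rᵇ b x ≡ true → run T x ≡ f x))
  branch b = separate d f (Rᵇ b) Z′ (ℕ.*-cancelˡ-< 2 _ _ (ℕ.≤-<-trans len′ len)) (h′ b)
  correct : ∀ x → R x ≡ true → run (node a (proj₁ (branch false)) (proj₁ (branch true))) x ≡ f x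
  correct x Rx with ⟨ a , x ⟩ in e
  ... | false = proj₂ (proj₂ (branch false)) x (cong₂ _∧_ Rx (cong (λ c → not (false xor c)) e))
  ... | true  = proj₂ (proj₂ (branch true)) x (cong₂ _∧_ Rx (cong (λ c → not (true xor c)) e))

-- Words with few ones

words : ∀ k → List (Word k)
words zero    = [] List.∷ List.[]
words (suc k) = List.map (false ∷_) (words k) List.++ List.map (true ∷_) (words k)

∈-words : ∀ {k} (w : Word k) → w ∈ words k
∈-words []          = here refl
∈-words (false ∷ w) = ∈-++⁺ˡ (∈-map⁺ (false ∷_) (∈-words w))
∈-words (true ∷ w)  = ∈-++⁺ʳ (List.map (false ∷_) (words _)) (∈-map⁺ (true ∷_) (∈-words w))

length-both : ∀ {n} (X Y : List (Word n)) →
  List.length (List.map (false ∷_) X List.++ List.map (true ∷_) Y) ≡ List.length X ℕ.+ List.length Y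
length-both X Y = trans (length-++ (List.map (false ∷_) X)) (cong₂ ℕ._+_ (length-map _ X) (length-map _ Y))

length-words : ∀ k → List.length (words k) ≡ 2 ℕ.^ k
length-words zero    = refl
length-words (suc k) = trans (length-both (words k) (words k))
  (cong₂ ℕ._+_ (length-words k) (trans (length-words k) (sym (ℕ.+-identityʳ _))))

ones : ∀ N {k} → Word (N ℕ.+ k) → ℕ
ones zero    w           = 0
ones (suc N) (true ∷ w)  = suc (ones N w)
ones (suc N) (false ∷ w) = ones N w

light : ∀ N {k} → ℕ → List (Word (N ℕ.+ k))
light zero    {k} t    = words k
light (suc N) zero     = List.map (false ∷_) (light N zero)
light (suc N) (suc t)  = List.map (false ∷_) (light N (suc t)) List.++ List.map (true ∷_) (light N t)

∈-light : ∀ N {k} (w : Word (N ℕ.+ k)) t → ones N w ℕ.≤ t → w ∈ light N t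
∈-light zero    w           t       h         = ∈-words w
∈-light (suc N) (false ∷ w) zero    h         = ∈-map⁺ (false ∷_) (∈-light N w zero h)
∈-light (suc N) (false ∷ w) (suc t) h         = ∈-++⁺ˡ (∈-map⁺ (false ∷_) (∈-light N w (suc t) h))
∈-light (suc N) (true ∷ w)  (suc t) (ℕ.s≤s h) = ∈-++⁺ʳ (List.map (false ∷_) (light N (suc t)))
    (∈-map⁺ (true ∷_) (∈-light N w t h))

-- Pascal's recursion with a crude bound: for M = N + 1, M^(t+1) + M^t = (M + 1) M^t ≤ (M +
-- 1)^(t+1). The y part contributes the factor 2ᵏ.
length-light : ∀ N {k} t → List.length (light N {k} t) ℕ.≤ 2 ℕ.^ k ℕ.* suc N ℕ.^ t
length-light zero {k} t = ℕ.≤-reflexive (trans (length-words k)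
    (sym (trans (cong (2 ℕ.^ k ℕ.*_) (ℕ.^-zeroˡ t)) (ℕ.*-identityʳ _))))
length-light (suc N) {k} zero = subst (ℕ._≤ 2 ℕ.^ k ℕ.* 1) (sym (length-map _ (light N zero)))
    (length-light N zero)
length-light (suc N) {k} (suc t) = begin
  List.length (light (suc N) {k} (suc t))
    ≡⟨ length-both (light N (suc t)) (light N t) ⟩
  List.length (light N {k} (suc t)) ℕ.+ List.length (light N {k} t)
    ≤⟨ ℕ.+-mono-≤ (length-light N (suc t)) (length-light N t) ⟩
  2 ℕ.^ k ℕ.* (suc N ℕ.* suc N ℕ.^ t) ℕ.+ 2 ℕ.^ k ℕ.* suc N ℕ.^ t
    ≡⟨ trans (sym (ℕ.*-distribˡ-+ (2 ℕ.^ k) _ _)) (cong (2 ℕ.^ k ℕ.*_) (ℕ.+-comm (suc N ℕ.* suc N ℕ.^ t) _)) ⟩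
  2 ℕ.^ k ℕ.* (suc (suc N) ℕ.* suc N ℕ.^ t)
    ≤⟨ ℕ.*-monoʳ-≤ (2 ℕ.^ k) (ℕ.*-monoʳ-≤ (suc (suc N)) (ℕ.^-monoˡ-≤ t (ℕ.n≤1+n (suc N)))) ⟩
  2 ℕ.^ k ℕ.* (suc (suc N) ℕ.^ suc t) ∎
  where open ℕ.≤-Reasoning

ones-⊕ : ∀ N {k} (v w : Word (N ℕ.+ k)) → ones N (v ⊕ w) ℕ.≤ ones N v ℕ.+ ones N w
ones-⊕ zero    v           w           = ℕ.z≤n
ones-⊕ (suc N) (false ∷ v) (false ∷ w) = ones-⊕ N v w
ones-⊕ (suc N) (false ∷ v) (true ∷ w)  = ℕ.≤-trans (ℕ.s≤s (ones-⊕ N v w)) (ℕ.≤-reflexive (sym (ℕ.+-suc _ _)))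
ones-⊕ (suc N) (true ∷ v)  (false ∷ w) = ℕ.s≤s (ones-⊕ N v w)
ones-⊕ (suc N) (true ∷ v)  (true ∷ w)  = ℕ.≤-trans (ones-⊕ N v w)
    (ℕ.≤-trans (ℕ.+-monoʳ-≤ _ (ℕ.n≤1+n _)) (ℕ.n≤1+n _))

-- Two words with at most t ones differ in a word with at most 2t ones, so the list of such words
-- contains every difference that `separate` has to split. The factor 2 is for the bit b.
light-tree : ∀ N {k} (f : Word (suc (N ℕ.+ k)) → Bool) t d →
  2 ℕ.* (2 ℕ.^ k ℕ.* suc N ℕ.^ (t ℕ.+ t)) ℕ.< 2 ℕ.^ d →
  Σ[ T ∈ PDT (suc (N ℕ.+ k)) ] (depth T ℕ.≤ d × (∀ b w → ones N w ℕ.≤ t → run T (b ∷ w) ≡ f (b ∷ w)))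
light-tree N {k} f t d len =
  let (T , dT , ok) = separate d f isLight Z (ℕ.≤-<-trans lenZ len) differences
  in T , dT , λ b w h → ok (b ∷ w) (T⇒≡ (ℕ.≤⇒≤ᵇ h))
  where
  T⇒≡ : ∀ {b} → T b → b ≡ true
  T⇒≡ {true} _ = refl
  ≡⇒T : ∀ {b} → b ≡ true → T b
  ≡⇒T refl = _
  isLight : Word (suc (N ℕ.+ k)) → Bool
  isLight (b ∷ w) = ones N w ℕ.≤ᵇ t
  L = light N {k} (t ℕ.+ t)
  Z = List.map (false ∷_) L List.++ List.map (true ∷_) L
  lenZ : List.length Z ℕ.≤ 2 ℕ.* (2 ℕ.^ k ℕ.* suc N ℕ.^ (t ℕ.+ t))
  lenZ = ℕ.≤-trans (ℕ.≤-reflexive (length-both L L))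
    (ℕ.+-mono-≤ (length-light N (t ℕ.+ t)) (ℕ.≤-trans (length-light N (t ℕ.+ t)) (ℕ.m≤m+n _ 0)))
  member : ∀ b w → w ∈ L → b ∷ w ∈ Z
  member false w i = ∈-++⁺ˡ (∈-map⁺ (false ∷_) i)
  member true  w i = ∈-++⁺ʳ (List.map (false ∷_) L) (∈-map⁺ (true ∷_) i)
  differences : ∀ x y → isLight x ≡ true → isLight y ≡ true → f x ≢ f y → x ⊕ y ∈ Z
  differences (b ∷ v) (c ∷ w) hv hw _ = member (b xor c) (v ⊕ w) (∈-light N (v ⊕ w) (t ℕ.+ t)
    (ℕ.≤-trans (ones-⊕ N v w) (ℕ.+-mono-≤ (ℕ.≤ᵇ⇒≤ (ones N v) t (≡⇒T hv)) (ℕ.≤ᵇ⇒≤ (ones N w) t (≡⇒T hw)))))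

-- Masking x to a prefix

mask : ∀ {N k} → Word N → Word (N ℕ.+ k) → Word (N ℕ.+ k)
mask []      w       = w
mask (m ∷ M) (b ∷ w) = (m ∧ b) ∷ mask M w

-- Masking is self-adjoint, so a tree is run on the masked input by masking its queries, at no cost
-- in depth.
⟨,⟩-mask : ∀ {N k} (M : Word N) (a w : Word (N ℕ.+ k)) → ⟨ mask M a , w ⟩ ≡ ⟨ a , mask M w ⟩
⟨,⟩-mask []          a       w       = refl
⟨,⟩-mask (true ∷ M)  (a ∷ as) (b ∷ w) = cong ((a ∧ b) xor_) (⟨,⟩-mask M as w)
⟨,⟩-mask (false ∷ M) (a ∷ as) (b ∷ w) rewrite Bool.∧-zeroʳ a = ⟨,⟩-mask M as w

maskTree : ∀ {N k} → Word N → PDT (suc (N ℕ.+ k)) → PDT (suc (N ℕ.+ k))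
maskTree M (leaf b)             = leaf b
maskTree M (node (a ∷ as) T₀ T₁) = node (a ∷ mask M as) (maskTree M T₀) (maskTree M T₁)

depth-maskTree : ∀ {N k} (M : Word N) (T : PDT (suc (N ℕ.+ k))) → depth (maskTree M T) ≡ depth T
depth-maskTree M (leaf b)              = refl
depth-maskTree M (node (a ∷ as) T₀ T₁) = cong suc (cong₂ ℕ._⊔_ (depth-maskTree M T₀) (depth-maskTree M T₁))

run-maskTree : ∀ {N k} (M : Word N) (T : PDT (suc (N ℕ.+ k))) b w → run (maskTree M T) (b ∷ w) ≡ run T
    (b ∷ mask M w)
run-maskTree M (leaf _)              b w = refl
run-maskTree M (node (a ∷ as) T₀ T₁) b w
  rewrite ⟨,⟩-mask M as w | run-maskTree M T₀ b w | run-maskTree M T₁ b w = refl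

data Prefix : ∀ {N} → Word N → Set where
  stop : ∀ {N} {M : Word N} → isZero M ≡ true → Prefix M
  next : ∀ {N} {M : Word N} → Prefix M → Prefix (true ∷ M)

hit : ∀ {N k} → Word N → Word (N ℕ.+ k) → Bool
hit []      w       = false
hit (m ∷ M) (b ∷ w) = (m ∧ b) ∨ hit M w

hit-zero : ∀ {N k} (M : Word N) (w : Word (N ℕ.+ k)) → isZero M ≡ true → hit M w ≡ false
hit-zero []          w       z = refl
hit-zero (false ∷ M) (b ∷ w) z = hit-zero M w z

after-mask : ∀ {N k} (M : Word N) (w : Word (N ℕ.+ k)) → after N (mask M w) ≡ after N w
after-mask []      w       = refl
after-mask (m ∷ M) (b ∷ w) = after-mask M w

-- A one inside the prefix forces the first one to lie there; clearing the ones after the prefix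
-- then changes neither its position nor y.
F-mask : ∀ {N k} (cs : Vec (Word k) (suc N)) {M : Word N} → Prefix M → ∀ w → hit M w ≡ true →
    F N cs (mask M w) ≡ F N cs w
F-mask cs {M} (stop z) w h = case trans (sym h) (hit-zero M w z) of λ ()
F-mask (c ∷ cs) (next {M = M} P) (true ∷ w)  h = cong ⟨ c ,_⟩ (after-mask M w)
F-mask (c ∷ cs) (next P) (false ∷ w) h = F-mask cs P w h

full : ∀ {N} → Word N → Bool
full []      = true
full (m ∷ M) = m ∧ full M

mask-full : ∀ {N k} (M : Word N) (w : Word (N ℕ.+ k)) → full M ≡ true → mask M w ≡ w
mask-full []         w       h = refl
mask-full (true ∷ M) (b ∷ w) h = cong (b ∷_) (mask-full M w h)

meanWeight : ∀ {N k} → (Fin (N ℕ.+ k) → ℚ) → Word N → ℚ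
meanWeight p []      = 0ℚ
meanWeight p (m ∷ M) = ind m * p zero + meanWeight (p ∘ suc) M

missProb : ∀ {N k} → (Fin (N ℕ.+ k) → ℚ) → Word N → ℚ
missProb p []      = 1ℚ
missProb p (m ∷ M) = (1ℚ - ind m * p zero) * missProb (p ∘ suc) M

E-ones : ∀ {N k} (p : Fin (N ℕ.+ k) → ℚ) (M : Word N) → E p (λ w → ι (ones N (mask M w))) ≡ meanWeight p M
E-ones {zero}  p []          = trans (E-const p (ι 0)) fromℤ-0
E-ones {suc N} {k} p (false ∷ M) = begin
  mix (p zero) e e                            ≡⟨ mix-same (p zero) e ⟩
  e                                           ≡⟨ E-ones (p ∘ suc) M ⟩
  meanWeight (p ∘ suc) M                      ≡⟨ sym (ℚ.+-identityˡ (meanWeight (p ∘ suc) M)) ⟩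
  0ℚ + meanWeight (p ∘ suc) M                 ≡⟨ cong (λ z → z + meanWeight (p ∘ suc) M)
      (sym (ℚ.*-zeroˡ (p zero))) ⟩
  0ℚ * p zero + meanWeight (p ∘ suc) M        ∎
  where
  open ≡-Reasoning
  e = E (p ∘ suc) (λ w → ι (ones N {k} (mask M w)))
E-ones {suc N} {k} p (true ∷ M) = begin
  mix (p zero) e (E (p ∘ suc) (λ w → ι (suc (ones N {k} (mask M w)))))
    ≡⟨ cong (mix (p zero) e) (trans (E-cong (p ∘ suc) (λ w → ι-suc (ones N {k} (mask M w))))
        (trans (E-+ (p ∘ suc) (λ _ → 1ℚ) _) (cong (_+ e) (E-const (p ∘ suc) 1ℚ)))) ⟩
  mix (p zero) e (1ℚ + e)
    ≡⟨ lem (p zero) e ⟩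
  1ℚ * p zero + e
    ≡⟨ cong (λ z → 1ℚ * p zero + z) (E-ones (p ∘ suc) M) ⟩
  1ℚ * p zero + meanWeight (p ∘ suc) M ∎
  where
  open ≡-Reasoning
  open +-*-Solver
  e = E (p ∘ suc) (λ w → ι (ones N {k} (mask M w)))
  lem : ∀ p e → mix p e (1ℚ + e) ≡ 1ℚ * p + e
  lem = solve 2 (λ p e → (con 1ℚ :- p) :* e :+ p :* (con 1ℚ :+ e) := con 1ℚ :* p :+ e) refl

E-miss : ∀ {N k} (p : Fin (N ℕ.+ k) → ℚ) (M : Word N) → E p (λ w → ind (not (hit M w))) ≡ missProb p M
E-miss {zero}  p []          = E-const p 1ℚ
E-miss {suc N} {k} p (false ∷ M) = begin
  mix (p zero) e e                                 ≡⟨ mix-same (p zero) e ⟩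
  e                                                ≡⟨ E-miss (p ∘ suc) M ⟩
  missProb (p ∘ suc) M                             ≡⟨ lem (p zero) (missProb (p ∘ suc) M) ⟩
  (1ℚ - 0ℚ * p zero) * missProb (p ∘ suc) M        ∎
  where
  open ≡-Reasoning
  open +-*-Solver
  e = E (p ∘ suc) (λ w → ind (not (hit {k = k} M w)))
  lem : ∀ p z → z ≡ (1ℚ - 0ℚ * p) * z
  lem = solve 2 (λ p z → z := (con 1ℚ :- con 0ℚ :* p) :* z) refl
E-miss {suc N} {k} p (true ∷ M) = begin
  mix (p zero) e (E (p ∘ suc) (λ _ → 0ℚ))          ≡⟨ cong₂ (mix (p zero)) (E-miss (p ∘ suc) M)
      (E-const (p ∘ suc) 0ℚ) ⟩
  mix (p zero) (missProb (p ∘ suc) M) 0ℚ           ≡⟨ lem (p zero) (missProb (p ∘ suc) M) ⟩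
  (1ℚ - 1ℚ * p zero) * missProb (p ∘ suc) M        ∎
  where
  open ≡-Reasoning
  open +-*-Solver
  e = E (p ∘ suc) (λ w → ind (not (hit {k = k} M w)))
  lem : ∀ p z → mix p z 0ℚ ≡ (1ℚ - 1ℚ * p) * z
  lem = solve 2 (λ p z → (con 1ℚ :- p) :* z :+ p :* con 0ℚ := (con 1ℚ :- con 1ℚ :* p) :* z) refl

ind-prob : ∀ {p} m → IsProb p → IsProb (ind m * p)
ind-prob {p} true  P = subst IsProb (sym (ℚ.*-identityˡ p)) P
ind-prob {p} false P = subst IsProb (sym (ℚ.*-zeroˡ p)) (ℚ.≤-refl , 0≤1)

0≤meanWeight : ∀ {N k} {p : Fin (N ℕ.+ k) → ℚ} → IsProbs p → (M : Word N) → 0ℚ ≤ meanWeight p M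
0≤meanWeight P []      = ℚ.≤-refl
0≤meanWeight P (m ∷ M) = 0≤+ (proj₁ (ind-prob m (P zero))) (0≤meanWeight (P ∘ suc) M)

0≤missProb : ∀ {N k} {p : Fin (N ℕ.+ k) → ℚ} → IsProbs p → (M : Word N) → 0ℚ ≤ missProb p M
0≤missProb P []      = 0≤1
0≤missProb P (m ∷ M) = 0≤* (≤⇒0≤- (proj₂ (ind-prob m (P zero)))) (0≤missProb (P ∘ suc) M)

-- A rational substitute for the exponential bound on ∏ (1 - qᵢ). The induction step is (1 - q)(1 +
-- q + s) ≤ 1 + s, the difference being q (q + s).
missProb-bound : ∀ {N k} {p : Fin (N ℕ.+ k) → ℚ} → IsProbs p → (M : Word N) →
  missProb p M * (1ℚ + meanWeight p M) ≤ 1ℚ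
missProb-bound P []      = ℚ.≤-refl
missProb-bound {p = p} P (m ∷ M) = ℚ.≤-trans (0≤-⇒≤ (subst (0ℚ ≤_) (lem q z s)
    (0≤* (0≤missProb (P ∘ suc) M) (0≤* 0≤q (0≤+ 0≤q (0≤meanWeight (P ∘ suc) M))))))
  (missProb-bound (P ∘ suc) M)
  where
  open +-*-Solver
  q = ind m * p zero
  0≤q = proj₁ (ind-prob m (P zero))
  z = missProb (p ∘ suc) M
  s = meanWeight (p ∘ suc) M
  lem : ∀ q z s → z * (q * (q + s)) ≡ z * (1ℚ + s) - (1ℚ - q) * z * (1ℚ + (q + s))
  lem = solve 3 (λ q z s → z :* (q :* (q :+ s)) := z :* (con 1ℚ :+ s) :- (con 1ℚ :- q) :* z :*
      (con 1ℚ :+ (q :+ s))) refl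

zeroʷ-mean : ∀ {N k} (p : Fin (N ℕ.+ k) → ℚ) → meanWeight {N} {k} p zeroʷ ≡ 0ℚ
zeroʷ-mean {zero}  p = refl
zeroʷ-mean {suc N} {k} p = trans (cong₂ _+_ (ℚ.*-zeroˡ (p zero)) (zeroʷ-mean {N} {k} (p ∘ suc)))
    (ℚ.+-identityʳ 0ℚ)

-- Greedy: coordinates are taken while the remaining target r is positive. A single bias is at most
-- 1, so r never falls below -1, and the mean overshoots by at most 1.
choose : ∀ {N k} {p : Fin (N ℕ.+ k) → ℚ} → IsProbs p → ∀ r → - 1ℚ ≤ r →
  Σ[ M ∈ Word N ] (Prefix M × meanWeight p M ≤ r + 1ℚ × (full M ≡ true ⊎ r ≤ meanWeight p M))
choose {zero} P r h = [] , stop refl , subst (_≤ r + 1ℚ) (ℚ.+-inverseˡ 1ℚ) (ℚ.+-monoˡ-≤ 1ℚ h) , inj₁ refl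
choose {suc N} {k} {p} P r h with ℚ.≤-total r 0ℚ
... | inj₁ r≤0 = zeroʷ , stop (isZero-zeroʷ (suc N)) ,
  subst (_≤ r + 1ℚ) (sym (zeroʷ-mean {suc N} {k} p)) (subst (_≤ r + 1ℚ) (ℚ.+-inverseˡ 1ℚ) (ℚ.+-monoˡ-≤ 1ℚ h)) ,
  inj₂ (subst (r ≤_) (sym (zeroʷ-mean {suc N} {k} p)) r≤0)
... | inj₂ 0≤r with choose {N} {k} (P ∘ suc) (r - p zero)
    (subst (_≤ r - p zero) (ℚ.+-identityˡ (- 1ℚ)) (ℚ.+-mono-≤ 0≤r (ℚ.neg-antimono-≤ (proj₂ (P zero)))))
... | M , pre , small , large = true ∷ M , next pre ,
    subst (1ℚ * p zero + s ≤_) (lem₁ r (p zero)) (ℚ.+-monoʳ-≤ (1ℚ * p zero) small) ,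
    (case large of λ where
      (inj₁ f) → inj₁ f
      (inj₂ l) → inj₂ (subst (_≤ 1ℚ * p zero + s) (lem₂ r (p zero)) (ℚ.+-monoʳ-≤ (1ℚ * p zero) l)))
  where
  open +-*-Solver
  s = meanWeight (p ∘ suc) M
  lem₁ : ∀ r q → 1ℚ * q + (r - q + 1ℚ) ≡ r + 1ℚ
  lem₁ = solve 2 (λ r q → con 1ℚ :* q :+ (r :- q :+ con 1ℚ) := r :+ con 1ℚ) refl
  lem₂ : ∀ r q → 1ℚ * q + (r - q) ≡ r
  lem₂ = solve 2 (λ r q → con 1ℚ :* q :+ (r :- q) := r) refl

inv-square : inv 63 * ι 8 ≡ inv 7
inv-square = inv-unique 7 (trans (ℚ.*-assoc (inv 63) (ι 8) (ι 8))
    (trans (cong (inv 63 *_) (sym (ι-* 8 8))) (inv-* 63)))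

module _ {N k : ℕ} (cs : Vec (Word k) (suc N)) (T : PDT (suc (N ℕ.+ k)))
  (correct : ∀ b w → ones N w ℕ.≤ 63 → run T (b ∷ w) ≡ G N cs (b ∷ w)) where

  wrong-mask : ∀ {M : Word N} → Prefix M → ∀ b w → full M ≡ true ⊎ hit M w ≡ true → ones N (mask M w) ℕ.≤ 63 →
    wrong (G N cs) (maskTree M T) (b ∷ w) ≡ false
  wrong-mask {M} pre b w h light = trans (cong (_xor (b xor F N cs w)) (trans (run-maskTree M T b w)
    (trans (correct b (mask M w) light) (cong (b xor_) (same h))))) (Bool.xor-same (b xor F N cs w))
    where
    same : full M ≡ true ⊎ hit M w ≡ true → F N cs (mask M w) ≡ F N cs w
    same (inj₁ f) = cong (F N cs) (mask-full M w f)
    same (inj₂ h) = F-mask cs pre w h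

  -- Markov's inequality before taking expectations: b can be true only for n ≥ 64.
  markov : ∀ n b → (n ℕ.≤ 63 → b ≡ false) → ind b ≤ inv 63 * ι n
  markov n false h = 0≤* (0≤inv 63) (0≤ι n)
  markov n true  h = subst (_≤ inv 63 * ι n) (inv-* 63) (*-monoˡ (0≤inv 63)
    (ι-mono (ℕ.≰⇒> λ n≤63 → case h n≤63 of λ ())))

  -- With target 7 the mean number of kept ones is at most 8, so 64 of them occur with probability
  -- at most 8/64. Unless the prefix is all of x, the mean is at least 7 and the prefix has no one
  -- with probability at most 1/(1 + 7). This gives 1/8 twice.
  mask-error : ∀ {p : Fin (suc (N ℕ.+ k)) → ℚ} → IsProbs p →
    Σ[ M ∈ Word N ] E p (ind ∘ wrong (G N cs) (maskTree M T)) ≤ inv 7 + inv 7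
  mask-error {p} P with choose {N} {k} {p ∘ suc} (P ∘ suc) (ι 7) (ℚ.≤-trans (ℚ.neg-antimono-≤ 0≤1) (0≤ι 7))
  ... | M , pre , small , large = M , (begin
      mix (p zero) (E q (λ w → ind (wr false w))) (E q (λ w → ind (wr true w)))
        ≤⟨ mix-mono (P zero) (bound false large) (bound true large) ⟩
      mix (p zero) (inv 7 + inv 7) (inv 7 + inv 7)
        ≡⟨ mix-same (p zero) (inv 7 + inv 7) ⟩
      inv 7 + inv 7 ∎)
    where
    open ≤-Reasoning
    q = p ∘ suc
    wr : Bool → Word (N ℕ.+ k) → Bool
    wr b w = wrong (G N cs) (maskTree M T) (b ∷ w)
    heavy : ℚ
    heavy = E q (λ w → inv 63 * ι (ones N {k} (mask M w)))
    heavy≤ : heavy ≤ inv 7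
    heavy≤ = begin
      heavy                      ≡⟨ trans (E-* q (inv 63) _) (cong (inv 63 *_) (E-ones q M)) ⟩
      inv 63 * meanWeight q M    ≤⟨ *-monoˡ (0≤inv 63) small ⟩
      inv 63 * (ι 7 + 1ℚ)        ≡⟨ cong (inv 63 *_) (trans (ℚ.+-comm (ι 7) 1ℚ) (sym (ι-suc 7))) ⟩
      inv 63 * ι 8               ≡⟨ inv-square ⟩
      inv 7                      ∎
    pointwise : ∀ b w → ind (wr b w) ≤ inv 63 * ι (ones N (mask M w)) + ind (not (hit M w))
    pointwise b w with hit M w in e
    ... | true  = subst (ind (wr b w) ≤_) (sym (ℚ.+-identityʳ _))
        (markov (ones N (mask M w)) (wr b w) (wrong-mask pre b w (inj₂ e)))
    ... | false = ℚ.≤-trans (ind≤1 (wr b w)) (subst (_≤ inv 63 * ι (ones N (mask M w)) + 1ℚ) (ℚ.+-identityˡ 1ℚ)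
                    (ℚ.+-monoˡ-≤ 1ℚ (0≤* (0≤inv 63) (0≤ι (ones N (mask M w))))))
      where
      ind≤1 : ∀ b → ind b ≤ 1ℚ
      ind≤1 true  = ℚ.≤-refl
      ind≤1 false = 0≤1
    bound : ∀ b → full M ≡ true ⊎ ι 7 ≤ meanWeight q M → E q (λ w → ind (wr b w)) ≤ inv 7 + inv 7
    bound b (inj₁ f) = begin
      E q (λ w → ind (wr b w))   ≤⟨ E-mono (P ∘ suc) (λ w → markov (ones N (mask M w)) (wr b w)
          (wrong-mask pre b w (inj₁ f))) ⟩
      heavy                      ≤⟨ heavy≤ ⟩
      inv 7                      ≡⟨ ℚ.+-identityʳ (inv 7) ⟨
      inv 7 + 0ℚ                 ≤⟨ ℚ.+-monoʳ-≤ (inv 7) (0≤inv 7) ⟩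
      inv 7 + inv 7              ∎
    bound b (inj₂ 7≤) = begin
      E q (λ w → ind (wr b w))   ≤⟨ E-mono (P ∘ suc) (pointwise b) ⟩
      E q (λ w → inv 63 * ι (ones N (mask M w)) + ind (not (hit M w)))
                                 ≡⟨ trans (E-+ q _ (λ w → ind (not (hit M w))))
                                     (cong (λ z → heavy + z) (E-miss q M)) ⟩
      heavy + missProb q M       ≤⟨ ℚ.+-mono-≤ heavy≤ miss≤ ⟩
      inv 7 + inv 7              ∎
      where
      miss≤ : missProb q M ≤ inv 7
      miss≤ = ℚ.*-cancelʳ-≤-pos (ι 8) {{ι-suc-pos 7}} (begin
        missProb q M * ι 8                       ≡⟨ cong (missProb q M *_) (ι-suc 7) ⟩
        missProb q M * (1ℚ + ι 7)                ≤⟨ *-monoˡ (0≤missProb (P ∘ suc) M) (ℚ.+-monoʳ-≤ 1ℚ 7≤) ⟩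
        missProb q M * (1ℚ + meanWeight q M)     ≤⟨ missProb-bound (P ∘ suc) M ⟩
        1ℚ                                       ≡⟨ inv-* 7 ⟨
        inv 7 * ι 8                              ∎)

-- Approximation of real biases

4× : ℚ → ℚ
4× x = (x + x) + (x + x)

-- The biases are exchanged one at a time. The terms p of a real bias may stray outside [0,1], so
-- expectations under p are bounded through those under q: by 1 plus the deviation so far, which n e
-- ≤ 1 keeps within 2. A difference of two such expectations is at most 4, hence `4×`.
E-perturb : ∀ {n} (p q : Fin n → ℚ) → IsProbs q → ∀ e → 0ℚ ≤ e → ι n * e ≤ 1ℚ →
  (∀ i → 4× ∣ p i - q i ∣ ≤ e) → (g : Word n → ℚ) → (∀ x → ∣ g x ∣ ≤ 1ℚ) →
  ∣ E p g - E q g ∣ ≤ ι n * e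
E-perturb {zero} p q Q e 0≤e ne≤1 h g b =
  subst₂ _≤_ (cong ∣_∣ (sym (ℚ.+-inverseʳ (g [])))) refl (0≤* (0≤ι 0) 0≤e)
E-perturb {suc n} p q Q e 0≤e ne≤1 h g b = begin
  ∣ mix (p zero) A B - mix (q zero) A′ B′ ∣
    ≡⟨ cong ∣_∣ (lem (p zero) (q zero) A B A′ B′) ⟩
  ∣ (p zero - q zero) * (B - A) + mix (q zero) (A - A′) (B - B′) ∣
    ≤⟨ ℚ.∣p+q∣≤∣p∣+∣q∣ ((p zero - q zero) * (B - A)) (mix (q zero) (A - A′) (B - B′)) ⟩
  ∣ (p zero - q zero) * (B - A) ∣ + ∣ mix (q zero) (A - A′) (B - B′) ∣
    ≤⟨ ℚ.+-mono-≤ first (mix-∣∣ (Q zero) ihA ihB) ⟩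
  e + mix (q zero) (ι n * e) (ι n * e)
    ≡⟨ cong (λ z → e + z) (mix-same (q zero) (ι n * e)) ⟩
  e + ι n * e
    ≡⟨ suc-* ⟨
  ι (suc n) * e ∎
  where
  open ≤-Reasoning
  A  = E (p ∘ suc) (g ∘ (false ∷_))
  B  = E (p ∘ suc) (g ∘ (true ∷_))
  A′ = E (q ∘ suc) (g ∘ (false ∷_))
  B′ = E (q ∘ suc) (g ∘ (true ∷_))
  lem : ∀ p q a b c d → mix p a b - mix q c d ≡ (p - q) * (b - a) + mix q (a - c) (b - d)
  lem = solve 6 (λ p q a b c d →
    (con 1ℚ :- p) :* a :+ p :* b :- ((con 1ℚ :- q) :* c :+ q :* d) :=
    (p :- q) :* (b :- a) :+ ((con 1ℚ :- q) :* (a :- c) :+ q :* (b :- d))) refl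
    where open +-*-Solver
  suc-* : ι (suc n) * e ≡ e + ι n * e
  suc-* = trans (cong (_* e) (ι-suc n)) (trans (ℚ.*-distribʳ-+ e 1ℚ (ι n))
      (cong (_+ ι n * e) (ℚ.*-identityˡ e)))
  ne≤1′ : ι n * e ≤ 1ℚ
  ne≤1′ = ℚ.≤-trans (subst₂ _≤_ (ℚ.+-identityˡ (ι n * e)) (sym suc-*) (ℚ.+-monoˡ-≤ (ι n * e) 0≤e)) ne≤1
  ihA : ∣ A - A′ ∣ ≤ ι n * e
  ihA = E-perturb (p ∘ suc) (q ∘ suc) (Q ∘ suc) e 0≤e ne≤1′ (h ∘ suc) (g ∘ (false ∷_)) (b ∘ (false ∷_))
  ihB : ∣ B - B′ ∣ ≤ ι n * e
  ihB = E-perturb (p ∘ suc) (q ∘ suc) (Q ∘ suc) e 0≤e ne≤1′ (h ∘ suc) (g ∘ (true ∷_)) (b ∘ (true ∷_))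
  ∣∣≤2 : ∀ {a c} → ∣ a - c ∣ ≤ ι n * e → ∣ c ∣ ≤ 1ℚ → ∣ a ∣ ≤ 1ℚ + 1ℚ
  ∣∣≤2 {a} {c} i c≤1 = begin
    ∣ a ∣                 ≡⟨ cong ∣_∣ (solve 2 (λ a c → a := a :- c :+ c) refl a c) ⟩
    ∣ a - c + c ∣         ≤⟨ ℚ.∣p+q∣≤∣p∣+∣q∣ (a - c) c ⟩
    ∣ a - c ∣ + ∣ c ∣     ≤⟨ ℚ.+-mono-≤ (ℚ.≤-trans i ne≤1′) c≤1 ⟩
    1ℚ + 1ℚ               ∎
    where open +-*-Solver
  d = ∣ p zero - q zero ∣
  first : ∣ (p zero - q zero) * (B - A) ∣ ≤ e
  first = begin
    ∣ (p zero - q zero) * (B - A) ∣            ≡⟨ ℚ.∣p*q∣≡∣p∣*∣q∣ (p zero - q zero) (B - A) ⟩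
    d * ∣ B - A ∣                              ≤⟨ *-monoˡ (ℚ.0≤∣p∣ (p zero - q zero))
        (ℚ.≤-trans (ℚ.∣p-q∣≤∣p∣+∣q∣ B A)
      (ℚ.+-mono-≤ (∣∣≤2 {B} {B′} ihB (E-bound (Q ∘ suc) _ 1ℚ (b ∘ (true ∷_))))
          (∣∣≤2 {A} {A′} ihA (E-bound (Q ∘ suc) _ 1ℚ (b ∘ (false ∷_)))))) ⟩
    d * (1ℚ + 1ℚ + (1ℚ + 1ℚ))                  ≡⟨ solve 1
        (λ d → d :* (con 1ℚ :+ con 1ℚ :+ (con 1ℚ :+ con 1ℚ)) := (d :+ d) :+ (d :+ d)) refl d ⟩
    4× d                                       ≤⟨ h zero ⟩
    e                                          ∎
    where open +-*-Solver

clamp : ∀ a ε → 0ℚ ≤ ε → - ε ≤ a → a ≤ 1ℚ + ε → ∃ λ q → IsProb q × ∣ a - q ∣ ≤ ε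
clamp a ε 0≤ε -ε≤a a≤1+ε with ℚ.≤-total 0ℚ a | ℚ.≤-total a 1ℚ
... | inj₁ 0≤a | inj₁ a≤1 = a , (0≤a , a≤1) , subst (_≤ ε) (cong ∣_∣ (sym (ℚ.+-inverseʳ a))) 0≤ε
... | inj₂ a≤0 | _ = 0ℚ , (ℚ.≤-refl , 0≤1) , ∣p∣≤
    (subst (_≤ ε) (sym (ℚ.+-identityʳ a)) (ℚ.≤-trans a≤0 0≤ε))
    (subst₂ _≤_ (cong -_ (sym (ℚ.+-identityʳ a))) (neg-involutive ε) (ℚ.neg-antimono-≤ -ε≤a))
... | inj₁ 0≤a | inj₂ 1≤a = 1ℚ , (0≤1 , ℚ.≤-refl) , ∣p∣≤
    (subst (a - 1ℚ ≤_) (solve 1 (λ ε → con 1ℚ :+ ε :- con 1ℚ := ε) refl ε) (ℚ.+-monoˡ-≤ (- 1ℚ) a≤1+ε))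
    (ℚ.≤-trans (subst (- (a - 1ℚ) ≤_) (neg-involutive 0ℚ) (ℚ.neg-antimono-≤ (≤⇒0≤- 1≤a))) 0≤ε)
  where open +-*-Solver

-- Finitely many Cauchy sequences have a common index from which on they hardly move and nearly
-- respect the bounds 0 and 1. Clamping the terms at that index gives true rational probabilities.
approximate : ∀ {n} (x : Fin n → ℝ) → (∀ i → 0ℝ Real.≤ x i) → (∀ i → x i Real.≤ 1ℝ) → ∀ e .{{_ : Positive e}} →
  Σ[ J ∈ ℕ ] Σ[ q ∈ (Fin n → ℚ) ] (IsProbs q × (∀ j → J ℕ.≤ j → ∀ i → 4× ∣ seq (x i) j - q i ∣ ≤ e))
approximate {zero} x 0≤x x≤1 e = 0 , (λ ()) , (λ ()) , λ _ _ ()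
approximate {suc n} x 0≤x x≤1 e =
  -- The allowance per bias is e / 4: half of it for the drift after index J, half for clamping.
  let ε = ½ * (½ * (½ * e))
      instance
        _ = ℚ.pos*pos⇒pos ½ e
        _ = ℚ.pos*pos⇒pos ½ (½ * e)
        _ = ℚ.pos*pos⇒pos ½ (½ * (½ * e))
      (J₀ , q , Q , h) = approximate (x ∘ suc) (0≤x ∘ suc) (x≤1 ∘ suc) e
      (J₁ , h₁) = cauchy (x zero) ε
      (J₂ , h₂) = eventually (0≤x zero) ε
      (J₃ , h₃) = eventually (x≤1 zero) ε
      J = (J₀ ℕ.⊔ J₁) ℕ.⊔ (J₂ ℕ.⊔ J₃)
      J₀≤J = ℕ.≤-trans (ℕ.m≤m⊔n J₀ J₁) (ℕ.m≤m⊔n (J₀ ℕ.⊔ J₁) (J₂ ℕ.⊔ J₃))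
      J₁≤J = ℕ.≤-trans (ℕ.m≤n⊔m J₀ J₁) (ℕ.m≤m⊔n (J₀ ℕ.⊔ J₁) (J₂ ℕ.⊔ J₃))
      J₂≤J = ℕ.≤-trans (ℕ.m≤m⊔n J₂ J₃) (ℕ.m≤n⊔m (J₀ ℕ.⊔ J₁) (J₂ ℕ.⊔ J₃))
      J₃≤J = ℕ.≤-trans (ℕ.m≤n⊔m J₂ J₃) (ℕ.m≤n⊔m (J₀ ℕ.⊔ J₁) (J₂ ℕ.⊔ J₃))
      a = seq (x zero) J
      (q₀ , Q₀ , close) = clamp a ε (ℚ.<⇒≤ (ℚ.positive⁻¹ ε))
        (subst₂ _≤_ (ℚ.+-identityˡ (- ε)) (lem a ε) (ℚ.+-monoˡ-≤ (- ε) (h₂ J J₂≤J)))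
        (h₃ J J₃≤J)
  in J , (λ { zero → q₀ ; (suc i) → q i }) , (λ { zero → Q₀ ; (suc i) → Q i }) , λ where
       j J≤j zero    → bound (seq (x zero) j) a q₀ (h₁ j J (ℕ.≤-trans J₁≤J J≤j) J₁≤J) close
       j J≤j (suc i) → h j (ℕ.≤-trans J₀≤J J≤j) i
  where
  open +-*-Solver
  lem : ∀ a ε → a + ε + - ε ≡ a
  lem = solve 2 (λ a ε → a :+ ε :+ :- ε := a) refl
  bound : ∀ y a q → ∣ y - a ∣ ≤ ½ * (½ * (½ * e)) → ∣ a - q ∣ ≤ ½ * (½ * (½ * e)) → 4× ∣ y - q ∣ ≤ e
  bound y a q h₁ h₂ = begin
    4× ∣ y - q ∣                    ≤⟨ ℚ.+-mono-≤ (ℚ.+-mono-≤ d≤ d≤) (ℚ.+-mono-≤ d≤ d≤) ⟩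
    4× (½ * (½ * (½ * e)) + ½ * (½ * (½ * e)))  ≡⟨ lem₂ e ⟩
    e                               ∎
    where
    open ≤-Reasoning
    d≤ : ∣ y - q ∣ ≤ ½ * (½ * (½ * e)) + ½ * (½ * (½ * e))
    d≤ = ℚ.≤-trans (ℚ.≤-reflexive (cong ∣_∣ (solve 3 (λ y a q → y :- q := (y :- a) :+ (a :- q)) refl y a q)))
      (ℚ.≤-trans (ℚ.∣p+q∣≤∣p∣+∣q∣ (y - a) (a - q)) (ℚ.+-mono-≤ h₁ h₂))
    lem₂ : ∀ e → 4× (½ * (½ * (½ * e)) + ½ * (½ * (½ * e))) ≡ e
    lem₂ = solve 1 (λ e → let d = con ½ :* (con ½ :* (con ½ :* e)) :+ con ½ :* (con ½ :* (con ½ :* e)) in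
      (d :+ d) :+ (d :+ d) := e) refl

ι*inv≤1 : ∀ n → ι n * inv n ≤ 1ℚ
ι*inv≤1 n = subst (ι n * inv n ≤_) (trans (ℚ.*-comm (ι (suc n)) (inv n)) (inv-* n))
    (*-monoʳ (0≤inv n) (ι-mono (ℕ.n≤1+n n)))

constants : inv 7 + inv 7 + inv 15 ≤ ⅓
constants = subst₂ (λ a b → a + a + b ≤ ⅓) e₇ e₁₅ (ℚ.toℚᵘ-cancel-≤ (ℚᵘ.*≤* (ℤ.+≤+ (ℕ.≤ᵇ⇒≤ _ _ _))))
  where
  e₇ : + 1 / 8 ≡ inv 7
  e₇ = inv-unique 7 (cong (+ 1 / 8 *_) (fromℤ-/1 (+ 8)))
  e₁₅ : + 1 / 16 ≡ inv 15
  e₁₅ = inv-unique 15 (cong (+ 1 / 16 *_) (fromℤ-/1 (+ 16)))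

∣ind∣≤1 : ∀ b → ∣ ind b ∣ ≤ 1ℚ
∣ind∣≤1 true  = ℚ.≤-refl
∣ind∣≤1 false = 0≤1

-- One of the two extra levels absorbs the leading factor 2, the other makes the inequality strict,
-- so that `separate` ends with an empty list.
light-tree-depth : ∀ N k t → suc N ℕ.≤ 2 ℕ.^ k → 2 ℕ.* (2 ℕ.^ k ℕ.* suc N ℕ.^ t) ℕ.< 2 ℕ.^ (2 ℕ.+ suc t ℕ.* k)
light-tree-depth N k t h = ℕ.≤-<-trans (ℕ.*-monoʳ-≤ 2 (begin
    2 ℕ.^ k ℕ.* suc N ℕ.^ t         ≤⟨ ℕ.*-monoʳ-≤ (2 ℕ.^ k) (ℕ.^-monoˡ-≤ t h) ⟩
    2 ℕ.^ k ℕ.* (2 ℕ.^ k) ℕ.^ t     ≡⟨ cong (2 ℕ.^ k ℕ.*_) (ℕ.^-*-assoc 2 k t) ⟩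
    2 ℕ.^ k ℕ.* 2 ℕ.^ (k ℕ.* t)     ≡⟨ ℕ.^-distribˡ-+-* 2 k (k ℕ.* t) ⟨
    2 ℕ.^ (k ℕ.+ k ℕ.* t)           ≡⟨ cong (λ m → 2 ℕ.^ (k ℕ.+ m)) (ℕ.*-comm k t) ⟩
    2 ℕ.^ (suc t ℕ.* k)             ∎))
  (ℕ.^-monoʳ-< 2 (ℕ.s≤s (ℕ.s≤s ℕ.z≤n)) (ℕ.n<1+n (suc (suc t ℕ.* k))))
  where open ℕ.≤-Reasoning

-- The mask depends on ν only through rational biases q close to it. The error under q is at most
-- 1/4, and at every late index the terms of ν change it by at most 1/16.
low-error : ∀ {N k} (cs : Vec (Word k) (suc N)) (T : PDT (suc (N ℕ.+ k))) →
  (∀ b w → ones N w ℕ.≤ 63 → run T (b ∷ w) ≡ G N cs (b ∷ w)) → (ν : Product (suc (N ℕ.+ k))) →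
  Σ[ M ∈ Word N ] error (G N cs) (maskTree M T) (mass ν) Real.≤ fromℚ ⅓
low-error {N} {k} cs T correct ν =
  let (J , q , Q , close) = approximate (prob-one ν) (prob≥0 ν) (prob≤1 ν) e {{ℚ.pos*pos⇒pos (inv n) {{inv-pos n}} (inv 15) {{inv-pos 15}}}}
      (M , error≤) = mask-error cs T correct Q
  in M , mk≤ λ ε → J , λ j J≤j → subst (_≤ ⅓ + ε) (sym (seq-error (G N cs) (maskTree M T) ν j))
    (ℚ.≤-trans (bound M (at ν j) q Q error≤ (close j J≤j))
      (subst (_≤ ⅓ + ε) (ℚ.+-identityʳ ⅓) (ℚ.+-monoʳ-≤ ⅓ (ℚ.<⇒≤ (ℚ.positive⁻¹ ε)))))
  where
  open ≤-Reasoning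
  n = suc (N ℕ.+ k)
  -- The allowance per coordinate; over all n coordinates it adds up to at most 1/16.
  e = inv n * inv 15
  0≤e : 0ℚ ≤ e
  0≤e = 0≤* (0≤inv n) (0≤inv 15)
  ne≤ : ι n * e ≤ inv 15
  ne≤ = subst₂ _≤_ (ℚ.*-assoc (ι n) (inv n) (inv 15)) (ℚ.*-identityˡ (inv 15)) (*-monoʳ (0≤inv 15) (ι*inv≤1 n))
  bound : ∀ M p q → IsProbs q → E q (ind ∘ wrong (G N cs) (maskTree M T)) ≤ inv 7 + inv 7 →
    (∀ i → 4× ∣ p i - q i ∣ ≤ e) → E p (ind ∘ wrong (G N cs) (maskTree M T)) ≤ ⅓
  bound M p q Q error≤ close = begin
    E p g                      ≡⟨ solve 2 (λ a b → a := b :+ (a :- b)) refl (E p g) (E q g) ⟩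
    E q g + (E p g - E q g)    ≤⟨ ℚ.+-mono-≤ error≤ (ℚ.≤-trans (p≤∣p∣ (E p g - E q g)) (ℚ.≤-trans
      (E-perturb p q Q e 0≤e (ℚ.≤-trans ne≤ (ℚ.≤-trans (inv-suc≤½ 14) (proj₂ ½′-prob))) close g
        (λ x → ∣ind∣≤1 (wrong (G N cs) (maskTree M T) x))) ne≤)) ⟩
    inv 7 + inv 7 + inv 15     ≤⟨ constants ⟩
    ⅓                          ∎
    where
    open +-*-Solver
    g = ind ∘ wrong (G N cs) (maskTree M T)

shallow-tree : ∀ {N k} → suc N ℕ.≤ 2 ℕ.^ k → (f : Word (suc (N ℕ.+ k)) → Bool) → ∀ t →
  Σ[ T ∈ PDT (suc (N ℕ.+ k)) ]
    (depth T ℕ.≤ 2 ℕ.+ suc (t ℕ.+ t) ℕ.* k × (∀ b w → ones N w ℕ.≤ t → run T (b ∷ w) ≡ f (b ∷ w)))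
shallow-tree {N} {k} h f t = light-tree N f t (2 ℕ.+ suc (t ℕ.+ t) ℕ.* k) (light-tree-depth N k (t ℕ.+ t) h)

-- Opaque, because unfolding arithmetic with large literals is slow.
abstract
  depthBound : ℕ → ℕ
  depthBound k = 2 ℕ.+ suc (63 ℕ.+ 63) ℕ.* k

  depthBound≤ : ∀ {k} → 2 ℕ.≤ k → depthBound k ℕ.≤ 256 ℕ.* k
  depthBound≤ {k} 2≤k = ℕ.≤-trans (ℕ.+-monoˡ-≤ (suc (63 ℕ.+ 63) ℕ.* k) 2≤k)
    (ℕ.*-monoˡ-≤ k (ℕ.≤ᵇ⇒≤ (suc (suc (63 ℕ.+ 63))) 256 _))

  D-upper : ∀ {N k} → suc N ℕ.≤ 2 ℕ.^ k → (cs : Vec (Word k) (suc N)) (ν : Product (suc (N ℕ.+ k))) →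
    Σ[ T ∈ PDT (suc (N ℕ.+ k)) ] (depth T ℕ.≤ depthBound k × error (G N cs) T (mass ν) Real.≤ fromℚ ⅓)
  D-upper {N} {k} h cs ν =
    let (T , dT , correct) = shallow-tree {N} {k} h (G N cs) 63
        (M , error≤)       = low-error cs T correct ν
    in maskTree M T , ℕ.≤-trans (ℕ.≤-reflexive (depth-maskTree M T)) dT , error≤

-- Skew cost

Answered : ∀ {n} → Word n → List (Word n × Bool) → Set
Answered x = All (λ (v , b) → ⟨ v , x ⟩ ≡ b)

implied-correct : ∀ {n} {x : Word n} es {a b} → Answered x es → implied es a ≡ just b → ⟨ a , x ⟩ ≡ b
implied-correct {x = x} List.[] {a} _ e with Vec.≡-dec Bool._≟_ a zeroʷ
implied-correct {x = x} List.[] _ refl | yes refl = ⟨0,⟩ x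
implied-correct ((v , c) List.∷ es) {a} (h All.∷ hs) e with implied es a in e₁
implied-correct ((v , c) List.∷ es) {a} (h All.∷ hs) refl | just b = implied-correct es hs e₁
implied-correct {x = x} ((v , c) List.∷ es) {a} (h All.∷ hs) e | nothing with implied es (a ⊕ v) in e₂
implied-correct {x = x} ((v , c) List.∷ es) {a} (h All.∷ hs) refl | nothing | just b = begin
  ⟨ a , x ⟩                        ≡⟨ cong ⟨_, x ⟩ (⊕-cancelʳ a v) ⟨
  ⟨ a ⊕ v ⊕ v , x ⟩                ≡⟨ ⟨,⟩-⊕ˡ (a ⊕ v) v x ⟩
  ⟨ a ⊕ v , x ⟩ xor ⟨ v , x ⟩      ≡⟨ cong₂ _xor_ (implied-correct es hs e₂) h ⟩
  b xor c                          ≡⟨ Bool.xor-comm b c ⟩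
  c xor b                          ∎
  where open ≡-Reasoning

implied-zero : ∀ {n} (es : List (Word n × Bool)) → implied es zeroʷ ≡ just false
implied-zero {n} List.[] with Vec.≡-dec Bool._≟_ (zeroʷ {n}) zeroʷ
... | yes _ = refl
... | no ≢  = ⊥-elim (≢ refl)
implied-zero ((v , c) List.∷ es) rewrite implied-zero es = refl

isZero⇒ : ∀ {n} (a : Word n) → isZero a ≡ true → a ≡ zeroʷ
isZero⇒ []          _ = refl
isZero⇒ (false ∷ a) e = cong (false ∷_) (isZero⇒ a e)

⟨,⟩-restrict : ∀ {n} (ρ : Fixing n) a x → consistent ρ x ≡ true → ⟨ restrictQuery ρ a , x ⟩ ≡ ⟨ a , x ⟩
⟨,⟩-restrict []           []      []          _ = refl
⟨,⟩-restrict (fixed₀ ∷ ρ) (b ∷ a) (false ∷ x) h rewrite Bool.∧-zeroʳ b = ⟨,⟩-restrict ρ a x h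
⟨,⟩-restrict (⋆ ∷ ρ)      (b ∷ a) (c ∷ x)     h = cong ((b ∧ c) xor_) (⟨,⟩-restrict ρ a x h)

charge : Bool → ℕ
charge zero? = if zero? then 0 else 1

-- An upper bound on the cost after restriction that depends on the path of x alone: it charges
-- every query with nonzero restriction and keeps no record of earlier answers.
effective : ∀ {n} → Fixing n → PDT n → Word n → ℕ
effective ρ (leaf b)       x = 0
effective ρ (node a T₀ T₁) x = charge (isZero (restrictQuery ρ a))
    ℕ.+ (if ⟨ a , x ⟩ then effective ρ T₁ x else effective ρ T₀ x)

-- A removed query has the answer that x itself gives, so x follows the same path as before.
-- Conversely every query that remains is charged by `effective`.
restrictFrom-sound : ∀ {n} (ρ : Fixing n) es T x → consistent ρ x ≡ true → Answered x es →
  queries (restrictFrom ρ es T) x ℕ.≤ effective ρ T x × run (restrictFrom ρ es T) x ≡ run T x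
restrictFrom-sound ρ es (leaf b) x c h = ℕ.z≤n , refl
restrictFrom-sound ρ es (node a T₀ T₁) x c h with implied es (restrictQuery ρ a) in e
restrictFrom-sound ρ es (node a T₀ T₁) x c h | just b
  rewrite trans (sym (⟨,⟩-restrict ρ a x c)) (implied-correct es h e) with b
... | false = let (q , r) = restrictFrom-sound ρ es T₀ x c h in ℕ.≤-trans q (ℕ.m≤n+m _ _) , r
... | true  = let (q , r) = restrictFrom-sound ρ es T₁ x c h in ℕ.≤-trans q (ℕ.m≤n+m _ _) , r
restrictFrom-sound ρ es (node a T₀ T₁) x c h | nothing with isZero (restrictQuery ρ a) in z
-- The zero query is always implied, so a query that is kept cannot have restriction zero.
... | true  = case trans (sym (implied-zero es)) (trans (cong (implied es) (sym (isZero⇒ _ z))) e) of λ ()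
... | false rewrite sym (⟨,⟩-restrict ρ a x c) with ⟨ restrictQuery ρ a , x ⟩ in e′
... | false = let (q , r) = restrictFrom-sound ρ ((restrictQuery ρ a , false) List.∷ es) T₀ x c (e′ All.∷ h) in ℕ.s≤s q , r
... | true  = let (q , r) = restrictFrom-sound ρ ((restrictQuery ρ a , true) List.∷ es) T₁ x c (e′ All.∷ h) in ℕ.s≤s q , r

-- On two inputs that differ in the flipping bit, f takes both values. A leaf errs on exactly one of
-- them, any other tree queries on both; an error counts twice so that either case reaches 2. The
-- outputs `r₀` and `r₁` are parameters so that the errors can be those of the unrestricted tree.
flip-bound : ∀ {n} (T : PDT (suc n)) {r₀ r₁ b} x →
  run T (false ∷ x) ≡ r₀ → run T (true ∷ x) ≡ r₁ →
  1ℚ + 1ℚ ≤ (ι (queries T (false ∷ x)) + (ind (r₀ xor b) + ind (r₀ xor b))) +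
            (ι (queries T (true ∷ x)) + (ind (r₁ xor not b) + ind (r₁ xor not b)))
flip-bound (leaf c) {b = b} x refl refl = ℚ.≤-reflexive (subst
    (λ z → 1ℚ + 1ℚ ≡ z + (ind (c xor b) + ind (c xor b)) + (z + (ind (c xor not b) + ind (c xor not b))))
    (sym fromℤ-0) (table c b))
  where
  table : ∀ c b → 1ℚ + 1ℚ ≡ 0ℚ + (ind (c xor b) + ind (c xor b))
      + (0ℚ + (ind (c xor not b) + ind (c xor not b)))
  table false false = refl
  table false true  = refl
  table true  false = refl
  table true  true  = refl
flip-bound (node a T₀ T₁) {r₀} {r₁} {b} x _ _ = ℚ.+-mono-≤ (one _ (r₀ xor b)) (one _ (r₁ xor not b))
  where
  0≤ind : ∀ c → 0ℚ ≤ ind c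
  0≤ind true  = 0≤1
  0≤ind false = ℚ.≤-refl
  one : ∀ m c → 1ℚ ≤ ι (suc m) + (ind c + ind c)
  one m c = subst (_≤ ι (suc m) + (ind c + ind c)) (ℚ.+-identityʳ 1ℚ)
    (ℚ.+-mono-≤ (subst (_≤ ι (suc m)) fromℤ-1 (ι-mono (ℕ.s≤s ℕ.z≤n))) (0≤+ (0≤ind c) (0≤ind c)))

-- The flipping bit has bias ½ and hence is free with probability 1, so `flip-bound` applies under
-- every fixing that occurs. `R-U` turns the mean error under the fixings into the error under μ.
skewCost-lower : ∀ {n} {p : Fin (suc n) → ℚ} (f : Word (suc n) → Bool) →
  p zero ≡ ½′ → (∀ i → IsProb (2ℚ * p (suc i))) → (∀ x → f (true ∷ x) ≡ not (f (false ∷ x))) →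
  ∀ T → 1ℚ ≤ skewCost p T + (E p (ind ∘ wrong f T) + E p (ind ∘ wrong f T))
skewCost-lower {n} {p} f p₀ P flip T = begin
  1ℚ                                                     ≡⟨ R-const (p ∘ suc) 1ℚ ⟨
  R (p ∘ suc) (λ _ → 1ℚ)                                 ≤⟨ R-mono P pointwise ⟩
  R (p ∘ suc) (λ ρ → U (⋆ ∷ ρ) (g (⋆ ∷ ρ)))              ≡⟨ trans (cong (λ z → mix z A B) 2p₀) (mix-1 A B) ⟨
  R p (λ ρ → U ρ (g ρ))                                  ≡⟨ R-cong p
      (λ ρ → trans (U-+ ρ (ι ∘ queries (restrict ρ T)) (λ x → w x + w x))
      (cong (λ z → U ρ (ι ∘ queries (restrict ρ T)) + z) (U-+ ρ w w))) ⟩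
  R p (λ ρ → U ρ (ι ∘ queries (restrict ρ T)) + (U ρ w + U ρ w))
                                                         ≡⟨ trans (R-+ p (λ ρ → U ρ
                                                             (ι ∘ queries (restrict ρ T)))
                                                             (λ ρ → U ρ w + U ρ w)) (cong
                                                             (λ z → skewCost p T + z) (R-+ p
                                                             (λ ρ → U ρ w) (λ ρ → U ρ w))) ⟩
  skewCost p T + (R p (λ ρ → U ρ w) + R p (λ ρ → U ρ w)) ≡⟨ cong (λ z → skewCost p T + (z + z)) (R-U p w) ⟩
  skewCost p T + (E p w + E p w)                         ∎
  where
  open ≤-Reasoning
  w = ind ∘ wrong f T
  g : Fixing (suc n) → Word (suc n) → ℚ
  g ρ x = ι (queries (restrict ρ T) x) + (w x + w x)
  A = R (p ∘ suc) (λ ρ → U (fixed₀ ∷ ρ) (g (fixed₀ ∷ ρ)))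
  B = R (p ∘ suc) (λ ρ → U (⋆ ∷ ρ) (g (⋆ ∷ ρ)))
  2p₀ : 2ℚ * p zero ≡ 1ℚ
  2p₀ = trans (cong (2ℚ *_) (trans p₀ ½′≡½)) refl
  mix-1 : ∀ a b → mix 1ℚ a b ≡ b
  mix-1 = solve 2 (λ a b → (con 1ℚ :- con 1ℚ) :* a :+ con 1ℚ :* b := b) refl
    where open +-*-Solver
  ½-two : ½′ * (1ℚ + 1ℚ) ≡ 1ℚ
  ½-two = trans (cong (_* (1ℚ + 1ℚ)) ½′≡½) refl
  pointwise : ∀ ρ → 1ℚ ≤ U (⋆ ∷ ρ) (g (⋆ ∷ ρ))
  pointwise ρ = begin
    1ℚ                                  ≡⟨ ½-two ⟨
    ½′ * (1ℚ + 1ℚ)                      ≡⟨ cong (½′ *_) (U-const ρ (1ℚ + 1ℚ)) ⟨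
    ½′ * U ρ (λ _ → 1ℚ + 1ℚ)            ≤⟨ *-monoˡ 0≤½′ (U-mono ρ λ x c → both x c) ⟩
    ½′ * U ρ (λ x → g (⋆ ∷ ρ) (false ∷ x) + g (⋆ ∷ ρ) (true ∷ x))
                                        ≡⟨ trans (cong (½′ *_) (U-+ ρ _ _)) (sym (mix-½ _ _)) ⟩
    U (⋆ ∷ ρ) (g (⋆ ∷ ρ))               ∎
    where
    T′ = restrict (⋆ ∷ ρ) T
    both : ∀ x → consistent ρ x ≡ true → 1ℚ + 1ℚ ≤ g (⋆ ∷ ρ) (false ∷ x) + g (⋆ ∷ ρ) (true ∷ x)
    both x c = subst (λ b → 1ℚ + 1ℚ ≤ g (⋆ ∷ ρ) (false ∷ x)
        + (ι (queries T′ (true ∷ x)) + (ind (run T (true ∷ x) xor b) + ind (run T (true ∷ x) xor b))))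
      (sym (flip x))
      (flip-bound T′ {b = f (false ∷ x)} x
        (proj₂ (restrictFrom-sound (⋆ ∷ ρ) List.[] T (false ∷ x) c All.[]))
        (proj₂ (restrictFrom-sound (⋆ ∷ ρ) List.[] T (true ∷ x) c All.[])))

-- The scanning tree

pad : ∀ N {k} → Word k → Word (N ℕ.+ k)
pad zero    c = c
pad (suc N) c = false ∷ pad N c

⟨pad,⟩ : ∀ N {k} (c : Word k) w → ⟨ pad N c , w ⟩ ≡ ⟨ c , after N w ⟩
⟨pad,⟩ zero    c w       = refl
⟨pad,⟩ (suc N) c (b ∷ w) = ⟨pad,⟩ N c w

ask : ∀ {n} → Word n → PDT n
ask a = node a (leaf false) (leaf true)

-- `emb` completes a query on the coordinates still ahead: its first argument tells whether b takes
-- part, and coordinates already scanned get 0. Once i is known, b ⊕ ⟨c_i , y⟩ is itself one parity,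
-- so a single query finishes.
scan : ∀ N {k n} → Vec (Word k) (suc N) → (Bool → Word (N ℕ.+ k) → Word n) → PDT n
scan zero    (c ∷ []) emb = ask (emb true c)
scan (suc N) (c ∷ cs) emb = node (emb false (true ∷ zeroʷ))
  (scan N cs (λ b u → emb b (false ∷ u))) (ask (emb true (pad (suc N) c)))

run-ask : ∀ {n} (a x : Word n) → run (ask a) x ≡ ⟨ a , x ⟩
run-ask a x with ⟨ a , x ⟩
... | true  = refl
... | false = refl

run-scan : ∀ N {k n} (cs : Vec (Word k) (suc N)) emb z₀ w (z : Word n) →
  (∀ b u → ⟨ emb b u , z ⟩ ≡ (b ∧ z₀) xor ⟨ u , w ⟩) → run (scan N cs emb) z ≡ z₀ xor F N cs w
run-scan zero    (c ∷ []) emb z₀ w       z h = trans (run-ask (emb true c) z) (h true c)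
run-scan (suc N) (c ∷ cs) emb z₀ (b ∷ w) z h
  rewrite h false (true ∷ zeroʷ) | ⟨0,⟩ w | Bool.xor-identityʳ b with b
... | false = run-scan N cs (λ b u → emb b (false ∷ u)) z₀ w z (λ b u → h b (false ∷ u))
... | true  = trans (run-ask (emb true (pad (suc N) c)) z)
    (trans (h true (pad (suc N) c)) (cong (z₀ xor_) (⟨pad,⟩ N c w)))

star : Status → ℕ
star fixed₀ = 0
star ⋆      = 1

scanCost : ∀ N {k} → Fixing (N ℕ.+ k) → Word (N ℕ.+ k) → ℕ
scanCost zero    ρ       w       = 0
scanCost (suc N) (s ∷ ρ) (b ∷ w) = star s ℕ.+ (if b then 0 else scanCost N ρ w)

restrict-zeroʷ : ∀ {n} (ρ : Fixing n) → isZero (restrictQuery ρ zeroʷ) ≡ true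
restrict-zeroʷ []           = refl
restrict-zeroʷ (fixed₀ ∷ ρ) = restrict-zeroʷ ρ
restrict-zeroʷ (⋆ ∷ ρ)      = restrict-zeroʷ ρ

charge≤1 : ∀ b → charge b ℕ.≤ 1
charge≤1 true  = ℕ.z≤n
charge≤1 false = ℕ.s≤s ℕ.z≤n

effective-ask : ∀ {n} (ρ : Fixing n) a x → effective ρ (ask a) x ℕ.≤ 1
effective-ask ρ a x with ⟨ a , x ⟩
... | true  = subst (ℕ._≤ 1) (sym (ℕ.+-identityʳ _)) (charge≤1 (isZero (restrictQuery ρ a)))
... | false = subst (ℕ._≤ 1) (sym (ℕ.+-identityʳ _)) (charge≤1 (isZero (restrictQuery ρ a)))

charge-unit : ∀ {n} s (ρ : Fixing n) → charge (isZero (restrictQuery (s ∷ ρ) (true ∷ zeroʷ))) ≡ star s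
charge-unit fixed₀ ρ rewrite restrict-zeroʷ ρ = refl
charge-unit ⋆      ρ = refl

isZero-fixed : ∀ {n} s (ρ : Fixing n) u → isZero (restrictQuery (s ∷ ρ) (false ∷ u)) ≡ isZero
    (restrictQuery ρ u)
isZero-fixed fixed₀ ρ u = refl
isZero-fixed ⋆      ρ u = refl

-- The `suc` pays for the closing query. By the second hypothesis on `emb` a scanning query
-- restricts to zero exactly when its part ahead does, so scanning a fixed coordinate is free.
effective-scan : ∀ N {k n} (cs : Vec (Word k) (suc N)) emb z₀ w (z : Word n) ρ σ →
  (∀ b u → ⟨ emb b u , z ⟩ ≡ (b ∧ z₀) xor ⟨ u , w ⟩) →
  (∀ u → isZero (restrictQuery ρ (emb false u)) ≡ isZero (restrictQuery σ u)) →
  effective ρ (scan N cs emb) z ℕ.≤ suc (scanCost N σ w)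
effective-scan zero    (c ∷ []) emb z₀ w       z ρ σ       h r = effective-ask ρ (emb true c) z
effective-scan (suc N) (c ∷ cs) emb z₀ (b ∷ w) z ρ (s ∷ σ) h r
  rewrite r (true ∷ zeroʷ) | charge-unit s σ | h false (true ∷ zeroʷ) | ⟨0,⟩ w | Bool.xor-identityʳ b with b
... | false = subst (star s ℕ.+ effective ρ (scan N cs (λ b u → emb b (false ∷ u))) z ℕ.≤_) (ℕ.+-suc (star s) _)
      (ℕ.+-monoʳ-≤ (star s) (effective-scan N cs (λ b u → emb b (false ∷ u)) z₀ w z ρ σ
          (λ b u → h b (false ∷ u)) (λ u → trans (r (false ∷ u)) (isZero-fixed s σ u))))
... | true  = subst (star s ℕ.+ effective ρ (ask (emb true (pad (suc N) c))) z ℕ.≤_) (ℕ.+-suc (star s) 0)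
      (ℕ.+-monoʳ-≤ (star s) (effective-ask ρ (emb true (pad (suc N) c)) z))

-- A free coordinate is one with probability 1/2, so on average the scan meets two of them.
scanCost-mean : ∀ N {k} {p : Fin (N ℕ.+ k) → ℚ} → (∀ i → IsProb (2ℚ * p i)) →
  R p (λ ρ → U ρ (λ w → ι (scanCost N ρ w))) ≤ 1ℚ + 1ℚ
scanCost-mean zero {p = p} P = subst (_≤ 1ℚ + 1ℚ)
  (sym (trans (R-cong p (λ ρ → trans (U-const ρ (ι 0)) fromℤ-0)) (R-const p 0ℚ))) (0≤+ 0≤1 0≤1)
scanCost-mean (suc N) {k} {p} P = begin
  mix (2ℚ * p zero) X (R q (λ ρ → mix ½′ (U ρ (λ w → ι (suc (scanCost N ρ w)))) (U ρ (λ w → ι 1))))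
    ≡⟨ cong (mix (2ℚ * p zero) X) (trans (R-mix q ½′ _ _) (cong₂ (mix ½′) eX e1)) ⟩
  mix (2ℚ * p zero) X (mix ½′ (1ℚ + X) 1ℚ)
    ≤⟨ mix-mono (P zero) ih (mix-mono ½′-prob (ℚ.+-monoʳ-≤ 1ℚ ih) ℚ.≤-refl) ⟩
  mix (2ℚ * p zero) (1ℚ + 1ℚ) (mix ½′ (1ℚ + (1ℚ + 1ℚ)) 1ℚ)
    ≡⟨ trans (cong (mix (2ℚ * p zero) (1ℚ + 1ℚ)) (cong (λ z → mix z (1ℚ + (1ℚ + 1ℚ)) 1ℚ) ½′≡½))
        (mix-same (2ℚ * p zero) (1ℚ + 1ℚ)) ⟩
  1ℚ + 1ℚ ∎
  where
  open ≤-Reasoning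
  q = p ∘ suc
  X = R q (λ ρ → U ρ (λ w → ι (scanCost N {k} ρ w)))
  ih : X ≤ 1ℚ + 1ℚ
  ih = scanCost-mean N (P ∘ suc)
  eX : R q (λ ρ → U ρ (λ w → ι (suc (scanCost N {k} ρ w)))) ≡ 1ℚ + X
  eX = trans (R-cong q (λ ρ → trans (Ucong ρ) (trans (U-+ ρ (λ _ → 1ℚ) _)
      (cong (_+ U ρ (λ w → ι (scanCost N ρ w))) (U-const ρ 1ℚ)))))
    (trans (R-+ q (λ _ → 1ℚ) _) (cong (_+ X) (R-const q 1ℚ)))
    where
    Ucong : ∀ ρ → U ρ (λ w → ι (suc (scanCost N {k} ρ w))) ≡ U ρ (λ w → 1ℚ + ι (scanCost N ρ w))
    Ucong ρ = ℚ.≤-antisym (U-mono ρ λ w _ → ℚ.≤-reflexive (ι-suc _))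
        (U-mono ρ λ w _ → ℚ.≤-reflexive (sym (ι-suc _)))
  e1 : R q (λ ρ → U ρ (λ w → ι 1)) ≡ 1ℚ
  e1 = trans (R-cong q (λ ρ → trans (U-const ρ (ι 1)) fromℤ-1)) (R-const q 1ℚ)

scanTree : ∀ N {k} → Vec (Word k) (suc N) → PDT (suc (N ℕ.+ k))
scanTree N cs = scan N cs _∷_

scanTree-correct : ∀ N {k} (cs : Vec (Word k) (suc N)) z → run (scanTree N cs) z ≡ G N cs z
scanTree-correct N cs (b ∷ w) = run-scan N cs _∷_ b w (b ∷ w) (λ _ _ → refl)

scanTree-cost : ∀ N {k} (cs : Vec (Word k) (suc N)) {p} → (∀ i → IsProb (2ℚ * p i)) →
  skewCost p (scanTree N cs) ≤ 1ℚ + (1ℚ + 1ℚ)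
scanTree-cost N {k} cs {p} P = begin
  skewCost p (scanTree N cs)                         ≤⟨ mix-mono (P zero)
      (R-mono (P ∘ suc) (λ ρ → cost≤ fixed₀ ρ false (λ _ c → c)))
                                                          (R-mono (P ∘ suc) (λ ρ → mix-mono ½′-prob
                                                              (cost≤ ⋆ ρ false (λ _ c → c))
                                                              (cost≤ ⋆ ρ true (λ _ c → c)))) ⟩
  mix (2ℚ * p zero) Y (R q (λ ρ → mix ½′ (u ρ) (u ρ))) ≡⟨ trans
      (cong (mix (2ℚ * p zero) Y) (R-cong q (λ ρ → mix-same ½′ (u ρ)))) (mix-same (2ℚ * p zero) Y) ⟩
  Y                                                  ≡⟨ trans
      (R-cong q (λ ρ → trans (U-+ ρ (λ _ → 1ℚ) _) (cong (_+ U ρ (λ w → ι (scanCost N ρ w))) (U-const ρ 1ℚ))))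
                                                         (trans (R-+ q (λ _ → 1ℚ) _)
                                                             (cong (_+ R q (λ ρ → U ρ (λ w →
                                                             ι (scanCost N ρ w)))) (R-const q 1ℚ))) ⟩
  1ℚ + R q (λ ρ → U ρ (λ w → ι (scanCost N ρ w)))    ≤⟨ ℚ.+-monoʳ-≤ 1ℚ (scanCost-mean N (P ∘ suc)) ⟩
  1ℚ + (1ℚ + 1ℚ)                                     ∎
  where
  open ≤-Reasoning
  q = p ∘ suc
  u : Fixing (N ℕ.+ k) → ℚ
  u ρ = U ρ (λ w → 1ℚ + ι (scanCost N ρ w))
  Y = R q u
  consistent-∷ : ∀ s b (ρ : Fixing (N ℕ.+ k)) w → consistent (s ∷ ρ) (b ∷ w) ≡ true →
    queries (restrict (s ∷ ρ) (scanTree N cs)) (b ∷ w) ℕ.≤ suc (scanCost N ρ w)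
  consistent-∷ s b ρ w c = ℕ.≤-trans (proj₁ (restrictFrom-sound (s ∷ ρ) List.[] (scanTree N cs)
      (b ∷ w) c All.[]))
    (effective-scan N cs _∷_ b w (b ∷ w) (s ∷ ρ) ρ (λ _ _ → refl) (isZero-fixed s ρ))
  cost≤ : ∀ s ρ b → (∀ w → consistent ρ w ≡ true → consistent (s ∷ ρ) (b ∷ w) ≡ true) →
    U ρ (λ w → ι (queries (restrict (s ∷ ρ) (scanTree N cs)) (b ∷ w))) ≤ u ρ
  cost≤ s ρ b h = U-mono ρ λ w c → subst (ι (queries (restrict (s ∷ ρ) (scanTree N cs)) (b ∷ w)) ≤_)
      (ι-suc (scanCost N ρ w))
    (ι-mono (consistent-∷ s b ρ w (h w c)))

-- The terms of a nonnegative real weight may be slightly negative. A deficit of at most (ε/2) / (1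
-- + d) for the first weight costs at most ε/2 after multiplication by its coefficient d; the
-- remaining weights share the other half.
nonneg-combination : ∀ {m} (w : Fin m → ℝ) → (∀ i → 0ℝ Real.≤ w i) → (d : Fin m → ℚ) → (∀ i → 0ℚ ≤ d i) →
  ∀ ε .{{_ : Positive ε}} → Σ[ J ∈ ℕ ] (∀ j → J ℕ.≤ j → - ε ≤ Σᶠ (λ i → seq (w i) j * d i))
nonneg-combination {zero}  w 0≤w d 0≤d ε = 0 , λ _ _ → ℚ.<⇒≤ (ℚ.neg-antimono-< (ℚ.positive⁻¹ ε))
nonneg-combination {suc m} w 0≤w d 0≤d ε =
  let instance
        _ = ℚ.pos*pos⇒pos ½ ε
        t>0 = t-pos
        _ = ℚ.pos*pos⇒pos (½ * ε) t
      (J₀ , h₀) = eventually (0≤w zero) (½ * ε * t)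
      (J₁ , h₁) = nonneg-combination (w ∘ suc) (0≤w ∘ suc) (d ∘ suc) (0≤d ∘ suc) (½ * ε)
  in J₀ ℕ.⊔ J₁ , λ j J≤j → subst (_≤ Σᶠ (λ i → seq (w i) j * d i)) (halves-sum ε)
       (ℚ.+-mono-≤ (term (seq (w zero) j) ε (h₀ j (ℕ.m⊔n≤o⇒m≤o J₀ J₁ J≤j))) (h₁ j (ℕ.m⊔n≤o⇒n≤o J₀ J₁ J≤j)))
  where
  open +-*-Solver
  s = 1ℚ + d zero
  s-pos : Positive s
  s-pos = positive (ℚ.+-mono-<-≤ (ℚ.positive⁻¹ 1ℚ) (0≤d zero))
  t = (ℚ.1/ s) {{ℚ.pos⇒nonZero s {{s-pos}}}}
  t-pos : Positive t
  t-pos = ℚ.1/pos⇒pos s {{s-pos}}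
  halves-sum : ∀ ε → - (½ * ε) + - (½ * ε) ≡ - ε
  halves-sum = solve 1 (λ ε → :- (con ½ :* ε) :+ :- (con ½ :* ε) := :- ε) refl
  term : ∀ v ε .{{_ : Positive ε}} → 0ℚ ≤ v + ½ * ε * t → - (½ * ε) ≤ v * d zero
  term v ε h = 0≤-⇒≤ (subst (0ℚ ≤_) e (0≤+ (0≤* h (0≤d zero))
      (0≤* (ℚ.nonNegative⁻¹ (½ * ε) {{ℚ.pos⇒nonNeg (½ * ε) {{ℚ.pos*pos⇒pos ½ ε}}}})
      (ℚ.<⇒≤ (ℚ.positive⁻¹ t {{t-pos}})))))
    where
    st : t * (1ℚ + d zero) ≡ 1ℚ
    st = ℚ.*-inverseˡ s {{ℚ.pos⇒nonZero s {{s-pos}}}}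
    lem : ∀ v h t d → (v + h * t) * d + h * t ≡ v * d + h * (t * (1ℚ + d))
    lem = solve 4 (λ v h t d → (v :+ h :* t) :* d :+ h :* t := v :* d :+ h :* (t :* (con 1ℚ :+ d))) refl
    lem₂ : ∀ a h → a + h * 1ℚ ≡ a - - h
    lem₂ = solve 2 (λ a h → a :+ h :* con 1ℚ := a :- :- h) refl
    e : (v + ½ * ε * t) * d zero + ½ * ε * t ≡ v * d zero - - (½ * ε)
    e = trans (lem v (½ * ε) t (d zero)) (trans (cong (λ z → v * d zero + ½ * ε * z) st)
        (lem₂ (v * d zero) (½ * ε)))

-- Arranged so that each sum falls under one fact: the slacks of `skewCost-lower` are nonnegative,
-- the weights total 1, and the error is at most 0.
Σᶠ-split : ∀ {m} (w C e : Fin m → ℚ) →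
  Σᶠ (λ i → w i * C i) ≡ Σᶠ (λ i → w i * (C i + (e i + e i) - 1ℚ)) + Σᶠ w
      - (Σᶠ (λ i → w i * e i) + Σᶠ (λ i → w i * e i))
Σᶠ-split {zero}  w C e = refl
Σᶠ-split {suc m} w C e = trans (cong (λ z → w zero * C zero + z) (Σᶠ-split (w ∘ suc) (C ∘ suc) (e ∘ suc)))
  (lem (w zero) (C zero) (e zero) _ _ _)
  where
  open +-*-Solver
  lem : ∀ w c e x y z → w * c + (x + y - (z + z)) ≡ (w * (c + (e + e) - 1ℚ) + x) + (w + y)
      - ((w * e + z) + (w * e + z))
  lem = solve 6 (λ w c e x y z → w :* c :+ (x :+ y :- (z :+ z)) :=
    (w :* (c :+ (e :+ e) :- con 1ℚ) :+ x) :+ (w :+ y) :- ((w :* e :+ z) :+ (w :* e :+ z))) refl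

natural-⊑ : ∀ {m n} → m ℕ.≤ n → natural m ⊑ ι n
natural-⊑ {m} {n} m≤n = real-⊑ (≤ᴿ-pointwise λ _ → subst (_≤ ι n) (fromℤ-/1 (+ m)) (ι-mono m≤n))

natural-⊒ : ∀ {m n} → n ℕ.≤ m → natural m ⊒ ι n
natural-⊒ {m} {n} n≤m = real-⊒ (≤ᴿ-pointwise λ _ → subst (ι n ≤_) (fromℤ-/1 (+ m)) (ι-mono n≤m))

-- Choice of the parameters

power-above : ∀ n → 1 ℕ.≤ n → Σ[ k ∈ ℕ ] (n ℕ.≤ 2 ℕ.^ k × 2 ℕ.^ k ℕ.< 2 ℕ.* n)
power-above (suc zero) _ = 0 , ℕ.≤-refl , ℕ.≤-refl
power-above (suc (suc n)) _ with power-above (suc n) (ℕ.s≤s ℕ.z≤n)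
... | k , n≤ , <2n with suc (suc n) ℕ.≤? 2 ℕ.^ k
... | yes n+1≤ = k , n+1≤ , ℕ.<-≤-trans <2n (ℕ.*-monoʳ-≤ 2 (ℕ.n≤1+n (suc n)))
... | no  n+1≰ = suc k , ℕ.≤-trans (ℕ.+-mono-≤ 1≤ n≤) (ℕ.+-monoʳ-≤ (2 ℕ.^ k) (ℕ.m≤m+n _ 0)) ,
    ℕ.*-monoʳ-< 2 (ℕ.≰⇒> n+1≰)
  where
  1≤ : 1 ℕ.≤ 2 ℕ.^ k
  1≤ = ℕ.≤-trans (ℕ.s≤s ℕ.z≤n) n≤

linear≤power : ∀ m → 4 ℕ.+ m ℕ.≤ 2 ℕ.^ (2 ℕ.+ m)
linear≤power zero    = ℕ.≤-refl
linear≤power (suc m) = ℕ.+-mono-≤ (ℕ.^-monoʳ-≤ 2 (ℕ.z≤n {2 ℕ.+ m})) (ℕ.≤-trans (linear≤power m) (ℕ.m≤m+n _ 0))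

-- The number of bits of y is k = 4 + m, with 2^(k-1) < n ≤ 2ᵏ. Since k ≤ 2^(k-2), removing b and y
-- from the n bits still leaves N + 1 ≥ 2^(k-2). That inequality starts to hold at k = 4, whence the
-- threshold 16.
record Parameters (n : ℕ) : Set where
  field
    N m    : ℕ
    size   : n ≡ suc (N ℕ.+ (4 ℕ.+ m))
    N<     : suc N ℕ.≤ 2 ℕ.^ (4 ℕ.+ m)
    ≤N     : 2 ℕ.^ (2 ℕ.+ m) ℕ.≤ suc N
    n≤     : n ℕ.≤ 2 ℕ.^ (4 ℕ.+ m)

parameters : ∀ n → 16 ℕ.≤ n → Parameters n
parameters n 16≤n with power-above n (ℕ.≤-trans (ℕ.s≤s ℕ.z≤n) 16≤n)
... | k , n≤ , <2n = record
  { N = N ; m = m ; size = size ; N< = ℕ.≤-trans (ℕ.≤-trans (ℕ.m≤m+n (suc N) (4 ℕ.+ m))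
      (ℕ.≤-reflexive (sym size))) n≤′
  ; ≤N = ℕ.+-cancelʳ-≤ (4 ℕ.+ m) _ _ (subst (2 ℕ.^ (2 ℕ.+ m) ℕ.+ (4 ℕ.+ m) ℕ.≤_) size room) ; n≤ = n≤′ }
  where
  4≤k : 4 ℕ.≤ k
  4≤k = ℕ.≮⇒≥ λ k<4 → ℕ.<-irrefl refl (ℕ.<-≤-trans (ℕ.^-monoʳ-< 2 (ℕ.s≤s (ℕ.s≤s ℕ.z≤n)) k<4)
      (ℕ.≤-trans 16≤n n≤))
  m = k ℕ.∸ 4
  k≡ : 4 ℕ.+ m ≡ k
  k≡ = ℕ.m+[n∸m]≡n 4≤k
  n≤′ : n ℕ.≤ 2 ℕ.^ (4 ℕ.+ m)
  n≤′ = subst (λ k → n ℕ.≤ 2 ℕ.^ k) (sym k≡) n≤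
  half< : 2 ℕ.^ (3 ℕ.+ m) ℕ.< n
  half< = ℕ.*-cancelˡ-< 2 _ _ (subst (λ k → 2 ℕ.^ k ℕ.< 2 ℕ.* n) (sym k≡) <2n)
  room : 2 ℕ.^ (2 ℕ.+ m) ℕ.+ (4 ℕ.+ m) ℕ.≤ n
  room = ℕ.≤-trans (ℕ.+-monoʳ-≤ (2 ℕ.^ (2 ℕ.+ m)) (ℕ.≤-trans (linear≤power m) (ℕ.m≤m+n _ 0))) (ℕ.<⇒≤ half<)
  N = n ℕ.∸ suc (4 ℕ.+ m)
  size : n ≡ suc (N ℕ.+ (4 ℕ.+ m))
  size = trans (sym (ℕ.m∸n+n≡m (ℕ.≤-trans (ℕ.+-monoˡ-≤ (4 ℕ.+ m) (ℕ.^-monoʳ-≤ 2 (ℕ.z≤n {2 ℕ.+ m}))) room)))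
      (ℕ.+-suc N (4 ℕ.+ m))

-- Assembly of the bounds

_∈[_,_] : Cut → ℚ → ℚ → Set
X ∈[ a , b ] = X ⊒ a × X ⊑ b

-- κ is the number k of bits of y. The lower bounds are A or A - 1 for A = k - 2, and k ≤ 8 (A - 1);
-- the upper bounds are k, 2k + 1 and 2 + 127k, all at most 256k. One pair of constants thus serves
-- all three quantities.
record Good (n : ℕ) (f : Word n → Bool) (μ : Product n) : Set where
  field
    κ     : ℚ
    D×∈   : D× f ∈[ inv 7 * κ , ι 256 * κ ]
    disc∈ : disc f (mass μ) ∈[ inv 7 * κ , ι 256 * κ ]
    log∈  : log₂ (fromℕ n) ∈[ inv 7 * κ , ι 256 * κ ]
    S∈    : S 0ℚ f μ ∈[ 1ℚ , 1ℚ + (1ℚ + 1ℚ) ]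

between : ∀ X k {lo hi} → k ℕ.≤ 8 ℕ.* lo → hi ℕ.≤ 256 ℕ.* k → X ⊒ ι lo → X ⊑ ι hi → X ∈[ inv 7 * ι k ,
    ι 256 * ι k ]
between X k {lo} {hi} k≤ hi≤ X⊒ X⊑ =
  ⊒-weaken {X} (subst (inv 7 * ι k ≤_) e (*-monoˡ (0≤inv 7) (ι-mono k≤))) X⊒ ,
  ⊑-weaken {X} (subst (ι hi ≤_) (ι-* 256 k) (ι-mono hi≤)) X⊑
  where
  e : inv 7 * ι (8 ℕ.* lo) ≡ ι lo
  e = trans (cong (inv 7 *_) (ι-* 8 lo)) (trans (sym (ℚ.*-assoc (inv 7) (ι 8) (ι lo)))
    (trans (cong (_* ι lo) (inv-* 7)) (ℚ.*-identityˡ (ι lo))))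

ι-pow2 : ∀ k → ι (2 ℕ.^ k) ≡ pow2 (+ k)
ι-pow2 zero    = fromℤ-1
ι-pow2 (suc k) = trans (ι-* 2 (2 ℕ.^ k)) (cong₂ _*_ (fromℤ-/1 (+ 2)) (ι-pow2 k))

log₂-fromℕ-⊒ : ∀ {k n} → 2 ℕ.^ k ℕ.≤ n → log₂ (fromℕ n) ⊒ ι k
log₂-fromℕ-⊒ {k} {n} h = log₂-⊒ (fromℕ n) (+ k) λ _ → subst₂ _≤_ (ι-pow2 k) (fromℤ-/1 (+ n)) (ι-mono h)

log₂-fromℕ-⊑ : ∀ {k n} → n ℕ.≤ 2 ℕ.^ k → log₂ (fromℕ n) ⊑ ι k
log₂-fromℕ-⊑ {k} {n} h = log₂-⊑ (fromℕ n) (+ k)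
  (λ _ → subst (0ℚ ≤_) (fromℤ-/1 (+ n)) (0≤ι n))
  (λ _ → subst₂ _≤_ (fromℤ-/1 (+ n)) (ι-pow2 k) (ι-mono h))

module Instance (N k : ℕ) (h : suc N ℕ.≤ 2 ℕ.^ k) where

  cs : Vec (Word k) (suc N)
  cs = codes {N} {k} h

  biases≤½ : ∀ i → biases N {k} i ≤ ½′
  biases≤½ zero    = ℚ.≤-refl
  biases≤½ (suc i) = go N i
    where
    go : ∀ N i → hazards N {k} i ≤ ½′
    go zero    i       = ℚ.≤-refl
    go (suc N) zero    = inv-suc≤½ N
    go (suc N) (suc i) = go N i

  biases-prob : IsProbs (biases N {k})
  biases-prob zero    = ½′-prob
  biases-prob (suc i) = hazards-prob N i

  2biases-prob : ∀ i → IsProb (2ℚ * biases N {k} i)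
  2biases-prob i = 0≤* (ℚ.nonNegative⁻¹ 2ℚ) (proj₁ (biases-prob i)) ,
    subst (2ℚ * biases N i ≤_) (trans (cong (2ℚ *_) ½′≡½) refl) (*-monoˡ (ℚ.nonNegative⁻¹ 2ℚ) (biases≤½ i))

  μ : Product (suc (N ℕ.+ k))
  μ = record
    { prob-one = λ i → fromℚ (biases N {k} i)
    ; prob≥0   = λ i → ≤ᴿ-pointwise λ _ → proj₁ (biases-prob i)
    ; prob≤1   = λ i → ≤ᴿ-pointwise λ _ → proj₂ (biases-prob i) }

  zeroBiased : ZeroBiased μ
  zeroBiased i = ≤ᴿ-pointwise λ _ → subst (_≤ 1ℚ - biases N {k} i) 1-½′
      (ℚ.+-monoʳ-≤ 1ℚ (ℚ.neg-antimono-≤ (biases≤½ i)))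
    where
    1-½′ : 1ℚ - ½′ ≡ ½
    1-½′ rewrite ½′≡½ = refl

  S-lower : S 0ℚ (G N cs) μ ⊒ 1ℚ
  S-lower = minimum-⊒ λ (𝒯 , err≤0) → real-⊒ (bound 𝒯 err≤0)
    where
    bound : ∀ 𝒯 → err (G N cs) 𝒯 (mass μ) Real.≤ fromℚ 0ℚ → fromℚ 1ℚ Real.≤ sq̄ μ 𝒯
    bound 𝒯 err≤0 = mk≤ λ ε →
      -- Four tolerances are spent: one on the slacks, one on the total weight and two on the error,
      -- which is counted twice.
      let ε′ = ½ * (½ * ε)
          instance
            _ = ℚ.pos*pos⇒pos ½ ε
            _ = ℚ.pos*pos⇒pos ½ (½ * ε)
          (J₀ , h₀) = nonneg-combination (weight 𝒯) (weight≥0 𝒯) d 0≤d ε′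
          (J₁ , h₁) = eventually (proj₂ (total 𝒯)) ε′
          (J₂ , h₂) = eventually err≤0 ε′
      in (J₀ ℕ.⊔ J₁) ℕ.⊔ J₂ , λ j J≤j →
        let J₀₁≤j = ℕ.m⊔n≤o⇒m≤o (J₀ ℕ.⊔ J₁) J₂ J≤j
            W = Σᶠ (λ i → seq (weight 𝒯 i) j)
            X = Σᶠ (λ i → seq (weight 𝒯 i) j * e i)
            Y = Σᶠ (λ i → seq (weight 𝒯 i) j * d i)
        in subst (λ z → 1ℚ ≤ z + ε) (sym (trans (seq-sq̄ μ 𝒯 j) (Σᶠ-split (λ i → seq (weight 𝒯 i) j) C e)))
             (combine ε Y W X (h₀ j (ℕ.m⊔n≤o⇒m≤o J₀ J₁ J₀₁≤j))
               (subst (λ z → 1ℚ ≤ z + ε′) (seq-∑ (weight 𝒯) j) (h₁ j (ℕ.m⊔n≤o⇒n≤o J₀ J₁ J₀₁≤j)))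
               (subst (_≤ 0ℚ + ε′) (seq-err (G N cs) 𝒯 μ j) (h₂ j (ℕ.m⊔n≤o⇒n≤o (J₀ ℕ.⊔ J₁) J₂ J≤j))))
      where
      open Randomised
      open +-*-Solver
      C e d : Fin (size 𝒯) → ℚ
      C i = skewCost (biases N) (tree 𝒯 i)
      e i = E (biases N) (ind ∘ wrong (G N cs) (tree 𝒯 i))
      d i = C i + (e i + e i) - 1ℚ
      0≤d : ∀ i → 0ℚ ≤ d i
      0≤d i = ≤⇒0≤- (skewCost-lower {p = biases N {k}} (G N cs) refl (2biases-prob ∘ suc) (λ _ → refl)
          (tree 𝒯 i))
      combine : ∀ ε y w x → - (½ * (½ * ε)) ≤ y → 1ℚ ≤ w + ½ * (½ * ε) → x ≤ 0ℚ + ½ * (½ * ε) →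
          1ℚ ≤ y + w - (x + x) + ε
      combine ε y w x hy hw hx = 0≤-⇒≤ (subst (0ℚ ≤_) (lem ε y w x)
        (0≤+ (0≤+ (≤⇒0≤- hy) (≤⇒0≤- hw)) (0≤+ (≤⇒0≤- hx) (≤⇒0≤- hx))))
        where
        lem : ∀ ε y w x → ((y - - (½ * (½ * ε))) + (w + ½ * (½ * ε) - 1ℚ))
            + ((0ℚ + ½ * (½ * ε) - x) + (0ℚ + ½ * (½ * ε) - x)) ≡ y + w - (x + x) + ε - 1ℚ
        lem = solve 4 (λ ε y w x → let q = con ½ :* (con ½ :* ε) in
          ((y :- :- q) :+ (w :+ q :- con 1ℚ)) :+ ((con 0ℚ :+ q :- x) :+ (con 0ℚ :+ q :- x)) := y :+ w :-
              (x :+ x) :+ ε :- con 1ℚ) refl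

  S-upper : S 0ℚ (G N cs) μ ⊑ 1ℚ + (1ℚ + 1ℚ)
  S-upper = minimum-⊑ (𝒯 , err≤0) (real-⊑ (≤ᴿ-pointwise cost≤))
    where
    open Randomised
    𝒯 : Randomised (suc (N ℕ.+ k))
    𝒯 = record
      { size = 1 ; tree = λ _ → scanTree N cs ; weight = λ _ → 1ℝ
      ; weight≥0 = λ _ → ≤ᴿ-pointwise λ _ → 0≤1
      ; total = ≤ᴿ-pointwise (λ _ → ℚ.≤-refl) , ≤ᴿ-pointwise (λ _ → ℚ.≤-refl) }
    unit : ∀ x → 1ℚ * x + 0ℚ ≡ x
    unit x = trans (ℚ.+-identityʳ (1ℚ * x)) (ℚ.*-identityˡ x)
    err≤0 : err (G N cs) 𝒯 (mass μ) Real.≤ fromℚ 0ℚ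
    err≤0 = ≤ᴿ-pointwise λ j → ℚ.≤-reflexive (trans (seq-err (G N cs) 𝒯 μ j) (trans (unit _)
      (trans (E-cong (biases N) λ x → cong ind (trans (cong (_xor (G N cs) x) (scanTree-correct N cs x))
          (Bool.xor-same ((G N cs) x))))
        (E-const (biases N {k}) 0ℚ))))
    cost≤ : ∀ j → seq (sq̄ μ 𝒯) j ≤ 1ℚ + (1ℚ + 1ℚ)
    cost≤ j = subst (_≤ 1ℚ + (1ℚ + 1ℚ)) (sym (trans (seq-sq̄ μ 𝒯 j)
        (unit (skewCost (biases N {k}) (scanTree N cs))))) (scanTree-cost N cs {biases N {k}} 2biases-prob)

  D×-upper : D× (G N cs) ⊑ ι (depthBound k)
  D×-upper = maximum-⊑ {X = λ ν → D ⅓ (G N cs) (mass ν)} λ ν → best ν (D-upper {N} {k} h cs ν)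
    where
    best : ∀ ν → Σ[ T ∈ PDT (suc (N ℕ.+ k)) ] (depth T ℕ.≤ depthBound k × error (G N cs) T
        (mass ν) Real.≤ fromℚ ⅓) →
      D ⅓ (G N cs) (mass ν) ⊑ ι (depthBound k)
    best ν (T , dT , error≤) = minimum-⊑ {X = λ (T , _) → natural (depth T)} (T , error≤) (natural-⊑ dT)

  discrepancy≤ : ∀ P → Affine P → ∣ E (biases N) (signed (G N cs) P) ∣ ≤ inv N
  discrepancy≤ = G-discrepancy N cs (codes-spread {N} {k} h)

  D×-lower : ∀ {A} → 2 ℕ.^ A ℕ.≤ suc N → D× (G N cs) ⊒ ι (A ℕ.∸ 1)
  D×-lower {A} h = maximum-⊒ {X = λ ν → D ⅓ (G N cs) (mass ν)} μ
      (minimum-⊒ {X = λ (T , _) → natural (depth T)} λ (T , error≤) → natural-⊒ (bound T (≤ᴿ⇒≤ error≤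
      (λ j → ℚ.≤-reflexive (sym (seq-error (G N cs) T μ j))) (λ _ → ℚ.≤-refl))))
    where
    bound : ∀ T → E (biases N) (ind ∘ wrong (G N cs) T) ≤ ⅓ → A ℕ.∸ 1 ℕ.≤ depth T
    -- From ⅓ ≤ 2ᵈ / (N + 1) it follows that 2^A ≤ N + 1 ≤ 3 · 2ᵈ < 2^(d+2), that is, A ≤ d + 1.
    bound T e≤⅓ = ℕ.∸-monoˡ-≤ {A} {suc (depth T)} 1 (ℕ.≮⇒≥ λ d+1<A → ℕ.<-irrefl refl (begin-strict
        3 ℕ.* 2 ℕ.^ depth T      <⟨ ℕ.*-monoˡ-< (2 ℕ.^ depth T) {{ℕ.m^n≢0 2 (depth T)}} (ℕ.≤-refl {4}) ⟩
        4 ℕ.* 2 ℕ.^ depth T      ≡⟨ ℕ.*-assoc 2 2 (2 ℕ.^ depth T) ⟩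
        2 ℕ.^ suc (suc (depth T)) ≤⟨ ℕ.^-monoʳ-≤ 2 d+1<A ⟩
        2 ℕ.^ A                  ≤⟨ h ⟩
        suc N                    ≤⟨ ι-cancel count ⟩
        3 ℕ.* 2 ℕ.^ depth T      ∎))
      where
      open ℕ.≤-Reasoning
      ι3 : ι 3 * ⅓ ≡ 1ℚ
      ι3 = cong (_* ⅓) (fromℤ-/1 (+ 3))
      count : ι (suc N) ≤ ι (3 ℕ.* 2 ℕ.^ depth T)
      count = subst₂ _≤_
        (trans (sym (ℚ.*-assoc (ι 3) ⅓ (ι (suc N)))) (trans (cong (_* ι (suc N)) ι3) (ℚ.*-identityˡ _)))
        (trans (cong (ι 3 *_) (trans (ℚ.*-assoc (ι (2 ℕ.^ depth T)) (inv N) (ι (suc N)))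
          (trans (cong (ι (2 ℕ.^ depth T) *_) (inv-* N)) (ℚ.*-identityʳ _)))) (sym (ι-* 3 (2 ℕ.^ depth T))))
        (*-monoˡ (0≤ι 3) (*-monoʳ (0≤ι (suc N)) (depth-bound {p = biases N {k}} {f = G N cs}
            (0≤inv N) discrepancy≤ T e≤⅓)))

  half-power : ∀ A → ½ ^ᵠ A * ι (2 ℕ.^ A) ≡ 1ℚ
  half-power zero    = cong (1ℚ *_) fromℤ-1
  half-power (suc A) = trans (cong (½ * ½ ^ᵠ A *_) (ι-* 2 (2 ℕ.^ A)))
    (trans (lem (½ ^ᵠ A) (ι 2) (ι (2 ℕ.^ A))) (cong₂ _*_ (cong (½ *_) (fromℤ-/1 (+ 2))) (half-power A)))
    where
    open +-*-Solver
    lem : ∀ p t q → ½ * p * (t * q) ≡ ½ * t * (p * q)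
    lem = solve 3 (λ p t q → con ½ :* p :* (t :* q) := con ½ :* t :* (p :* q)) refl

  disc-lower : ∀ {A} → 2 ℕ.^ A ℕ.≤ suc N → disc (G N cs) (mass μ) ⊒ ι A
  disc-lower {A} h = subst (disc (G N cs) (mass μ) ⊒_) (neg-fromℤ (+ A))
    (negate-⊒ (maximum-⊑ {X = λ S → log₂ Real.∣ signedMass (G N cs) (mass μ) S ∣} λ S →
        log₂-⊑ Real.∣ signedMass (G N cs) (mass μ) S ∣ (ℤ.- + A)
      (λ j → ℚ.0≤∣p∣ (seq (signedMass (G N cs) (mass μ) S) j))
      (λ j → subst₂ _≤_ (cong ∣_∣ (sym (seq-signedMass (G N cs) μ S j))) (sym (pow2-neg A))
        (ℚ.≤-trans (discrepancy≤ _ (member-affine S)) small))))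
    where
    small : inv N ≤ ½ ^ᵠ A
    small = inv≤ N (subst (_≤ ½ ^ᵠ A * ι (suc N)) (half-power A)
        (*-monoˡ (0≤^ᵠ (ℚ.nonNegative⁻¹ ½) A) (ι-mono h)))

  -- The point zero has mass ½ · 1/(N + 1) · 2⁻ᵏ, which is at least 2^-(2k+1) because N + 1 ≤ 2ᵏ.
  disc-upper : disc (G N cs) (mass μ) ⊑ ι (suc (k ℕ.+ k))
  disc-upper = subst (disc (G N cs) (mass μ) ⊑_) (neg-fromℤ (+ suc (k ℕ.+ k)))
    (negate-⊑ (maximum-⊒ {X = λ S → log₂ Real.∣ signedMass (G N cs) (mass μ) S ∣} origin₀
        (log₂-⊒ Real.∣ signedMass (G N cs) (mass μ) origin₀ ∣ (ℤ.- + suc (k ℕ.+ k))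
      (λ j → subst (½ ^ᵠ suc (k ℕ.+ k) ≤_) (cong ∣_∣ (sym
          (trans (seq-signedMass (G N cs) μ origin₀ j) (origin-mass N cs))))
        (ℚ.≤-trans large (p≤∣p∣ _))))))
    where
    half≤ : ½ ^ᵠ k ≤ inv N
    half≤ = ℚ.*-cancelʳ-≤-pos (ι (suc N)) {{ι-suc-pos N}}
        (subst (½ ^ᵠ k * ι (suc N) ≤_) (trans (half-power k) (sym (inv-* N)))
      (*-monoˡ (0≤^ᵠ (ℚ.nonNegative⁻¹ ½) k) (ι-mono h)))
    large : ½ ^ᵠ suc (k ℕ.+ k) ≤ ½′ * (inv N * ½′ ^ᵠ k)
    large = subst (λ z → ½ ^ᵠ suc (k ℕ.+ k) ≤ z * (inv N * z ^ᵠ k)) (sym ½′≡½)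
      (*-monoˡ (ℚ.nonNegative⁻¹ ½) (subst (_≤ inv N * ½ ^ᵠ k) (sym (^ᵠ-+ ½ k k))
          (*-monoʳ {½ ^ᵠ k} {½ ^ᵠ k} {inv N} (0≤^ᵠ (ℚ.nonNegative⁻¹ ½) k) half≤)))

  module _ (A : ℕ) (k≤ : k ℕ.≤ 8 ℕ.* (A ℕ.∸ 1)) (2≤k : 2 ℕ.≤ k)
    (≤N : 2 ℕ.^ A ℕ.≤ suc N) (n≤ : suc (N ℕ.+ k) ℕ.≤ 2 ℕ.^ k) where

    private
      grow : ∀ c d k → c ℕ.≤ d → c ℕ.* k ℕ.≤ d ℕ.* k
      grow c d k = ℕ.*-monoˡ-≤ k

      3k≤256k : 3 ℕ.* k ℕ.≤ 256 ℕ.* k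
      3k≤256k = grow 3 256 k (ℕ.≤ᵇ⇒≤ 3 256 _)

      k≤8A : k ℕ.≤ 8 ℕ.* A
      k≤8A = ℕ.≤-trans k≤ (ℕ.*-monoʳ-≤ 8 (ℕ.m∸n≤m A 1))

      2k+1≤3k : suc (k ℕ.+ k) ℕ.≤ 3 ℕ.* k
      2k+1≤3k = ℕ.≤-trans (ℕ.+-monoˡ-≤ (k ℕ.+ k) (ℕ.<⇒≤ 2≤k)) (ℕ.+-monoʳ-≤ k (ℕ.+-monoʳ-≤ k (ℕ.m≤m+n k 0)))

    log-between : log₂ (fromℕ (suc (N ℕ.+ k))) ∈[ inv 7 * ι k , ι 256 * ι k ]
    log-between = between (log₂ (fromℕ (suc (N ℕ.+ k)))) k {A} {k} k≤8A
      (ℕ.≤-trans {k} {3 ℕ.* k} {256 ℕ.* k} (ℕ.m≤m+n k _) 3k≤256k)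
      (log₂-fromℕ-⊒ {A} {suc (N ℕ.+ k)} (ℕ.≤-trans ≤N (ℕ.m≤m+n (suc N) k)))
          (log₂-fromℕ-⊑ {k} {suc (N ℕ.+ k)} n≤)

    disc-between : disc (G N cs) (mass μ) ∈[ inv 7 * ι k , ι 256 * ι k ]
    disc-between = between (disc (G N cs) (mass μ)) k {A} {suc (k ℕ.+ k)} k≤8A
      (ℕ.≤-trans {suc (k ℕ.+ k)} {3 ℕ.* k} {256 ℕ.* k} 2k+1≤3k 3k≤256k) (disc-lower {A} ≤N) disc-upper

    D×-between : D× (G N cs) ∈[ inv 7 * ι k , ι 256 * ι k ]
    D×-between = between (D× (G N cs)) k {A ℕ.∸ 1} {depthBound k} k≤ (depthBound≤ {k} 2≤k)
        (D×-lower {A} ≤N) D×-upper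

    instance-good : Good (suc (N ℕ.+ k)) (G N cs) μ
    instance-good = record
      { κ = ι k ; D×∈ = D×-between ; disc∈ = disc-between ; log∈ = log-between ; S∈ = S-lower , S-upper }

4+m≤8+8m : ∀ m → 4 ℕ.+ m ℕ.≤ 8 ℕ.* (1 ℕ.+ m)
4+m≤8+8m m = ℕ.≤-trans (ℕ.+-mono-≤ (ℕ.m≤m+n 4 4) (ℕ.m≤m+n m _)) (ℕ.≤-reflexive (sym (ℕ.*-distribˡ-+ 8 1 m)))

record Family (n : ℕ) : Set where
  field
    f          : Word n → Bool
    μ          : Product n
    zeroBiased : ZeroBiased μ
    good       : 16 ℕ.≤ n → Good n f μ

-- Below the threshold the asymptotic claims say nothing, and the constant function with the point
-- mass at 0 fills the gap.
family : ∀ n → Family n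
family n with 16 ℕ.≤? n
... | no 16≰n = record
  { f = λ _ → false
  ; μ = record { prob-one = λ _ → 0ℝ ; prob≥0 = λ _ → ≤ᴿ-pointwise λ _ → ℚ.≤-refl ; prob≤1 = λ _ →
      ≤ᴿ-pointwise λ _ → 0≤1 }
  ; zeroBiased = λ _ → ≤ᴿ-pointwise λ _ → subst (_≤ 1ℚ - 0ℚ) ½′≡½ (proj₂ ½′-prob)
  ; good = λ 16≤n → ⊥-elim (16≰n 16≤n) }
... | yes 16≤n with parameters n 16≤n
... | record { N = N ; m = m ; size = refl ; N< = h ; ≤N = ≤N ; n≤ = n≤ } = record
  { f = G N (Instance.cs N (4 ℕ.+ m) h) ; μ = Instance.μ N (4 ℕ.+ m) h
  ; zeroBiased = Instance.zeroBiased N (4 ℕ.+ m) h ; good = λ _ → Instance.instance-good N (4 ℕ.+ m) h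
      (2 ℕ.+ m) (4+m≤8+8m m) (ℕ.s≤s (ℕ.s≤s ℕ.z≤n)) ≤N n≤ }

theorem34 : Σ[ f ∈ ((n : ℕ) → Word n → Bool) ] Σ[ μ ∈ ((n : ℕ) → Product n) ]
    ( ((n : ℕ) → ZeroBiased (μ n))
    × ((λ n → D× (f n)) =Θ (λ n → disc (f n) (mass (μ n))))
    × ((λ n → disc (f n) (mass (μ n))) =Θ (λ n → log₂ (fromℕ n)))
    × ((λ n → S 0ℚ (f n) (μ n)) =Θ (λ n → natural 1)) )
theorem34 = (λ n → f (family n)) , (λ n → μ (family n)) , (λ n → zeroBiased (family n)) ,
    Θ (λ n h → D×∈ (good (family n) h)) (λ n h → disc∈ (good (family n) h)) ,
    Θ (λ n h → disc∈ (good (family n) h)) (λ n h → log∈ (good (family n) h)) ,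
    -- Here κ is constantly 1, and both sides lie in [1, 3].
    Θ-intro {X = λ n → S 0ℚ (f (family n)) (μ (family n))} {Y = λ n → natural 1} 1ℚ (ι 3) (inv 2)
        (ι 3) {{inv-pos 2}} {{ι-suc-pos 2}} (inv-* 2) (ℚ.*-identityʳ (ι 3)) 16 (λ _ _ → 1ℚ)
      (λ n h → scale (S 0ℚ (f (family n)) (μ (family n)))
          (proj₁ (S∈ (good (family n) h)) , subst (S 0ℚ (f (family n)) (μ (family n)) ⊑_) (sym ι3)
          (proj₂ (S∈ (good (family n) h)))))
      (λ n h → scale (natural 1) (subst (natural 1 ⊒_) fromℤ-1 (natural-⊒ {1} ℕ.≤-refl) ,
          natural-⊑ {1} {3} (ℕ.s≤s ℕ.z≤n)))
  where
  open Family
  open Good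
  ι3 : ι 3 ≡ 1ℚ + (1ℚ + 1ℚ)
  ι3 = fromℤ-/1 (+ 3)
  scale : ∀ X → X ∈[ 1ℚ , ι 3 ] → X ∈[ 1ℚ * 1ℚ , ι 3 * 1ℚ ]
  scale X (l , u) = l , subst (X ⊑_) (sym (ℚ.*-identityʳ (ι 3))) u
  cb≡a : inv 7 * inv 255 * ι 256 ≡ inv 7
  cb≡a = trans (ℚ.*-assoc (inv 7) (inv 255) (ι 256)) (trans (cong (inv 7 *_) (inv-* 255))
      (ℚ.*-identityʳ (inv 7)))
  Ca≡b : ι 256 * ι 8 * inv 7 ≡ ι 256
  Ca≡b = trans (ℚ.*-assoc (ι 256) (ι 8) (inv 7)) (trans (cong (ι 256 *_)
      (trans (ℚ.*-comm (ι 8) (inv 7)) (inv-* 7))) (ℚ.*-identityʳ (ι 256)))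
  Θ : ∀ {X Y : ℕ → Cut} → (∀ n (h : 16 ℕ.≤ n) → X n ∈[ inv 7 * κ (good (family n) h) ,
      ι 256 * κ (good (family n) h) ]) →
    (∀ n (h : 16 ℕ.≤ n) → Y n ∈[ inv 7 * κ (good (family n) h) , ι 256 * κ (good (family n) h) ]) → X =Θ Y
  Θ = Θ-intro (inv 7) (ι 256) (inv 7 * inv 255) (ι 256 * ι 8)
    {{ℚ.pos*pos⇒pos (inv 7) {{inv-pos 7}} (inv 255) {{inv-pos 255}}}}
    {{ℚ.pos*pos⇒pos (ι 256) {{ι-suc-pos 255}} (ι 8) {{ι-suc-pos 7}}}}
    cb≡a Ca≡b 16 (λ n h → κ (good (family n) h))
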